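{- Let $n,m\ge1$ be integers. The vertex-face walk on the toroidal $(n,m)$-grid is periodic if and only if $\min\{n,m\}\le2$ or $n=m=4$.
   Context: Toroidal $(n,m)$-grid ($n,m\ge1$): the embedding of $C_n\square C_m$ in the torus (a multigraph with doubled edges or loops if $n$ or $m$ is $2$ or $1$). Concretely: the vertex set is $V=\mathbb{Z}_n\times\mathbb{Z}_m$; with $e_1=(1,0)$, $e_2=(0,1)$, the set $\mathcal{A}$ of arcs consists of the $4nm$ pairs $(x,s)$ with $x\in V$ and $s\in\{+e_1,-e_1,+e_2,-e_2\}$ (four formally distinct directions, even if $n$ or $m$ is $1$ or $2$), the arc $(x,s)$ having tail $x$ and head $x+s$. The face set is $F=\mathbb{Z}_n\times\mathbb{Z}_m$, where the arcs lying inside face $f$ are the four arcs $(f,+e_1)$, $(f+e_1,+e_2)$, $(f+e_1+e_2,-e_1)$, $(f+e_2,-e_2)$ (the boundary walk of the unit square with corner $f$); each arc lies inside exactly one face. Vertex-face walk: $N\in\mathbb{R}^{\mathcal{A}\times V}$ has $N(a,x)=\frac12$ if $x$ is the tail of $a$ and $0$ otherwise; $M\in\mathbb{R}^{\mathcal{A}\times F}$ has $M(a,f)=\frac12$ if $a$ lies inside $f$ and $0$ otherwise. The transition matrix is $U=(2MM^T-I)(2NN^T-I)$. The walk is periodic at vertex $x$ if there are an integer $t>0$ and $\gamma\in\mathbb{C}$ with $|\gamma|=1$ such that $U^tN\mathbf{e}_x=\gamma N\mathbf{e}_x$. The walk on the grid is called periodic if it is periodic at every vertex; for toroidal grids this is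 equivalent to periodicity at one vertex, and also to $U^\tau=I$ for some integer $\tau>0$. -}

module Defs where

open import Algebra.Bundles using (CommutativeMonoid)
open import Algebra.Bundles.Raw using (RawMonoid)
import Algebra.Definitions.RawMonoid as MonoidSum
import Algebra.Properties.CommutativeSemigroup as CommutativeSemigroup
open import Data.Bool.Base using (if_then_else_)
open import Data.Fin.Base using (Fin; toℕ)
open import Data.Fin.Patterns using (0F; 1F; 2F; 3F)
import Data.Fin.Properties as Fin
open import Data.List.Base using (List; []; _∷_)
import Data.List.Membership.DecPropositional as DecMembership
open import Data.Nat.Base as ℕ using (ℕ; zero; suc; NonZero)
open import Data.Nat.DivMod using (_mod_)
import Data.Nat.Properties as ℕ
open import Data.Product.Base using (Σ; ∃; _×_; _,_; proj₁; proj₂; map₁; map₂)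
import Data.Product.Properties as Product
open import Data.Rational.Base as ℚ
  using (ℚ; 0ℚ; 1ℚ; ½; ∣_∣; 1/_; Positive; positive)
import Data.Rational.Properties as ℚ
open import Level using (0ℓ)
open import Relation.Binary.Definitions using (DecidableEquality)
open import Relation.Binary.PropositionalEquality
  using (_≡_; sym; trans; cong; cong₂; subst; module ≡-Reasoning)
open import Relation.Nullary.Decidable using (does)

------------------------------------------------------------------------
-- Real numbers as Cauchy sequences of rationals (a setoid under _≈_)

IsCauchy : (ℕ → ℚ) → Set
IsCauchy u = ∀ ε → 0ℚ ℚ.< ε →
  ∃ λ K → ∀ i j → K ℕ.≤ i → K ℕ.≤ j → ∣ u i ℚ.- u j ∣ ℚ.< ε

record ℝ : Set where
  constructor mkℝ
  field
    seq    : ℕ → ℚ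
    cauchy : IsCauchy seq

open ℝ public

infix 4 _≈_

_≈_ : ℝ → ℝ → Set
x ≈ y = ∀ ε → 0ℚ ℚ.< ε →
  ∃ λ K → ∀ i → K ℕ.≤ i → ∣ seq x i ℚ.- seq y i ∣ ℚ.< ε

abstract

  private

    open CommutativeSemigroup
      (CommutativeMonoid.commutativeSemigroup ℚ.+-0-commutativeMonoid)
      using (interchange)

    half>0 : ∀ {ε} → 0ℚ ℚ.< ε → 0ℚ ℚ.< ½ ℚ.* ε
    half>0 {ε} 0<ε = subst (ℚ._< ½ ℚ.* ε) (ℚ.*-zeroʳ ½) (ℚ.*-monoʳ-<-pos ½ 0<ε)

    half+half : ∀ ε → ½ ℚ.* ε ℚ.+ ½ ℚ.* ε ≡ ε
    half+half ε = trans (sym (ℚ.*-distribʳ-+ ε ½ ½)) (ℚ.*-identityˡ ε)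

    cancel : ∀ p q → (p ℚ.- q) ℚ.+ q ≡ p
    cancel p q = trans (ℚ.+-assoc p (ℚ.- q) q)
      (trans (cong (p ℚ.+_) (ℚ.+-inverseˡ q)) (ℚ.+-identityʳ p))

    telescope : ∀ p q r → (p ℚ.- q) ℚ.+ (q ℚ.- r) ≡ p ℚ.- r
    telescope p q r = trans (sym (ℚ.+-assoc (p ℚ.- q) q (ℚ.- r)))
      (cong (ℚ._- r) (cancel p q))

    -- An eventual bound, which is all the product needs.
    bounded : ∀ u → IsCauchy u →
      ∃ λ K → Σ ℚ λ B → Positive B × (∀ i → K ℕ.≤ i → ∣ u i ∣ ℚ.≤ B)
    bounded u cu with cu 1ℚ (ℚ.positive⁻¹ 1ℚ)
    ... | K , h = K , B , positive 0<B , bound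
      where
      B : ℚ
      B = 1ℚ ℚ.+ ∣ u K ∣
      0<B : 0ℚ ℚ.< B
      0<B = ℚ.+-mono-<-≤ (ℚ.positive⁻¹ 1ℚ) (ℚ.0≤∣p∣ (u K))
      bound : ∀ i → K ℕ.≤ i → ∣ u i ∣ ℚ.≤ B
      bound i K≤i = begin
        ∣ u i ∣                       ≡⟨ cong ∣_∣ (sym (cancel (u i) (u K))) ⟩
        ∣ (u i ℚ.- u K) ℚ.+ u K ∣     ≤⟨ ℚ.∣p+q∣≤∣p∣+∣q∣ (u i ℚ.- u K) (u K) ⟩
        ∣ u i ℚ.- u K ∣ ℚ.+ ∣ u K ∣   ≤⟨ ℚ.+-monoˡ-≤ ∣ u K ∣ (ℚ.<⇒≤ (h i K K≤i ℕ.≤-refl)) ⟩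
        B                             ∎
        where open ℚ.≤-Reasoning

    -- B δ with δ = ε / B
    scale : ∀ ε B .{{_ : Positive B}} → 0ℚ ℚ.< ε →
      Σ ℚ λ δ → 0ℚ ℚ.< δ × B ℚ.* δ ≡ ε
    scale ε B 0<ε = 1/B ℚ.* ε , 0<δ , eq
      where
      instance
        B≢0 : ℚ.NonZero B
        B≢0 = ℚ.pos⇒nonZero B
      1/B : ℚ
      1/B = 1/ B
      0<δ : 0ℚ ℚ.< 1/B ℚ.* ε
      0<δ = subst (ℚ._< 1/B ℚ.* ε) (ℚ.*-zeroʳ 1/B)
              (ℚ.*-monoʳ-<-pos 1/B {{ℚ.1/pos⇒pos B}} 0<ε)
      eq : B ℚ.* (1/B ℚ.* ε) ≡ ε
      eq = trans (sym (ℚ.*-assoc B 1/B ε))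
             (trans (cong (ℚ._* ε) (ℚ.*-inverseʳ B)) (ℚ.*-identityˡ ε))

  const-cauchy : ∀ q → IsCauchy (λ _ → q)
  const-cauchy q ε 0<ε =
    0 , λ _ _ _ _ → subst (ℚ._< ε) (cong ∣_∣ (sym (ℚ.+-inverseʳ q))) 0<ε

  +-cauchy : ∀ u v → IsCauchy u → IsCauchy v → IsCauchy (λ i → u i ℚ.+ v i)
  +-cauchy u v cu cv ε 0<ε
    with cu (½ ℚ.* ε) (half>0 0<ε) | cv (½ ℚ.* ε) (half>0 0<ε)
  ... | K , hu | L , hv = K ℕ.⊔ L , close
    where
    rearrange : ∀ p q r s → (p ℚ.+ q) ℚ.- (r ℚ.+ s) ≡ (p ℚ.- r) ℚ.+ (q ℚ.- s)
    rearrange p q r s = trans (cong (p ℚ.+ q ℚ.+_) (ℚ.neg-distrib-+ r s))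
      (interchange p q (ℚ.- r) (ℚ.- s))
    close : ∀ i j → K ℕ.⊔ L ℕ.≤ i → K ℕ.⊔ L ℕ.≤ j →
            ∣ (u i ℚ.+ v i) ℚ.- (u j ℚ.+ v j) ∣ ℚ.< ε
    close i j ≤i ≤j = begin-strict
      ∣ (u i ℚ.+ v i) ℚ.- (u j ℚ.+ v j) ∣     ≡⟨ cong ∣_∣ (rearrange (u i) (v i) (u j) (v j)) ⟩
      ∣ (u i ℚ.- u j) ℚ.+ (v i ℚ.- v j) ∣     ≤⟨ ℚ.∣p+q∣≤∣p∣+∣q∣ (u i ℚ.- u j) (v i ℚ.- v j) ⟩
      ∣ u i ℚ.- u j ∣ ℚ.+ ∣ v i ℚ.- v j ∣     <⟨ ℚ.+-mono-<
                                                   (hu i j (ℕ.m⊔n≤o⇒m≤o K L ≤i) (ℕ.m⊔n≤o⇒m≤o K L ≤j))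
                                                   (hv i j (ℕ.m⊔n≤o⇒n≤o K L ≤i) (ℕ.m⊔n≤o⇒n≤o K L ≤j)) ⟩
      ½ ℚ.* ε ℚ.+ ½ ℚ.* ε                     ≡⟨ half+half ε ⟩
      ε                                       ∎
      where open ℚ.≤-Reasoning

  neg-cauchy : ∀ u → IsCauchy u → IsCauchy (λ i → ℚ.- u i)
  neg-cauchy u cu ε 0<ε with cu ε 0<ε
  ... | K , h = K , λ i j K≤i K≤j →
    subst (ℚ._< ε)
      (trans (sym (ℚ.∣-p∣≡∣p∣ (u i ℚ.- u j))) (cong ∣_∣ (ℚ.neg-distrib-+ (u i) (ℚ.- u j))))
      (h i j K≤i K≤j)

  *-cauchy : ∀ u v → IsCauchy u → IsCauchy v → IsCauchy (λ i → u i ℚ.* v i)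
  *-cauchy u v cu cv ε 0<ε with bounded u cu | bounded v cv
  ... | Ku , Bu , pu , bu | Kv , Bv , pv , bv
    with scale (½ ℚ.* ε) Bu {{pu}} (half>0 0<ε) | scale (½ ℚ.* ε) Bv {{pv}} (half>0 0<ε)
  ... | δ , 0<δ , Bδ | η , 0<η , Bη with cv δ 0<δ | cu η 0<η
  ... | Lv , hv | Lu , hu = (Ku ℕ.⊔ Kv) ℕ.⊔ (Lv ℕ.⊔ Lu) , close
    where
    module _ {i} (K≤i : (Ku ℕ.⊔ Kv) ℕ.⊔ (Lv ℕ.⊔ Lu) ℕ.≤ i) where
      Ku≤ : Ku ℕ.≤ i
      Ku≤ = ℕ.m⊔n≤o⇒m≤o Ku Kv (ℕ.m⊔n≤o⇒m≤o (Ku ℕ.⊔ Kv) (Lv ℕ.⊔ Lu) K≤i)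
      Kv≤ : Kv ℕ.≤ i
      Kv≤ = ℕ.m⊔n≤o⇒n≤o Ku Kv (ℕ.m⊔n≤o⇒m≤o (Ku ℕ.⊔ Kv) (Lv ℕ.⊔ Lu) K≤i)
      Lv≤ : Lv ℕ.≤ i
      Lv≤ = ℕ.m⊔n≤o⇒m≤o Lv Lu (ℕ.m⊔n≤o⇒n≤o (Ku ℕ.⊔ Kv) (Lv ℕ.⊔ Lu) K≤i)
      Lu≤ : Lu ℕ.≤ i
      Lu≤ = ℕ.m⊔n≤o⇒n≤o Lv Lu (ℕ.m⊔n≤o⇒n≤o (Ku ℕ.⊔ Kv) (Lv ℕ.⊔ Lu) K≤i)
    rearrange : ∀ p q r s → p ℚ.* q ℚ.- r ℚ.* s ≡ p ℚ.* (q ℚ.- s) ℚ.+ s ℚ.* (p ℚ.- r)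
    rearrange p q r s = sym (begin
      p ℚ.* (q ℚ.- s) ℚ.+ s ℚ.* (p ℚ.- r)
        ≡⟨ cong₂ ℚ._+_ (distrib p q s) (trans (distrib s p r)
             (cong₂ ℚ._-_ (ℚ.*-comm s p) (ℚ.*-comm s r))) ⟩
      (p ℚ.* q ℚ.- p ℚ.* s) ℚ.+ (p ℚ.* s ℚ.- r ℚ.* s)
        ≡⟨ telescope (p ℚ.* q) (p ℚ.* s) (r ℚ.* s) ⟩
      p ℚ.* q ℚ.- r ℚ.* s ∎)
      where
      open ≡-Reasoning
      distrib : ∀ a b c → a ℚ.* (b ℚ.- c) ≡ a ℚ.* b ℚ.- a ℚ.* c
      distrib a b c = trans (ℚ.*-distribˡ-+ a b (ℚ.- c))
        (cong (a ℚ.* b ℚ.+_) (sym (ℚ.neg-distribʳ-* a c)))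
    estimate : ∀ {p q B γ} → Positive B → ∣ p ∣ ℚ.≤ B → ∣ q ∣ ℚ.< γ → ∣ p ℚ.* q ∣ ℚ.< B ℚ.* γ
    estimate {p} {q} {B} {γ} B>0 p≤B q<γ = begin-strict
      ∣ p ℚ.* q ∣       ≡⟨ ℚ.∣p*q∣≡∣p∣*∣q∣ p q ⟩
      ∣ p ∣ ℚ.* ∣ q ∣   ≤⟨ ℚ.*-monoʳ-≤-nonNeg ∣ q ∣ {{ℚ.∣-∣-nonNeg q}} p≤B ⟩
      B ℚ.* ∣ q ∣       <⟨ ℚ.*-monoʳ-<-pos B {{B>0}} q<γ ⟩
      B ℚ.* γ           ∎
      where open ℚ.≤-Reasoning
    close : ∀ i j → (Ku ℕ.⊔ Kv) ℕ.⊔ (Lv ℕ.⊔ Lu) ℕ.≤ i →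
            (Ku ℕ.⊔ Kv) ℕ.⊔ (Lv ℕ.⊔ Lu) ℕ.≤ j → ∣ u i ℚ.* v i ℚ.- u j ℚ.* v j ∣ ℚ.< ε
    close i j K≤i K≤j = begin-strict
      ∣ u i ℚ.* v i ℚ.- u j ℚ.* v j ∣
        ≡⟨ cong ∣_∣ (rearrange (u i) (v i) (u j) (v j)) ⟩
      ∣ u i ℚ.* (v i ℚ.- v j) ℚ.+ v j ℚ.* (u i ℚ.- u j) ∣
        ≤⟨ ℚ.∣p+q∣≤∣p∣+∣q∣ (u i ℚ.* (v i ℚ.- v j)) (v j ℚ.* (u i ℚ.- u j)) ⟩
      ∣ u i ℚ.* (v i ℚ.- v j) ∣ ℚ.+ ∣ v j ℚ.* (u i ℚ.- u j) ∣
        <⟨ ℚ.+-mono-< (estimate {u i} pu (bu i (Ku≤ K≤i)) (hv i j (Lv≤ K≤i) (Lv≤ K≤j)))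
                      (estimate {v j} pv (bv j (Kv≤ K≤j)) (hu i j (Lu≤ K≤i) (Lu≤ K≤j))) ⟩
      Bu ℚ.* δ ℚ.+ Bv ℚ.* η
        ≡⟨ cong₂ ℚ._+_ Bδ Bη ⟩
      ½ ℚ.* ε ℚ.+ ½ ℚ.* ε
        ≡⟨ half+half ε ⟩
      ε ∎
      where open ℚ.≤-Reasoning

fromℚ : ℚ → ℝ
fromℚ q = mkℝ (λ _ → q) (const-cauchy q)

0ℝ 1ℝ ½ℝ : ℝ
0ℝ = fromℚ 0ℚ
1ℝ = fromℚ 1ℚ
½ℝ = fromℚ ½

infixl 6 _+_ _-_
infixl 7 _*_
infix  8 -_

_+_ : ℝ → ℝ → ℝ
x + y = mkℝ (λ i → seq x i ℚ.+ seq y i) (+-cauchy (seq x) (seq y) (cauchy x) (cauchy y))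

-_ : ℝ → ℝ
- x = mkℝ (λ i → ℚ.- seq x i) (neg-cauchy (seq x) (cauchy x))

_-_ : ℝ → ℝ → ℝ
x - y = x + (- y)

_*_ : ℝ → ℝ → ℝ
x * y = mkℝ (λ i → seq x i ℚ.* seq y i) (*-cauchy (seq x) (seq y) (cauchy x) (cauchy y))

+-rawMonoid : RawMonoid 0ℓ 0ℓ
+-rawMonoid = record { Carrier = ℝ ; _≈_ = _≈_ ; _∙_ = _+_ ; ε = 0ℝ }

open MonoidSum +-rawMonoid public using (sum)

------------------------------------------------------------------------
-- Complex numbers

record ℂ : Set where
  constructor _+i_
  field
    re im : ℝ

open ℂ public

infix 4 _≈ᶜ_

_≈ᶜ_ : ℂ → ℂ → Set
z ≈ᶜ w = re z ≈ re w × im z ≈ im w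

fromℝ : ℝ → ℂ
fromℝ x = x +i 0ℝ

infixl 7 _*ᶜ_

_*ᶜ_ : ℂ → ℂ → ℂ
z *ᶜ w = (re z * re w - im z * im w) +i (re z * im w + im z * re w)

-- |γ| = 1, written without the square root as |γ|² = 1.
Unimodular : ℂ → Set
Unimodular γ = re γ * re γ + im γ * im γ ≈ 1ℝ

------------------------------------------------------------------------
-- Real matrices and vectors with arbitrary index types. Where a
-- contraction is needed, the summation over the index type is passed in.

Mat : Set → Set → Set
Mat X Y = X → Y → ℝ

Summation : Set → Set
Summation X = (X → ℝ) → ℝ

infix 9 _ᵀ

_ᵀ : ∀ {X Y} → Mat X Y → Mat Y X
(A ᵀ) y x = A x y

mul : ∀ {X Y Z} → Summation Y → Mat X Y → Mat Y Z → Mat X Z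
mul Σʸ A B x z = Σʸ λ y → A x y * B y z

apply : ∀ {X Y} → Summation Y → Mat X Y → (Y → ℝ) → (X → ℝ)
apply Σʸ A v x = Σʸ λ y → A x y * v y

module _ {X : Set} (_≟_ : DecidableEquality X) where

  identity : Mat X X
  identity x y = if does (x ≟ y) then 1ℝ else 0ℝ

  -- 2P − I
  reflection : Mat X X → Mat X X
  reflection P x y = (1ℝ + 1ℝ) * P x y - identity x y

  power : Summation X → Mat X X → ℕ → Mat X X
  power Σˣ A zero    = identity
  power Σˣ A (suc t) = mul Σˣ A (power Σˣ A t)

------------------------------------------------------------------------
-- The toroidal (n , m)-grid. Fin k carries the arithmetic of ℤ/k.

cyclicSuc cyclicPred : ∀ {k} .{{_ : NonZero k}} → Fin k → Fin k
cyclicSuc  {k} i = suc (toℕ i) mod k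
cyclicPred {k} i = (toℕ i ℕ.+ ℕ.pred k) mod k

Dir : Set
Dir = Fin 4

pattern +e₁ = 0F
pattern -e₁ = 1F
pattern +e₂ = 2F
pattern -e₂ = 3F

module Grid (n m : ℕ) .{{_ : NonZero n}} .{{_ : NonZero m}} where

  Vertex Face Arc : Set
  Vertex = Fin n × Fin m
  Face   = Fin n × Fin m
  Arc    = Vertex × Dir

  tail : Arc → Vertex
  tail = proj₁

  head : Arc → Vertex
  head (x , +e₁) = map₁ cyclicSuc  x
  head (x , -e₁) = map₁ cyclicPred x
  head (x , +e₂) = map₂ cyclicSuc  x
  head (x , -e₂) = map₂ cyclicPred x

  infixl 6 _⊕_

  _⊕_ : Vertex → Dir → Vertex
  x ⊕ s = head (x , s)

  arcsInside : Face → List Arc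
  arcsInside f = (f             , +e₁)
               ∷ (f ⊕ +e₁       , +e₂)
               ∷ (f ⊕ +e₁ ⊕ +e₂ , -e₁)
               ∷ (f ⊕ +e₂       , -e₂)
               ∷ []

  _≟ⱽ_ : DecidableEquality Vertex
  _≟ⱽ_ = Product.≡-dec Fin._≟_ Fin._≟_

  _≟ᴬ_ : DecidableEquality Arc
  _≟ᴬ_ = Product.≡-dec _≟ⱽ_ Fin._≟_

  open DecMembership _≟ᴬ_ using (_∈?_)

  Σⱽ : Summation Vertex
  Σⱽ f = sum λ i → sum λ j → f (i , j)

  Σᶠ : Summation Face
  Σᶠ f = sum λ i → sum λ j → f (i , j)

  Σᴬ : Summation Arc
  Σᴬ f = Σⱽ λ x → sum λ s → f (x , s)

  N : Mat Arc Vertex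
  N a x = if does (tail a ≟ⱽ x) then ½ℝ else 0ℝ

  M : Mat Arc Face
  M a f = if does (a ∈? arcsInside f) then ½ℝ else 0ℝ

  U : Mat Arc Arc
  U = mul Σᴬ (reflection _≟ᴬ_ (mul Σᶠ M (M ᵀ)))
             (reflection _≟ᴬ_ (mul Σⱽ N (N ᵀ)))

  e : Vertex → (Vertex → ℝ)
  e = identity _≟ⱽ_

  PeriodicAt : Vertex → Set
  PeriodicAt x = ∃ λ t → 0 ℕ.< t × (∃ λ γ → Unimodular γ ×
    (∀ a → fromℝ (apply Σᴬ (power _≟ᴬ_ Σᴬ U t) (apply Σⱽ N (e x)) a)
             ≈ᶜ γ *ᶜ fromℝ (apply Σⱽ N (e x) a)))

  Periodic : Set
  Periodic = ∀ x → PeriodicAt x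

{-# OPTIONS --safe #-}
module Submission where

-- Notation: s₁ and s₂ are the two coordinate shifts, acting on functions on the vertices (which are
-- identified with the faces), and 𝒜 = (2 + s₁ + s₁⁻¹)(2 + s₂ + s₂⁻¹).  All entries of N, M and U are
-- rational, so everything is done over ℚ: a real matrix is replaced by the operator that the i-th
-- approximations to its entries define, for a fixed i.  The key relation is a three-term recurrence
-- of Chebyshev type (chebyshev):
--
--   U N (𝒜 φ) = 4 (U² N φ + 2 U N φ + N φ).
--
-- Necessity.  Since U and N are rational, periodicity forces the phases to be 1 or −1, so that
-- U^T N = N for some exponent T > 0 (periodic⇒fixed).  If φ is integer valued, the recurrence shows
-- that 4^k clears the denominators of 2 U^k N φ, and by periodicity 4^T clears them for all k at
-- once.  Reading the recurrence in the other direction, 4^T 𝒜^j φ is divisible by 4^j for all j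
-- (𝒜^-divisible).  For φ = g ⊗ h the function 𝒜^j φ is X^j g ⊗ X^j h, where X = 2 + s + s⁻¹ on each
-- cycle.  It remains to find values of X^j g that are not very divisible by 2, for j a power of two
-- and a cycle of length n ≥ 3 (value, small-value):
--
--   * if n does not divide 2j, some value is odd, because X^j ≡ s^j + s^(−j) modulo 2 (frobenius);
--   * if 8 divides n, some value has 2-adic valuation j/2, because X acts like multiplication by
--     2 + √2 on some functions of period 8;
--   * if n = 4, some value has 2-adic valuation j, because X is multiplication by 2 on functions
--     with s² = −1.
--
-- An n ≥ 3 that divides a power of two is 4 or a multiple of 8.  So if n, m ≥ 3 are not both 4, some
-- value of some 𝒜^j φ has valuation at most 3j/2, and 2j ≤ 2T + 3j/2 fails for large j (not-fixed).
--
-- Sufficiency.  Functions are decomposed according to the action of s₁ and s₂.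
-- If s₁ φ = −φ, then U N φ = −N φ (antiinvariant⇒fixed).  If s₁ φ = φ, put D = M − N; then
-- U N φ = N s₂ φ + D (φ + s₂ φ) and U D φ = D s₂⁻¹ φ, and the D-terms of U^m N φ add up to D of an
-- invariant function, which is 0; hence U^m N φ = N φ (invariant⇒fixed).  This settles n ≤ 2, where
-- s₁² = 1, with period 2m.  If n = m = 4, the only further case is s₁² φ = s₂² φ = −φ
-- (quarter-turns⇒fixed): there 𝒜 φ = 4 φ, so U² N φ + U N φ + N φ = 0 and U³ N φ = N φ.  Altogether 12
-- is a period.

open import Data.Nat.Base using (ℕ; NonZero; _⊓_; _≤_)
open import Data.Product.Base using (_×_)
open import Data.Sum.Base using (_⊎_)
open import Function.Bundles using (_⇔_)
open import Relation.Binary.PropositionalEquality using (_≡_)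
open import Defs using (module Grid)

open import Algebra.Bundles using (CommutativeRing)
import Algebra.Properties.Semiring.Sum as SemiringSum
open import Data.Bool.Base using (true; false; if_then_else_)
open import Data.Fin.Base using (Fin; zero; suc; toℕ)
open import Data.Fin.Patterns using (0F; 1F; 2F; 3F)
import Data.Fin.Properties as Fin
open import Data.Integer.Base as ℤ using (ℤ; +_; 0ℤ; 1ℤ)
import Data.Integer.Properties as ℤ
open import Data.Integer.Tactic.RingSolver using (solve-∀)
import Data.List.Membership.DecPropositional as DecMembership
open import Data.List.Membership.Propositional using (_∈_)
open import Data.List.Relation.Unary.Any using (here; there)
open import Data.Nat.Base as ℕ using (_<_; zero; suc)
open import Data.Nat.Divisibility as ℕ using (divides)
open import Data.Nat.DivMod as ℕ using (_%_; _/_; _mod_)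
open import Data.Nat.GeneralisedArithmetic using (fold; fold-+)
import Data.Nat.Properties as ℕ
open import Data.Product.Base using (_,_; proj₁; proj₂; map₁; map₂; ∃)
open import Data.Rational.Base as ℚ
  using (ℚ; 0ℚ; 1ℚ; ½; _+_; _*_; _-_; -_; ∣_∣; 1/_; Positive; positive; toℚᵘ; fromℚᵘ)
import Data.Rational.Properties as ℚ
open import Data.Rational.Solver using (module +-*-Solver)
open import Data.Rational.Unnormalised.Base as ℚᵘ using (mkℚᵘ; *≡*)
import Data.Rational.Unnormalised.Properties as ℚᵘ
open import Data.Sum.Base using (inj₁; inj₂; [_,_]′)
open import Defs using
  (ℝ; seq; re; im; _+i_; 0ℝ; 1ℝ; ½ℝ; Mat; Summation; _ᵀ; mul; apply; identity; reflection;
   power; cyclicSuc; cyclicPred; Dir)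
open import Function.Base using (_∘_; id)
open import Function.Bundles using (mk⇔)
open import Relation.Binary.Definitions using (DecidableEquality)
open import Relation.Binary.PropositionalEquality
  using (_≢_; _≗_; refl; sym; trans; cong; cong₂; cong-app; subst; module ≡-Reasoning)
open import Relation.Nullary.Decidable using (Dec; yes; no; does; _×-dec_)
open import Relation.Nullary.Negation using (¬_; contradiction)

open +-*-Solver using (solve; _:=_; _:+_; _:*_; _:-_; :-_; con)
open SemiringSum (CommutativeRing.semiring ℚ.+-*-commutativeRing)
  using (sum; sum-cong-≗; ∑-distrib-+; *-distribˡ-sum)

------------------------------------------------------------------------
-- The walk in terms of two commuting shifts

-- Iteration; used for shifts as well as for powers of operators.
infixr 9 _^_

_^_ : ∀ {X : Set} → (X → X) → ℕ → X → X
(f ^ k) x = fold x f k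

^-comm : ∀ {X : Set} (f : X → X) k x → (f ^ k) (f x) ≡ f ((f ^ k) x)
^-comm f zero    x = refl
^-comm f (suc k) x = cong f (^-comm f k x)

^-cong : ∀ {X : Set} {f g : X → X} → f ≗ g → ∀ j → f ^ j ≗ g ^ j
^-cong e zero    x = refl
^-cong {g = g} e (suc j) x = trans (e _) (cong g (^-cong e j x))

2ℚ 4ℚ : ℚ
2ℚ = 1ℚ + 1ℚ
4ℚ = 2ℚ + 2ℚ

-- The operator (1 + f)(1 + g): the sum over the corners x, f x, g x, f (g x) of a square.
corners : ∀ {V : Set} → (V → V) → (V → V) → (V → ℚ) → V → ℚ
corners f g φ x = (φ x + φ (f x)) + (φ (g x) + φ (f (g x)))

corners-cong : ∀ {V : Set} (f g : V → V) {φ φ′} → φ ≗ φ′ → corners f g φ ≗ corners f g φ′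
corners-cong f g e x = cong₂ _+_ (cong₂ _+_ (e _) (e _)) (cong₂ _+_ (e _) (e _))

corners-swap : ∀ {V : Set} (f g : V → V) → (∀ x → f (g x) ≡ g (f x)) →
  ∀ φ → corners f g φ ≗ corners g f φ
corners-swap f g fg φ x = trans
  (cong (λ y → (φ x + φ (f x)) + (φ (g x) + φ y)) (fg x))
  (solve 4 (λ p q r s → (p :+ q) :+ (r :+ s) := (p :+ r) :+ (q :+ s)) refl
    (φ x) (φ (f x)) (φ (g x)) (φ (g (f x))))

-- What the argument uses of a vertex-face walk: V stands for the vertices and for the faces, A for
-- the arcs, a and b for the unit translations in the two directions.  The states N φ and M w of the
-- walk are represented, without their factor ½, by φ ∘ tail and w ∘ face.  The formulas for U
-- follow from U = (2 M Mᵀ − I)(2 N Nᵀ − I) together with 4 Mᵀ N = corners a b.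
record Walk (V A : Set) : Set where
  field
    a a⁻ b b⁻ : V → V
    a-a⁻  : ∀ x → a (a⁻ x) ≡ x
    a⁻-a  : ∀ x → a⁻ (a x) ≡ x
    b-b⁻  : ∀ x → b (b⁻ x) ≡ x
    b⁻-b  : ∀ x → b⁻ (b x) ≡ x
    ab≡ba : ∀ x → a (b x) ≡ b (a x)
    tail face : A → V
    U      : (A → ℚ) → A → ℚ
    U-cong : ∀ {ψ ψ′ : A → ℚ} → ψ ≗ ψ′ → U ψ ≗ U ψ′
    U-lin  : ∀ c ψ d ψ′ α → U (λ β → c * ψ β + d * ψ′ β) α ≡ c * U ψ α + d * U ψ′ α
    U-tail : ∀ φ α → U (φ ∘ tail) α ≡ ½ * corners a b φ (face α) - φ (tail α)
    U-face : ∀ w α → U (w ∘ face) α ≡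
      (½ * (½ * corners a b (corners a⁻ b⁻ w) (face α)) - ½ * corners a⁻ b⁻ w (tail α))
        - w (face α)
    -- The tail and the face of an arc differ by a translation.
    invariant : ∀ (θ : V → ℚ) → θ ∘ a ≗ θ → θ ∘ b ≗ θ → ∀ α → θ (face α) ≡ θ (tail α)

-- What commutes with a bijection commutes with its inverse.
commute-inverse : ∀ {V : Set} (f f⁻ g : V → V) →
  (∀ x → f (f⁻ x) ≡ x) → (∀ x → f⁻ (f x) ≡ x) → (∀ x → f (g x) ≡ g (f x)) →
  ∀ x → f⁻ (g x) ≡ g (f⁻ x)
commute-inverse f f⁻ g ff⁻ f⁻f fg x = begin
  f⁻ (g x)              ≡⟨ cong (f⁻ ∘ g) (ff⁻ x) ⟨
  f⁻ (g (f (f⁻ x)))     ≡⟨ cong f⁻ (fg (f⁻ x)) ⟨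
  f⁻ (f (g (f⁻ x)))     ≡⟨ f⁻f _ ⟩
  g (f⁻ x)              ∎
  where open ≡-Reasoning

module WalkProperties {V A : Set} (W : Walk V A) where
  open Walk W public

  -- The operators 4 Mᵀ N and 4 Nᵀ M.
  P Q : (V → ℚ) → V → ℚ
  P = corners a b
  Q = corners a⁻ b⁻

  a⁻b≡ba⁻ : ∀ x → a⁻ (b x) ≡ b (a⁻ x)
  a⁻b≡ba⁻ = commute-inverse a a⁻ b a-a⁻ a⁻-a ab≡ba

  b⁻a≡ab⁻ : ∀ x → b⁻ (a x) ≡ a (b⁻ x)
  b⁻a≡ab⁻ = commute-inverse b b⁻ a b-b⁻ b⁻-b (sym ∘ ab≡ba)

  a⁻b⁻≡b⁻a⁻ : ∀ x → a⁻ (b⁻ x) ≡ b⁻ (a⁻ x)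
  a⁻b⁻≡b⁻a⁻ = commute-inverse a a⁻ b⁻ a-a⁻ a⁻-a (sym ∘ b⁻a≡ab⁻)

  -- The same walk with the two coordinate directions exchanged.
  swap : Walk V A
  swap = record
    { a = b ; a⁻ = b⁻ ; b = a ; b⁻ = a⁻
    ; a-a⁻ = b-b⁻ ; a⁻-a = b⁻-b ; b-b⁻ = a-a⁻ ; b⁻-b = a⁻-a
    ; ab≡ba = sym ∘ ab≡ba
    ; tail = tail ; face = face ; U = U ; U-cong = U-cong ; U-lin = U-lin
    ; U-tail = λ φ α → trans (U-tail φ α)
        (cong (λ z → ½ * z - φ (tail α)) (corners-swap a b ab≡ba φ (face α)))
    ; U-face = λ w α → trans (U-face w α)
        (cong₂ (λ y z → (½ * (½ * y) - ½ * z) - w (face α))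
          (trans (corners-swap a b ab≡ba (Q w) (face α))
                 (corners-cong b a (corners-swap a⁻ b⁻ a⁻b⁻≡b⁻a⁻ w) (face α)))
          (corners-swap a⁻ b⁻ a⁻b⁻≡b⁻a⁻ w (tail α)))
    ; invariant = λ θ ia ib → invariant θ ib ia
    }

  U^-cong : ∀ k {ψ ψ′ : A → ℚ} → ψ ≗ ψ′ → (U ^ k) ψ ≗ (U ^ k) ψ′
  U^-cong zero    e = e
  U^-cong (suc k) e = U-cong (U^-cong k e)

  U^-lin : ∀ k c ψ d ψ′ α →
    (U ^ k) (λ β → c * ψ β + d * ψ′ β) α ≡ c * (U ^ k) ψ α + d * (U ^ k) ψ′ α
  U^-lin zero    c ψ d ψ′ α = refl
  U^-lin (suc k) c ψ d ψ′ α = trans (U-cong (U^-lin k c ψ d ψ′) α) (U-lin c _ d _ α)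

  U^-step : ∀ k ψ → (U ^ k) (U ψ) ≗ (U ^ suc k) ψ
  U^-step k ψ α = cong-app (^-comm U k ψ) α

  -- The operator 2 + s + s⁻¹.
  X : (V → V) → (V → V) → (V → ℚ) → V → ℚ
  X s s⁻ φ x = (φ x + φ x) + (φ (s x) + φ (s⁻ x))

  -- The operator 16 Nᵀ M Mᵀ N.
  𝒜 : (V → ℚ) → V → ℚ
  𝒜 φ = X a a⁻ (X b b⁻ φ)

  Q-P : ∀ φ → Q (P φ) ≗ 𝒜 φ
  Q-P φ x
    rewrite sym (ab≡ba x) | a-a⁻ x | b-b⁻ x | a-a⁻ (b⁻ x) | sym (a⁻b≡ba⁻ x) | a-a⁻ (b x)
          | b⁻a≡ab⁻ x | sym (a⁻b⁻≡b⁻a⁻ x) | sym (a⁻b≡ba⁻ (b⁻ x)) | b-b⁻ x | a-a⁻ x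
    = solve 9 (λ x a a⁻ b b⁻ ab a⁻b ab⁻ a⁻b⁻ →
        (((x :+ a) :+ (b :+ ab)) :+ ((a⁻ :+ x) :+ (a⁻b :+ b))) :+
        (((b⁻ :+ ab⁻) :+ (x :+ a)) :+ ((a⁻b⁻ :+ b⁻) :+ (a⁻ :+ x)))
        := (((x :+ x) :+ (b :+ b⁻)) :+ ((x :+ x) :+ (b :+ b⁻)))
           :+ (((a :+ a) :+ (ab :+ ab⁻)) :+ ((a⁻ :+ a⁻) :+ (a⁻b :+ a⁻b⁻))))
        refl (φ x) (φ (a x)) (φ (a⁻ x)) (φ (b x)) (φ (b⁻ x)) (φ (a (b x)))
          (φ (a⁻ (b x))) (φ (a (b⁻ x))) (φ (a⁻ (b⁻ x)))

  U-tail′ : ∀ φ → U (φ ∘ tail) ≗ λ β → ½ * P φ (face β) + (- 1ℚ) * φ (tail β)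
  U-tail′ φ α = trans (U-tail φ α)
    (solve 2 (λ p q → p :- q := p :+ con (- 1ℚ) :* q) refl (½ * P φ (face α)) (φ (tail α)))

  -- The three-term recurrence of the walk.
  chebyshev : ∀ φ α → U (𝒜 φ ∘ tail) α ≡
    4ℚ * (((U ^ 2) (φ ∘ tail) α + 2ℚ * U (φ ∘ tail) α) + φ (tail α))
  chebyshev φ α = begin
    U (𝒜 φ ∘ tail) α
      ≡⟨ U-tail (𝒜 φ) α ⟩
    ½ * P (𝒜 φ) (face α) - 𝒜 φ (tail α)
      ≡⟨ solve 4 (λ p q r s → con ½ :* p :- q :=
           con 4ℚ :* (((con ½ :* ((con ½ :* (con ½ :* p) :- con ½ :* q) :- r)
                          :+ con (- 1ℚ) :* (con ½ :* r :- s))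
                        :+ con 2ℚ :* (con ½ :* r :- s)) :+ s))
           refl (P (𝒜 φ) (face α)) (𝒜 φ (tail α)) (P φ (face α)) (φ (tail α)) ⟩
    4ℚ * ((combination (P (𝒜 φ) (face α)) (𝒜 φ (tail α)) (½ * P φ (face α) - φ (tail α))
             + 2ℚ * (½ * P φ (face α) - φ (tail α))) + φ (tail α))
      ≡⟨ cong (λ z → 4ℚ * ((z + 2ℚ * (½ * P φ (face α) - φ (tail α))) + φ (tail α)))
           (sym U²) ⟩
    4ℚ * (((U ^ 2) (φ ∘ tail) α + 2ℚ * (½ * P φ (face α) - φ (tail α))) + φ (tail α))
      ≡⟨ cong (λ z → 4ℚ * (((U ^ 2) (φ ∘ tail) α + 2ℚ * z) + φ (tail α))) (sym (U-tail φ α)) ⟩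
    4ℚ * (((U ^ 2) (φ ∘ tail) α + 2ℚ * U (φ ∘ tail) α) + φ (tail α))
      ∎
    where
    open ≡-Reasoning
    combination : ℚ → ℚ → ℚ → ℚ
    combination p q u = ½ * ((½ * (½ * p) - ½ * q) - P φ (face α)) + (- 1ℚ) * u
    U² : (U ^ 2) (φ ∘ tail) α ≡
      combination (P (𝒜 φ) (face α)) (𝒜 φ (tail α)) (½ * P φ (face α) - φ (tail α))
    U² = begin
      U (U (φ ∘ tail)) α
        ≡⟨ U-cong (U-tail′ φ) α ⟩
      U (λ β → ½ * P φ (face β) + (- 1ℚ) * φ (tail β)) α
        ≡⟨ U-lin ½ _ (- 1ℚ) _ α ⟩
      ½ * U (P φ ∘ face) α + (- 1ℚ) * U (φ ∘ tail) α
        ≡⟨ cong₂ (λ y z → ½ * y + (- 1ℚ) * z) (U-face (P φ) α) (U-tail φ α) ⟩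
      combination (P (Q (P φ)) (face α)) (Q (P φ) (tail α)) (½ * P φ (face α) - φ (tail α))
        ≡⟨ cong₂ (λ y z → combination y z (½ * P φ (face α) - φ (tail α)))
             (corners-cong a b (Q-P φ) (face α)) (Q-P φ (tail α)) ⟩
      combination (P (𝒜 φ) (face α)) (𝒜 φ (tail α)) (½ * P φ (face α) - φ (tail α))
        ∎

------------------------------------------------------------------------
-- Functions invariant under one shift

x-x≡0 : ∀ {x y} → x ≡ y → x - y ≡ 0ℚ
x-x≡0 {x} refl = ℚ.+-inverseʳ x

x-y≡0⇒x≡y : ∀ x y → x - y ≡ 0ℚ → x ≡ y
x-y≡0⇒x≡y x y eq = begin
  x            ≡⟨ solve 2 (λ x y → x := (x :- y) :+ y) refl x y ⟩
  (x - y) + y  ≡⟨ cong (_+ y) eq ⟩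
  0ℚ + y       ≡⟨ ℚ.+-identityˡ y ⟩
  y            ∎
  where open ≡-Reasoning

module InvariantFunctions {V A : Set} (W : Walk V A) where
  open WalkProperties W

  -- The face-minus-tail part of (U ^ k) (θ ∘ tail).  The recursion S (k + 1) = b⁻¹ S k + bᵏ (1 + b) θ
  -- comes from U-θtail and U-δ.
  S : ℕ → (V → ℚ) → V → ℚ
  S zero    θ x = 0ℚ
  S (suc k) θ x = S k θ (b⁻ x) + (θ ((b ^ k) x) + θ ((b ^ suc k) x))

  -- In particular S k is invariant under b as soon as bᵏ = 1.
  telescope : ∀ k θ x → S k θ (b x) - S k θ x ≡ θ ((b ^ suc k) x) - θ (b ((b⁻ ^ k) x))
  telescope zero    θ x = sym (ℚ.+-inverseʳ (θ (b x)))
  telescope (suc k) θ x = begin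
    (S k θ (b⁻ (b x)) + (θ ((b ^ k) (b x)) + θ (b ((b ^ k) (b x)))))
      - (S k θ (b⁻ x) + (θ ((b ^ k) x) + θ (b ((b ^ k) x))))
      ≡⟨ cong₂ (λ y z → (y + z) - (S k θ (b⁻ x) + (θ ((b ^ k) x) + θ (b ((b ^ k) x)))))
           (cong (S k θ) (trans (b⁻-b x) (sym (b-b⁻ x))))
           (cong (λ y → θ y + θ (b y)) (^-comm b k x)) ⟩
    (S k θ (b (b⁻ x)) + (θ (b ((b ^ k) x)) + θ (b (b ((b ^ k) x)))))
      - (S k θ (b⁻ x) + (θ ((b ^ k) x) + θ (b ((b ^ k) x))))
      ≡⟨ solve 5 (λ p q r s t → (p :+ (s :+ t)) :- (q :+ (r :+ s))
           := (p :- q) :+ (t :- r)) refl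
           (S k θ (b (b⁻ x))) (S k θ (b⁻ x)) (θ ((b ^ k) x)) (θ (b ((b ^ k) x)))
           (θ (b (b ((b ^ k) x)))) ⟩
    (S k θ (b (b⁻ x)) - S k θ (b⁻ x)) + (θ (b (b ((b ^ k) x))) - θ ((b ^ k) x))
      ≡⟨ cong (_+ (θ (b (b ((b ^ k) x))) - θ ((b ^ k) x))) (telescope k θ (b⁻ x)) ⟩
    (θ (b ((b ^ k) (b⁻ x))) - θ (b ((b⁻ ^ k) (b⁻ x)))) + (θ (b (b ((b ^ k) x))) - θ ((b ^ k) x))
      ≡⟨ cong₂ (λ y z → (θ y - θ (b z)) + (θ (b (b ((b ^ k) x))) - θ ((b ^ k) x)))
           (trans (sym (^-comm b k (b⁻ x))) (cong (b ^ k) (b-b⁻ x))) (^-comm b⁻ k x) ⟩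
    (θ ((b ^ k) x) - θ (b (b⁻ ((b⁻ ^ k) x)))) + (θ (b (b ((b ^ k) x))) - θ ((b ^ k) x))
      ≡⟨ solve 3 (λ p q r → (p :- q) :+ (r :- p) := r :- q) refl
           (θ ((b ^ k) x)) (θ (b (b⁻ ((b⁻ ^ k) x)))) (θ (b (b ((b ^ k) x)))) ⟩
    θ (b (b ((b ^ k) x))) - θ (b (b⁻ ((b⁻ ^ k) x)))
      ∎
    where open ≡-Reasoning

  b^-a : ∀ k x → (b ^ k) (a x) ≡ a ((b ^ k) x)
  b^-a zero    x = refl
  b^-a (suc k) x = trans (cong b (b^-a k x)) (sym (ab≡ba _))

  module _ (θ : V → ℚ) (θa : θ ∘ a ≗ θ) where

    -- U N θ = N b θ + (M − N)(θ + b θ), for θ invariant under a.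
    U-θtail : ∀ α → U (θ ∘ tail) α ≡
      θ (b (tail α)) + ((θ (face α) + θ (b (face α))) - (θ (tail α) + θ (b (tail α))))
    U-θtail α = begin
      U (θ ∘ tail) α
        ≡⟨ U-tail θ α ⟩
      ½ * ((θ f + θ (a f)) + (θ (b f) + θ (a (b f)))) - θ (tail α)
        ≡⟨ cong₂ (λ y z → ½ * ((θ f + y) + (θ (b f) + z)) - θ (tail α)) (θa f) (θa (b f)) ⟩
      ½ * ((θ f + θ f) + (θ (b f) + θ (b f))) - θ (tail α)
        ≡⟨ solve 4 (λ p q r s → con ½ :* ((p :+ p) :+ (q :+ q)) :- r :=
             s :+ ((p :+ q) :- (r :+ s))) refl (θ f) (θ (b f)) (θ (tail α)) (θ (b (tail α))) ⟩
      θ (b (tail α)) + ((θ f + θ (b f)) - (θ (tail α) + θ (b (tail α))))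
        ∎
      where
      open ≡-Reasoning
      f = face α

    -- The state (M − N) θ; it is written as a linear combination so that U-lin applies.
    δ : A → ℚ
    δ α = 1ℚ * θ (face α) + (- 1ℚ) * θ (tail α)

    -- U (M − N) θ = (M − N) b⁻¹ θ.
    U-δ : ∀ α → U δ α ≡ θ (b⁻ (face α)) - θ (b⁻ (tail α))
    U-δ α = begin
      U δ α
        ≡⟨ U-lin 1ℚ _ (- 1ℚ) _ α ⟩
      1ℚ * U (θ ∘ face) α + (- 1ℚ) * U (θ ∘ tail) α
        ≡⟨ cong₂ (λ y z → 1ℚ * y + (- 1ℚ) * z) (U-face θ α) (U-θtail α) ⟩
      1ℚ * ((½ * (½ * P (Q θ) f) - ½ * Q θ t) - θ f)
        + (- 1ℚ) * (θ (b t) + ((θ f + θ (b f)) - (θ t + θ (b t))))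
        ≡⟨ cong₂ (λ y z → 1ℚ * ((½ * (½ * y) - ½ * z) - θ f)
              + (- 1ℚ) * (θ (b t) + ((θ f + θ (b f)) - (θ t + θ (b t)))))
             PQ (Q-θ t) ⟩
      1ℚ * ((½ * (½ * ((q + q) + (q′ + q′)))
        - ½ * ((θ t + θ t) + (θ (b⁻ t) + θ (b⁻ t)))) - θ f)
        + (- 1ℚ) * (θ (b t) + ((θ f + θ (b f)) - (θ t + θ (b t))))
        ≡⟨ solve 6 (λ f f⁺ f⁻ t t⁺ t⁻ →
             con 1ℚ :* ((con ½ :* (con ½ :* ((((f :+ f) :+ (f⁻ :+ f⁻)) :+ ((f :+ f) :+ (f⁻ :+ f⁻)))
               :+ (((f⁺ :+ f⁺) :+ (f :+ f)) :+ ((f⁺ :+ f⁺) :+ (f :+ f)))))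
               :- con ½ :* ((t :+ t) :+ (t⁻ :+ t⁻))) :- f)
               :+ con (- 1ℚ) :* (t⁺ :+ ((f :+ f⁺) :- (t :+ t⁺)))
             := f⁻ :- t⁻) refl (θ f) (θ (b f)) (θ (b⁻ f)) (θ t) (θ (b t)) (θ (b⁻ t)) ⟩
      θ (b⁻ f) - θ (b⁻ t)
        ∎
      where
      open ≡-Reasoning
      f t : V
      f = face α
      t = tail α
      q q′ : ℚ
      q  = (θ f + θ f) + (θ (b⁻ f) + θ (b⁻ f))
      q′ = (θ (b f) + θ (b f)) + (θ f + θ f)
      θa⁻ : ∀ x → θ (a⁻ x) ≡ θ x
      θa⁻ x = trans (sym (θa (a⁻ x))) (cong θ (a-a⁻ x))
      Q-θ : ∀ x → Q θ x ≡ (θ x + θ x) + (θ (b⁻ x) + θ (b⁻ x))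
      Q-θ x = cong₂ (λ y z → (θ x + y) + (θ (b⁻ x) + z)) (θa⁻ x) (θa⁻ (b⁻ x))
      Q-θ-a : ∀ x → Q θ (a x) ≡ Q θ x
      Q-θ-a x = begin
        Q θ (a x)                                               ≡⟨ Q-θ (a x) ⟩
        (θ (a x) + θ (a x)) + (θ (b⁻ (a x)) + θ (b⁻ (a x)))     ≡⟨ cong₂ (λ y z → (y + y) + (z + z)) (θa x)
                                                                     (trans (cong θ (b⁻a≡ab⁻ x)) (θa (b⁻ x))) ⟩
        (θ x + θ x) + (θ (b⁻ x) + θ (b⁻ x))                     ≡⟨ Q-θ x ⟨
        Q θ x                                                   ∎
      Qb : Q θ (b f) ≡ q′
      Qb = trans (Q-θ (b f)) (cong (λ z → (θ (b f) + θ (b f)) + (θ z + θ z)) (b⁻-b f))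
      PQ : P (Q θ) f ≡ (q + q) + (q′ + q′)
      PQ = cong₂ _+_ (cong₂ _+_ (Q-θ f) (trans (Q-θ-a f) (Q-θ f)))
                     (cong₂ _+_ Qb (trans (Q-θ-a (b f)) Qb))

    S-a : ∀ k → S k θ ∘ a ≗ S k θ
    S-a zero    x = refl
    S-a (suc k) x = cong₂ _+_ (trans (cong (S k θ) (b⁻a≡ab⁻ x)) (S-a k (b⁻ x)))
      (cong₂ _+_ (trans (cong θ (b^-a k x)) (θa _)) (trans (cong θ (b^-a (suc k) x)) (θa _)))

  U^-θtail : ∀ θ → θ ∘ a ≗ θ → ∀ k α → (U ^ k) (θ ∘ tail) α ≡
    1ℚ * θ ((b ^ k) (tail α)) + 1ℚ * (1ℚ * S k θ (face α) + (- 1ℚ) * S k θ (tail α))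
  U^-θtail θ θa zero    α = solve 1 (λ x → x := con 1ℚ :* x :+
    con 1ℚ :* (con 1ℚ :* con 0ℚ :+ con (- 1ℚ) :* con 0ℚ)) refl (θ (tail α))
  U^-θtail θ θa (suc k) α = begin
    U ((U ^ k) (θ ∘ tail)) α
      ≡⟨ U-cong (U^-θtail θ θa k) α ⟩
    U (λ β → 1ℚ * θᵏ (tail β) + 1ℚ * δ (S k θ) (S-a θ θa k) β) α
      ≡⟨ U-lin 1ℚ _ 1ℚ _ α ⟩
    1ℚ * U (θᵏ ∘ tail) α + 1ℚ * U (δ (S k θ) (S-a θ θa k)) α
      ≡⟨ cong₂ (λ y z → 1ℚ * y + 1ℚ * z) (U-θtail θᵏ θᵏa α) (U-δ (S k θ) (S-a θ θa k) α) ⟩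
    1ℚ * (θᵏ (b t) + ((θᵏ f + θᵏ (b f)) - (θᵏ t + θᵏ (b t))))
      + 1ℚ * (S k θ (b⁻ f) - S k θ (b⁻ t))
      ≡⟨ cong₂ (λ y z → 1ℚ * (y + ((θᵏ f + z) - (θᵏ t + y))) + 1ℚ * (S k θ (b⁻ f) - S k θ (b⁻ t)))
           (cong θ (^-comm b k t)) (cong θ (^-comm b k f)) ⟩
    1ℚ * (θ ((b ^ suc k) t) + ((θᵏ f + θ ((b ^ suc k) f)) - (θᵏ t + θ ((b ^ suc k) t))))
      + 1ℚ * (S k θ (b⁻ f) - S k θ (b⁻ t))
      ≡⟨ solve 6 (λ f f′ t t′ p q →
           con 1ℚ :* (t′ :+ ((f :+ f′) :- (t :+ t′))) :+ con 1ℚ :* (p :- q)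
           := con 1ℚ :* t′ :+ con 1ℚ :* (con 1ℚ :* (p :+ (f :+ f′)) :+ con (- 1ℚ) :* (q :+ (t :+ t′))))
           refl (θᵏ f) (θ ((b ^ suc k) f)) (θᵏ t) (θ ((b ^ suc k) t)) (S k θ (b⁻ f)) (S k θ (b⁻ t)) ⟩
    1ℚ * θ ((b ^ suc k) t) + 1ℚ * (1ℚ * S (suc k) θ f + (- 1ℚ) * S (suc k) θ t)
      ∎
    where
    open ≡-Reasoning
    f t : V
    f = face α
    t = tail α
    θᵏ : V → ℚ
    θᵏ x = θ ((b ^ k) x)
    θᵏa : θᵏ ∘ a ≗ θᵏ
    θᵏa x = trans (cong θ (b^-a k x)) (θa _)

  invariant⇒fixed : ∀ q → (∀ x → (b ^ q) x ≡ x) → (∀ x → (b⁻ ^ q) x ≡ x) →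
    ∀ θ → θ ∘ a ≗ θ → (U ^ q) (θ ∘ tail) ≗ θ ∘ tail
  invariant⇒fixed q b^q b⁻^q θ θa α = begin
    (U ^ q) (θ ∘ tail) α
      ≡⟨ U^-θtail θ θa q α ⟩
    1ℚ * θ ((b ^ q) (tail α)) + 1ℚ * (1ℚ * S q θ (face α) + (- 1ℚ) * S q θ (tail α))
      ≡⟨ cong₂ (λ y z → 1ℚ * θ y + 1ℚ * (1ℚ * z + (- 1ℚ) * S q θ (tail α)))
           (b^q (tail α)) (invariant (S q θ) (S-a θ θa q) S-b α) ⟩
    1ℚ * θ (tail α) + 1ℚ * (1ℚ * S q θ (tail α) + (- 1ℚ) * S q θ (tail α))
      ≡⟨ solve 2 (λ x y → con 1ℚ :* x :+ con 1ℚ :* (con 1ℚ :* y :+ con (- 1ℚ) :* y) := x)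
           refl (θ (tail α)) (S q θ (tail α)) ⟩
    θ (tail α)
      ∎
    where
    open ≡-Reasoning
    S-b : S q θ ∘ b ≗ S q θ
    S-b x = x-y≡0⇒x≡y _ _ (trans (telescope q θ x)
      (x-x≡0 (cong θ (trans (cong b (b^q x)) (sym (cong b (b⁻^q x)))))))

------------------------------------------------------------------------
-- States that return to themselves

module Fixed {V A : Set} (W : Walk V A) where
  open WalkProperties W

  -- The state φ ∘ tail returns to itself after k steps.  This is a record, so that comparing two such
  -- types never unfolds the k-th power of U.
  record Fix (k : ℕ) (φ : V → ℚ) : Set where
    constructor returning
    field
      return : (U ^ k) (φ ∘ tail) ≗ φ ∘ tail

  open Fix public

  Fix-* : ∀ j k φ → Fix k φ → Fix (j ℕ.* k) φ
  Fix-* zero    k φ f .return α = refl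
  Fix-* (suc j) k φ f .return α = begin
    (U ^ (k ℕ.+ j ℕ.* k)) (φ ∘ tail) α        ≡⟨ cong-app (fold-+ (φ ∘ tail) U k) α ⟩
    (U ^ k) ((U ^ (j ℕ.* k)) (φ ∘ tail)) α    ≡⟨ U^-cong k (Fix-* j k φ f .return) α ⟩
    (U ^ k) (φ ∘ tail) α                      ≡⟨ f .return α ⟩
    φ (tail α)                                ∎
    where open ≡-Reasoning

  Fix-+ : ∀ k φ χ θ → (∀ x → φ x ≡ χ x + θ x) → Fix k χ → Fix k θ → Fix k φ
  Fix-+ k φ χ θ e fχ fθ .return α = begin
    (U ^ k) (φ ∘ tail) α
      ≡⟨ U^-cong k e′ α ⟩
    (U ^ k) (λ β → 1ℚ * χ (tail β) + 1ℚ * θ (tail β)) α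
      ≡⟨ U^-lin k 1ℚ (χ ∘ tail) 1ℚ (θ ∘ tail) α ⟩
    1ℚ * (U ^ k) (χ ∘ tail) α + 1ℚ * (U ^ k) (θ ∘ tail) α
      ≡⟨ cong₂ (λ y z → 1ℚ * y + 1ℚ * z) (fχ .return α) (fθ .return α) ⟩
    1ℚ * χ (tail α) + 1ℚ * θ (tail α)
      ≡⟨ e′ α ⟨
    φ (tail α)
      ∎
    where
    open ≡-Reasoning
    e′ : ∀ β → φ (tail β) ≡ 1ℚ * χ (tail β) + 1ℚ * θ (tail β)
    e′ β = trans (e (tail β))
      (sym (cong₂ _+_ (ℚ.*-identityˡ (χ (tail β))) (ℚ.*-identityˡ (θ (tail β)))))

  -- If a θ = −θ, then corners a b θ = 0 and U acts as −1.
  antiinvariant⇒fixed : ∀ θ → (∀ x → θ (a x) ≡ - θ x) → Fix 2 θ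
  antiinvariant⇒fixed θ θa .return α = begin
    U (U (θ ∘ tail)) α
      ≡⟨ U-cong Uθ α ⟩
    U (λ β → (- 1ℚ) * θ (tail β) + 0ℚ * θ (tail β)) α
      ≡⟨ U-lin (- 1ℚ) (θ ∘ tail) 0ℚ (θ ∘ tail) α ⟩
    (- 1ℚ) * U (θ ∘ tail) α + 0ℚ * U (θ ∘ tail) α
      ≡⟨ cong (λ z → (- 1ℚ) * z + 0ℚ * z) (Uθ α) ⟩
    (- 1ℚ) * ((- 1ℚ) * θ (tail α) + 0ℚ * θ (tail α)) + 0ℚ * ((- 1ℚ) * θ (tail α) + 0ℚ * θ (tail α))
      ≡⟨ solve 1 (λ x → con (- 1ℚ) :* (con (- 1ℚ) :* x :+ con 0ℚ :* x)
           :+ con 0ℚ :* (con (- 1ℚ) :* x :+ con 0ℚ :* x) := x) refl (θ (tail α)) ⟩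
    θ (tail α)
      ∎
    where
    open ≡-Reasoning
    Uθ : U (θ ∘ tail) ≗ λ β → (- 1ℚ) * θ (tail β) + 0ℚ * θ (tail β)
    Uθ β = begin
      U (θ ∘ tail) β
        ≡⟨ U-tail θ β ⟩
      ½ * ((θ f + θ (a f)) + (θ (b f) + θ (a (b f)))) - θ (tail β)
        ≡⟨ cong₂ (λ y z → ½ * ((θ f + y) + (θ (b f) + z)) - θ (tail β)) (θa f) (θa (b f)) ⟩
      ½ * ((θ f - θ f) + (θ (b f) - θ (b f))) - θ (tail β)
        ≡⟨ solve 3 (λ x y z → con ½ :* ((x :- x) :+ (y :- y)) :- z
             := con (- 1ℚ) :* z :+ con 0ℚ :* z) refl (θ f) (θ (b f)) (θ (tail β)) ⟩
      (- 1ℚ) * θ (tail β) + 0ℚ * θ (tail β)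
        ∎
      where
      f : V
      f = face β

  -- Here 𝒜 χ = 4 χ, so the recurrence becomes U² N χ + U N χ + N χ = 0.
  quarter-turns⇒fixed : ∀ χ → (∀ x → χ (a (a x)) ≡ - χ x) → (∀ x → χ (b (b x)) ≡ - χ x) →
    Fix 3 χ
  quarter-turns⇒fixed χ χa χb .return α = begin
    U ((U ^ 2) (χ ∘ tail)) α
      ≡⟨ U-cong U² α ⟩
    U (λ β → (- 1ℚ) * U (χ ∘ tail) β + (- 1ℚ) * χ (tail β)) α
      ≡⟨ U-lin (- 1ℚ) (U (χ ∘ tail)) (- 1ℚ) (χ ∘ tail) α ⟩
    (- 1ℚ) * (U ^ 2) (χ ∘ tail) α + (- 1ℚ) * U (χ ∘ tail) α
      ≡⟨ cong (λ z → (- 1ℚ) * z + (- 1ℚ) * U (χ ∘ tail) α) (U² α) ⟩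
    (- 1ℚ) * ((- 1ℚ) * U (χ ∘ tail) α + (- 1ℚ) * χ (tail α)) + (- 1ℚ) * U (χ ∘ tail) α
      ≡⟨ solve 2 (λ u x → con (- 1ℚ) :* (con (- 1ℚ) :* u :+ con (- 1ℚ) :* x) :+ con (- 1ℚ) :* u
           := x) refl (U (χ ∘ tail) α) (χ (tail α)) ⟩
    χ (tail α)
      ∎
    where
    open ≡-Reasoning
    X-double : ∀ (s s⁻ : V → V) → (∀ x → s (s⁻ x) ≡ x) → (∀ x → χ (s (s x)) ≡ - χ x) →
      ∀ x → X s s⁻ χ x ≡ 2ℚ * χ x
    X-double s s⁻ ss⁻ χs x = begin
      (χ x + χ x) + (χ (s x) + χ (s⁻ x))
        ≡⟨ cong (λ z → (χ x + χ x) + (z + χ (s⁻ x)))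
             (trans (cong (χ ∘ s) (sym (ss⁻ x))) (χs (s⁻ x))) ⟩
      (χ x + χ x) + (- χ (s⁻ x) + χ (s⁻ x))
        ≡⟨ solve 2 (λ x y → (x :+ x) :+ (:- y :+ y) := con 2ℚ :* x) refl (χ x) (χ (s⁻ x)) ⟩
      2ℚ * χ x
        ∎
    𝒜χ : ∀ x → 𝒜 χ x ≡ 4ℚ * χ x + 0ℚ * χ x
    𝒜χ x = begin
      X a a⁻ (X b b⁻ χ) x
        ≡⟨ cong₂ _+_ (cong₂ _+_ (Xb x) (Xb x)) (cong₂ _+_ (Xb (a x)) (Xb (a⁻ x))) ⟩
      (2ℚ * χ x + 2ℚ * χ x) + (2ℚ * χ (a x) + 2ℚ * χ (a⁻ x))
        ≡⟨ solve 3 (λ x y z → (con 2ℚ :* x :+ con 2ℚ :* x) :+ (con 2ℚ :* y :+ con 2ℚ :* z) :=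
             con 2ℚ :* ((x :+ x) :+ (y :+ z))) refl (χ x) (χ (a x)) (χ (a⁻ x)) ⟩
      2ℚ * X a a⁻ χ x
        ≡⟨ cong (2ℚ *_) (X-double a a⁻ a-a⁻ χa x) ⟩
      2ℚ * (2ℚ * χ x)
        ≡⟨ solve 1 (λ x → con 2ℚ :* (con 2ℚ :* x) := con 4ℚ :* x :+ con 0ℚ :* x) refl (χ x) ⟩
      4ℚ * χ x + 0ℚ * χ x
        ∎
      where
      Xb : ∀ y → X b b⁻ χ y ≡ 2ℚ * χ y
      Xb = X-double b b⁻ b-b⁻ χb
    U² : (U ^ 2) (χ ∘ tail) ≗ λ β → (- 1ℚ) * U (χ ∘ tail) β + (- 1ℚ) * χ (tail β)
    U² β = begin
      (U ^ 2) (χ ∘ tail) β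
        ≡⟨ solve 3 (λ u² u x → u² := con (½ * ½) :* (con 4ℚ :* ((u² :+ con 2ℚ :* u) :+ x))
             :+ (con (- 1ℚ) :* (u :+ x) :- u)) refl u² u x ⟩
      (½ * ½) * (4ℚ * ((u² + 2ℚ * u) + x)) + ((- 1ℚ) * (u + x) - u)
        ≡⟨ cong (λ z → (½ * ½) * z + ((- 1ℚ) * (u + x) - u)) (chebyshev χ β) ⟨
      (½ * ½) * U (𝒜 χ ∘ tail) β + ((- 1ℚ) * (u + x) - u)
        ≡⟨ cong (λ z → (½ * ½) * z + ((- 1ℚ) * (u + x) - u))
             (trans (U-cong (𝒜χ ∘ tail) β) (U-lin 4ℚ (χ ∘ tail) 0ℚ (χ ∘ tail) β)) ⟩
      (½ * ½) * (4ℚ * u + 0ℚ * u) + ((- 1ℚ) * (u + x) - u)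
        ≡⟨ solve 2 (λ u x → con (½ * ½) :* (con 4ℚ :* u :+ con 0ℚ :* u) :+ (con (- 1ℚ) :* (u :+ x) :- u)
             := con (- 1ℚ) :* u :+ con (- 1ℚ) :* x) refl u x ⟩
      (- 1ℚ) * u + (- 1ℚ) * x
        ∎
      where
      u² u x : ℚ
      u² = (U ^ 2) (χ ∘ tail) β
      u  = U (χ ∘ tail) β
      x  = χ (tail β)

-- The components of a function under a shift s: if s² = 1, those with s = 1 (even) and s = −1 (odd);
-- if s⁴ = 1, those with s = 1 (mean), s = −1 (alternating) and s² = −1 (turning).
module Split {V : Set} (s : V → V) where

  mean alternating turning even odd : (V → ℚ) → V → ℚ
  mean        φ x = (½ * ½) * ((φ x + φ (s x)) + (φ (s (s x)) + φ (s (s (s x)))))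
  alternating φ x = (½ * ½) * ((φ x - φ (s x)) + (φ (s (s x)) - φ (s (s (s x)))))
  turning     φ x = ½ * (φ x - φ (s (s x)))
  even        φ x = ½ * (φ x + φ (s x))
  odd         φ x = ½ * (φ x - φ (s x))

  split-2 : ∀ φ x → φ x ≡ even φ x + odd φ x
  split-2 φ x = solve 2 (λ x y → x := con ½ :* (x :+ y) :+ con ½ :* (x :- y)) refl (φ x) (φ (s x))

  split-4 : ∀ φ x → φ x ≡ mean φ x + (alternating φ x + turning φ x)
  split-4 φ x = solve 4 (λ x y z w → x := con (½ * ½) :* ((x :+ y) :+ (z :+ w))
    :+ (con (½ * ½) :* ((x :- y) :+ (z :- w)) :+ con ½ :* (x :- z)))
    refl (φ x) (φ (s x)) (φ (s (s x))) (φ (s (s (s x))))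

  module _ (s² : ∀ x → s (s x) ≡ x) (φ : V → ℚ) (x : V) where

    even-s : even φ (s x) ≡ even φ x
    even-s rewrite s² x = cong (½ *_) (ℚ.+-comm (φ (s x)) (φ x))

    odd-s : odd φ (s x) ≡ - odd φ x
    odd-s rewrite s² x = solve 2 (λ x y → con ½ :* (y :- x) := :- (con ½ :* (x :- y)))
      refl (φ x) (φ (s x))

  module _ (s⁴ : ∀ x → (s ^ 4) x ≡ x) (φ : V → ℚ) (x : V) where

    mean-s : mean φ (s x) ≡ mean φ x
    mean-s rewrite s⁴ x = solve 4 (λ x y z w → con (½ * ½) :* ((y :+ z) :+ (w :+ x))
      := con (½ * ½) :* ((x :+ y) :+ (z :+ w)))
      refl (φ x) (φ (s x)) (φ (s (s x))) (φ (s (s (s x))))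

    alternating-s : alternating φ (s x) ≡ - alternating φ x
    alternating-s rewrite s⁴ x = solve 4 (λ x y z w → con (½ * ½) :* ((y :- z) :+ (w :- x))
      := :- (con (½ * ½) :* ((x :- y) :+ (z :- w))))
      refl (φ x) (φ (s x)) (φ (s (s x))) (φ (s (s (s x))))

    turning-s : turning φ (s (s x)) ≡ - turning φ x
    turning-s rewrite s⁴ x = solve 2 (λ x z → con ½ :* (z :- x) := :- (con ½ :* (x :- z)))
      refl (φ x) (φ (s (s x)))

module Periodicity {V A : Set} (W : Walk V A) where
  open WalkProperties W
  open Fixed W
  open InvariantFunctions W using (invariant⇒fixed)
  private
    module Sw = InvariantFunctions swap
    module Fw = Fixed swap
    module Sa = Split a
    module Sb = Split b

  -- The period 2q is a common multiple of the periods q of the even part and 2 of the odd part.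
  involution⇒fixed : (∀ x → a (a x) ≡ x) →
    ∀ q → (∀ x → (b ^ q) x ≡ x) → (∀ x → (b⁻ ^ q) x ≡ x) → ∀ φ → Fix (2 ℕ.* q) φ
  involution⇒fixed a² q b^q b⁻^q φ = Fix-+ (2 ℕ.* q) φ φ₀ φ₁ (Sa.split-2 φ)
    (Fix-* 2 q φ₀ (returning (invariant⇒fixed q b^q b⁻^q φ₀ (Sa.even-s a² φ))))
    (subst (λ k → Fix k φ₁) (ℕ.*-comm q 2)
      (Fix-* q 2 φ₁ (antiinvariant⇒fixed φ₁ (Sa.odd-s a² φ))))
    where
    φ₀ φ₁ : V → ℚ
    φ₀ = Sa.even φ
    φ₁ = Sa.odd φ

  -- 12 is a common multiple of the periods 4, 2 and 3 of the components.
  order-4⇒fixed : (∀ x → (a ^ 4) x ≡ x) → (∀ x → (a⁻ ^ 4) x ≡ x) →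
    (∀ x → (b ^ 4) x ≡ x) → (∀ x → (b⁻ ^ 4) x ≡ x) → ∀ φ → Fix 12 φ
  order-4⇒fixed a⁴ a⁻⁴ b⁴ b⁻⁴ φ =
    Fix-+ 12 φ (Sa.mean φ) (λ x → Sa.alternating φ x + χ x) (Sa.split-4 φ)
      (Fix-* 3 4 (Sa.mean φ) (returning (invariant⇒fixed 4 b⁴ b⁻⁴ (Sa.mean φ) (Sa.mean-s a⁴ φ))))
      (Fix-+ 12 _ (Sa.alternating φ) χ (λ _ → refl)
        (Fix-* 6 2 (Sa.alternating φ)
          (antiinvariant⇒fixed (Sa.alternating φ) (Sa.alternating-s a⁴ φ)))
        (Fix-+ 12 χ (Sb.mean χ) (λ x → Sb.alternating χ x + Sb.turning χ x) (Sb.split-4 χ)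
          (Fix-* 3 4 (Sb.mean χ) 
            (returning (Sw.invariant⇒fixed 4 a⁴ a⁻⁴ (Sb.mean χ) (Sb.mean-s b⁴ χ))))
          (Fix-+ 12 _ (Sb.alternating χ) (Sb.turning χ) (λ _ → refl)
            (Fix-* 6 2 (Sb.alternating χ)
              (returning (Fw.antiinvariant⇒fixed (Sb.alternating χ) (Sb.alternating-s b⁴ χ) .Fw.return)))
            (Fix-* 4 3 (Sb.turning χ)
              (quarter-turns⇒fixed (Sb.turning χ) turning-a (Sb.turning-s b⁴ χ))))))
    where
    χ : V → ℚ
    χ = Sa.turning φ
    b²a² : ∀ x → b (b (a (a x))) ≡ a (a (b (b x)))
    b²a² x rewrite sym (ab≡ba (a x)) | sym (ab≡ba x) | sym (ab≡ba (a (b x))) | sym (ab≡ba (b x)) = refl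
    turning-a : ∀ x → Sb.turning χ (a (a x)) ≡ - Sb.turning χ x
    turning-a x = trans
      (cong₂ (λ y z → ½ * (y - z)) (Sa.turning-s a⁴ φ x)
        (trans (cong χ (b²a² x)) (Sa.turning-s a⁴ φ (b (b x)))))
      (solve 2 (λ x y → con ½ :* (:- x :- (:- y)) := :- (con ½ :* (x :- y)))
        refl (χ x) (χ (b (b x))))

------------------------------------------------------------------------
-- Finite sums

-- Additive functionals on rational functions.
record Additive {Y : Set} (L : (Y → ℚ) → ℚ) : Set where
  field
    L-cong : ∀ {f g : Y → ℚ} → f ≗ g → L f ≡ L g
    L-0    : L (λ _ → 0ℚ) ≡ 0ℚ
    L-+    : ∀ f g → L (λ y → f y + g y) ≡ L f + L g

-- A summation over X of real numbers, together with the summation of rationals that computes its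
-- i-th approximations.
record FiniteSum (X : Set) : Set₁ where
  field
    Σʳ        : Summation X
    Σ         : (X → ℚ) → ℚ
    seq-Σ     : ∀ f i → seq (Σʳ f) i ≡ Σ (λ x → seq (f x) i)
    additive  : Additive Σ
    Σ-*       : ∀ c f → Σ (λ x → c * f x) ≡ c * Σ f
    Σ-support : ∀ f x → (∀ y → y ≢ x → f y ≡ 0ℚ) → Σ f ≡ f x
    Σ-swap    : ∀ {Y : Set} {L : (Y → ℚ) → ℚ} → Additive L → (f : X → Y → ℚ) →
                Σ (λ x → L (f x)) ≡ L (λ y → Σ (λ x → f x y))
  open Additive additive public
    renaming (L-cong to Σ-cong; L-0 to Σ-0; L-+ to Σ-+)

open FiniteSum

finSum : ∀ n → FiniteSum (Fin n)
finSum n .Σʳ = Defs.sum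
finSum n .Σ  = sum
finSum n .seq-Σ = go n
  where
  go : ∀ n (f : Fin n → ℝ) i → seq (Defs.sum f) i ≡ sum (λ x → seq (f x) i)
  go zero    f i = refl
  go (suc n) f i = cong (λ z → seq (f zero) i + z) (go n (f ∘ suc) i)
finSum n .additive = record
  { L-cong = sum-cong-≗
  ; L-0 = go n
  ; L-+ = ∑-distrib-+
  }
  where
  go : ∀ n → sum {n} (λ _ → 0ℚ) ≡ 0ℚ
  go zero    = refl
  go (suc n) = trans (ℚ.+-identityˡ _) (go n)
finSum n .Σ-* c f = sym (*-distribˡ-sum c f)
finSum n .Σ-support = go n
  where
  go : ∀ n (f : Fin n → ℚ) x → (∀ y → y ≢ x → f y ≡ 0ℚ) → sum f ≡ f x
  go (suc n) f zero    f≡0 = trans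
    (cong (λ z → f zero + z) (trans (sum-cong-≗ (λ y → f≡0 (suc y) λ ())) (Σ-0 (finSum n))))
    (ℚ.+-identityʳ (f zero))
  go (suc n) f (suc x) f≡0 = trans
    (cong₂ _+_ (f≡0 zero λ ()) (go n (f ∘ suc) x λ y y≢x → f≡0 (suc y) (y≢x ∘ Fin.suc-injective)))
    (ℚ.+-identityˡ (f (suc x)))
finSum n .Σ-swap = go n
  where
  go : ∀ n {Y : Set} {L : (Y → ℚ) → ℚ} → Additive L → (f : Fin n → Y → ℚ) →
    sum (λ x → L (f x)) ≡ L (λ y → sum (λ x → f x y))
  go zero    add f = sym (Additive.L-0 add)
  go (suc n) {L = L} add f = trans (cong (λ z → L (f zero) + z) (go n add (f ∘ suc)))
    (sym (Additive.L-+ add (f zero) _))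

infixr 2 _⊗_

_⊗_ : ∀ {X Y} → FiniteSum X → FiniteSum Y → FiniteSum (X × Y)
(S ⊗ T) .Σʳ f = Σʳ S λ x → Σʳ T λ y → f (x , y)
(S ⊗ T) .Σ  f = Σ S λ x → Σ T λ y → f (x , y)
(S ⊗ T) .seq-Σ f i = trans (seq-Σ S _ i) (Σ-cong S λ x → seq-Σ T _ i)
(S ⊗ T) .additive = record
  { L-cong = λ e → Σ-cong S λ x → Σ-cong T λ y → e (x , y)
  ; L-0 = trans (Σ-cong S λ x → Σ-0 T) (Σ-0 S)
  ; L-+ = λ f g → trans (Σ-cong S λ x → Σ-+ T _ _) (Σ-+ S _ _)
  }
(S ⊗ T) .Σ-* c f = trans (Σ-cong S λ x → Σ-* T c _) (Σ-* S c _)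
(S ⊗ T) .Σ-support f (x , y) f≡0 = trans
  (Σ-support S _ x λ x′ x′≢x →
    trans (Σ-cong T λ y′ → f≡0 (x′ , y′) (x′≢x ∘ cong proj₁)) (Σ-0 T))
  (Σ-support T _ y λ y′ y′≢y → f≡0 (x , y′) (y′≢y ∘ cong proj₂))
(S ⊗ T) .Σ-swap add f = trans (Σ-cong S λ x → Σ-swap T add _) (Σ-swap S add _)

-- Summation against an indicator function of a single point, scaled by c.
Σ-indicator : ∀ {X : Set} (S : FiniteSum X) (R : X → Set) (d : ∀ y → Dec (R y)) x →
  R x → (∀ y → R y → y ≡ x) → ∀ (c : ℝ) i (v : X → ℚ) →
  Σ S (λ y → seq (if does (d y) then c else 0ℝ) i * v y) ≡ seq c i * v x
Σ-indicator S R d x Rx unique c i v = trans (Σ-support S _ x off) on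
  where
  off : ∀ y → y ≢ x → seq (if does (d y) then c else 0ℝ) i * v y ≡ 0ℚ
  off y y≢x with d y
  ... | yes Ry = contradiction (unique y Ry) y≢x
  ... | no  _  = ℚ.*-zeroˡ (v y)
  on : seq (if does (d x) then c else 0ℝ) i * v x ≡ seq c i * v x
  on with d x
  ... | yes _  = refl
  ... | no ¬Rx = contradiction Rx ¬Rx

------------------------------------------------------------------------
-- Real matrices as operators on rational functions

module Operators (i : ℕ) where

  -- L is multiplication by the matrix of the i-th approximations to the entries of A.
  Represents : ∀ {X Y : Set} → FiniteSum Y → Mat X Y → ((Y → ℚ) → X → ℚ) → Set
  Represents S A L = ∀ v x → Σ S (λ y → seq (A x y) i * v y) ≡ L v x

  apply-represents : ∀ {X Y} (S : FiniteSum Y) (A : Mat X Y) L → Represents S A L →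
    ∀ v x → seq (apply (Σʳ S) A v x) i ≡ L (λ y → seq (v y) i) x
  apply-represents S A L rep v x = trans (seq-Σ S _ i) (rep (λ y → seq (v y) i) x)

  mul-represents : ∀ {X Y Z} (S : FiniteSum Y) (T : FiniteSum Z) (A : Mat X Y) (B : Mat Y Z) L L′ →
    Represents S A L → Represents T B L′ → Represents T (mul (Σʳ S) A B) (L ∘ L′)
  mul-represents S T A B L L′ repA repB v x = begin
    Σ T (λ z → seq (Σʳ S (λ y → A x y Defs.* B y z)) i * v z)
      ≡⟨ Σ-cong T (λ z → begin
           seq (Σʳ S (λ y → A x y Defs.* B y z)) i * v z
             ≡⟨ cong (_* v z) (seq-Σ S (λ y → A x y Defs.* B y z) i) ⟩
           Σ S (λ y → seq (A x y) i * seq (B y z) i) * v z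
             ≡⟨ ℚ.*-comm _ (v z) ⟩
           v z * Σ S (λ y → seq (A x y) i * seq (B y z) i)
             ≡⟨ Σ-* S (v z) (λ y → seq (A x y) i * seq (B y z) i) ⟨
           Σ S (λ y → v z * (seq (A x y) i * seq (B y z) i))
             ≡⟨ Σ-cong S (λ y → solve 3 (λ v a b → v :* (a :* b) := a :* (b :* v)) refl
                  (v z) (seq (A x y) i) (seq (B y z) i)) ⟩
           Σ S (λ y → seq (A x y) i * (seq (B y z) i * v z)) ∎) ⟩
    Σ T (λ z → Σ S (λ y → seq (A x y) i * (seq (B y z) i * v z)))
      ≡⟨ Σ-swap S (additive T) (λ y z → seq (A x y) i * (seq (B y z) i * v z)) ⟨
    Σ S (λ y → Σ T (λ z → seq (A x y) i * (seq (B y z) i * v z)))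
      ≡⟨ Σ-cong S (λ y → trans (Σ-* T (seq (A x y) i) (λ z → seq (B y z) i * v z))
           (cong (seq (A x y) i *_) (repB v y))) ⟩
    Σ S (λ y → seq (A x y) i * L′ v y)
      ≡⟨ repA (L′ v) x ⟩
    L (L′ v) x
      ∎
    where open ≡-Reasoning

  module _ {X : Set} (_≟_ : DecidableEquality X) (S : FiniteSum X) where

    identity-represents : Represents S (identity _≟_) id
    identity-represents v x = trans
      (Σ-indicator S (x ≡_) (x ≟_) x refl (λ _ → sym) Defs.1ℝ i v) (ℚ.*-identityˡ (v x))

    reflection-represents : ∀ A L → Represents S A L →
      Represents S (reflection _≟_ A) (λ v x → 2ℚ * L v x - v x)
    reflection-represents A L rep v x = begin
      Σ S (λ y → (2ℚ * α y - ι y) * v y)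
        ≡⟨ Σ-cong S (λ y → solve 3 (λ a b v → (con 2ℚ :* a :- b) :* v :=
             con 2ℚ :* (a :* v) :+ con (- 1ℚ) :* (b :* v)) refl (α y) (ι y) (v y)) ⟩
      Σ S (λ y → 2ℚ * (α y * v y) + (- 1ℚ) * (ι y * v y))
        ≡⟨ Σ-+ S (λ y → 2ℚ * (α y * v y)) (λ y → (- 1ℚ) * (ι y * v y)) ⟩
      Σ S (λ y → 2ℚ * (α y * v y)) + Σ S (λ y → (- 1ℚ) * (ι y * v y))
        ≡⟨ cong₂ _+_ (Σ-* S 2ℚ (λ y → α y * v y)) (Σ-* S (- 1ℚ) (λ y → ι y * v y)) ⟩
      2ℚ * Σ S (λ y → α y * v y) + (- 1ℚ) * Σ S (λ y → ι y * v y)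
        ≡⟨ cong₂ (λ p q → 2ℚ * p + (- 1ℚ) * q) (rep v x) (identity-represents v x) ⟩
      2ℚ * L v x + (- 1ℚ) * v x
        ≡⟨ solve 2 (λ p q → con 2ℚ :* p :+ con (- 1ℚ) :* q := con 2ℚ :* p :- q) refl (L v x) (v x) ⟩
      2ℚ * L v x - v x
        ∎
      where
      open ≡-Reasoning
      α ι : X → ℚ
      α y = seq (A x y) i
      ι y = seq (identity _≟_ x y) i

    power-represents : ∀ A L → Represents S A L → ∀ t → Represents S (power _≟_ (Σʳ S) A t) (L ^ t)
    power-represents A L rep zero    = identity-represents
    power-represents A L rep (suc t) =
      mul-represents S S A (power _≟_ (Σʳ S) A t) L (L ^ t) rep (power-represents A L rep t)

------------------------------------------------------------------------
-- Translations of a cycle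

module _ {k : ℕ} .{{_ : NonZero k}} where

  toℕ-mod : ∀ j → toℕ (j mod k) ≡ j % k
  toℕ-mod j = Fin.toℕ-fromℕ< (ℕ.m%n<n j k)

  toℕ-% : ∀ (x : Fin k) → toℕ x % k ≡ toℕ x
  toℕ-% x = ℕ.m<n⇒m%n≡m (Fin.toℕ<n x)

  %-+-% : ∀ i j → (i % k ℕ.+ j) % k ≡ (i ℕ.+ j) % k
  %-+-% i j = begin
    (i % k ℕ.+ j) % k               ≡⟨ ℕ.%-distribˡ-+ (i % k) j k ⟩
    (i % k % k ℕ.+ j % k) % k       ≡⟨ cong (λ z → (z ℕ.+ j % k) % k) (ℕ.m%n%n≡m%n i k) ⟩
    (i % k ℕ.+ j % k) % k           ≡⟨ ℕ.%-distribˡ-+ i j k ⟨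
    (i ℕ.+ j) % k                   ∎
    where open ≡-Reasoning

  -- Translation of ℤ/k by d.
  shift : ℕ → Fin k → Fin k
  shift d x = (toℕ x ℕ.+ d) mod k

  shift-+ : ∀ c d x → shift c (shift d x) ≡ shift (d ℕ.+ c) x
  shift-+ c d x = Fin.toℕ-injective (begin
    toℕ (shift c (shift d x))            ≡⟨ toℕ-mod _ ⟩
    (toℕ (shift d x) ℕ.+ c) % k          ≡⟨ cong (λ z → (z ℕ.+ c) % k) (toℕ-mod (toℕ x ℕ.+ d)) ⟩
    ((toℕ x ℕ.+ d) % k ℕ.+ c) % k        ≡⟨ %-+-% (toℕ x ℕ.+ d) c ⟩
    (toℕ x ℕ.+ d ℕ.+ c) % k              ≡⟨ cong (_% k) (ℕ.+-assoc (toℕ x) d c) ⟩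
    (toℕ x ℕ.+ (d ℕ.+ c)) % k            ≡⟨ toℕ-mod _ ⟨
    toℕ (shift (d ℕ.+ c) x)              ∎)
    where open ≡-Reasoning

  shift-multiple : ∀ j x → shift (j ℕ.* k) x ≡ x
  shift-multiple j x = Fin.toℕ-injective (begin
    toℕ (shift (j ℕ.* k) x)     ≡⟨ toℕ-mod _ ⟩
    (toℕ x ℕ.+ j ℕ.* k) % k     ≡⟨ ℕ.[m+kn]%n≡m%n (toℕ x) j k ⟩
    toℕ x % k                   ≡⟨ toℕ-% x ⟩
    toℕ x                       ∎)
    where open ≡-Reasoning

  shift-^ : ∀ d j x → (shift d ^ j) x ≡ shift (j ℕ.* d) x
  shift-^ d zero    x = sym (shift-multiple 0 x)
  shift-^ d (suc j) x = begin
    shift d ((shift d ^ j) x)       ≡⟨ cong (shift d) (shift-^ d j x) ⟩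
    shift d (shift (j ℕ.* d) x)     ≡⟨ shift-+ d (j ℕ.* d) x ⟩
    shift (j ℕ.* d ℕ.+ d) x         ≡⟨ cong (λ e → shift e x) (ℕ.+-comm (j ℕ.* d) d) ⟩
    shift (d ℕ.+ j ℕ.* d) x         ∎
    where open ≡-Reasoning

  shift-order : ∀ d x → (shift d ^ k) x ≡ x
  shift-order d x = trans (shift-^ d k x)
    (trans (cong (λ e → shift e x) (ℕ.*-comm k d)) (shift-multiple d x))

  cyclicSuc≗shift : ∀ (x : Fin k) → cyclicSuc x ≡ shift 1 x
  cyclicSuc≗shift x = cong (_mod k) (ℕ.+-comm 1 (toℕ x))

  cyclicSuc-order : ∀ x → (cyclicSuc {k} ^ k) x ≡ x
  cyclicSuc-order x = trans (^-cong cyclicSuc≗shift k x) (shift-order 1 x)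

  cyclicPred-order : ∀ x → (cyclicPred {k} ^ k) x ≡ x
  cyclicPred-order = shift-order (ℕ.pred k)

  pred-suc : ∀ x → cyclicPred {k} (cyclicSuc x) ≡ x
  pred-suc x = begin
    cyclicPred (cyclicSuc x)             ≡⟨ cong cyclicPred (cyclicSuc≗shift x) ⟩
    shift (ℕ.pred k) (shift 1 x)         ≡⟨ shift-+ (ℕ.pred k) 1 x ⟩
    shift (suc (ℕ.pred k)) x             ≡⟨ cong (λ d → shift d x) (ℕ.suc-pred k) ⟩
    shift k x                            ≡⟨ cong (λ d → shift d x) (ℕ.*-identityˡ k) ⟨
    shift (1 ℕ.* k) x                    ≡⟨ shift-multiple 1 x ⟩
    x                                    ∎
    where open ≡-Reasoning

  suc-pred : ∀ x → cyclicSuc {k} (cyclicPred x) ≡ x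
  suc-pred x = begin
    cyclicSuc (cyclicPred x)             ≡⟨ cyclicSuc≗shift _ ⟩
    shift 1 (shift (ℕ.pred k) x)         ≡⟨ shift-+ 1 (ℕ.pred k) x ⟩
    shift (ℕ.pred k ℕ.+ 1) x             ≡⟨ cong (λ d → shift d x) (ℕ.+-comm (ℕ.pred k) 1) ⟩
    shift (suc (ℕ.pred k)) x             ≡⟨ cong (λ d → shift d x) (ℕ.suc-pred k) ⟩
    shift k x                            ≡⟨ cong (λ d → shift d x) (ℕ.*-identityˡ k) ⟨
    shift (1 ℕ.* k) x                    ≡⟨ shift-multiple 1 x ⟩
    x                                    ∎
    where open ≡-Reasoning

------------------------------------------------------------------------
-- The walk on the grid

module GridWalk (n m : ℕ) .{{_ : NonZero n}} .{{_ : NonZero m}} where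
  open Defs.Grid n m
  open DecMembership _≟ᴬ_ using (_∈?_)

  right left up down : Vertex → Vertex
  right = map₁ cyclicSuc
  left  = map₁ cyclicPred
  up    = map₂ cyclicSuc
  down  = map₂ cyclicPred

  right-left : ∀ x → right (left x) ≡ x
  right-left (x , y) = cong (_, y) (suc-pred x)

  left-right : ∀ x → left (right x) ≡ x
  left-right (x , y) = cong (_, y) (pred-suc x)

  up-down : ∀ x → up (down x) ≡ x
  up-down (x , y) = cong (x ,_) (suc-pred y)

  down-up : ∀ x → down (up x) ≡ x
  down-up (x , y) = cong (x ,_) (pred-suc y)

  -- The unique face that an arc lies inside; conversely, corner f s is the tail of the arc of
  -- direction s inside the face f.
  face : Arc → Face
  face (x , 0F) = x
  face (x , 1F) = left (down x)
  face (x , 2F) = left x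
  face (x , 3F) = down x

  corner : Face → Dir → Vertex
  corner f 0F = f
  corner f 1F = up (right f)
  corner f 2F = right f
  corner f 3F = up f

  face-corner : ∀ f s → face (corner f s , s) ≡ f
  face-corner f 0F = refl
  face-corner f 1F = trans (cong left (down-up (right f))) (left-right f)
  face-corner f 2F = left-right f
  face-corner f 3F = down-up f

  ∈⇒corner : ∀ f x s → (x , s) ∈ arcsInside f → x ≡ corner f s
  ∈⇒corner f x s (here refl)                         = refl
  ∈⇒corner f x s (there (here refl))                 = refl
  ∈⇒corner f x s (there (there (here refl)))         = refl
  ∈⇒corner f x s (there (there (there (here refl)))) = refl

  corner∈ : ∀ f s → (corner f s , s) ∈ arcsInside f
  corner∈ f 0F = here refl
  corner∈ f 1F = there (there (here refl))
  corner∈ f 2F = there (here refl)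
  corner∈ f 3F = there (there (there (here refl)))

  corner-face : ∀ x s → corner (face (x , s)) s ≡ x
  corner-face x 0F = refl
  corner-face x 1F = trans (cong up (right-left (down x))) (up-down x)
  corner-face x 2F = right-left x
  corner-face x 3F = up-down x

  face∈ : ∀ x s → (x , s) ∈ arcsInside (face (x , s))
  face∈ x s = subst (λ y → (y , s) ∈ arcsInside (face (x , s))) (corner-face x s)
    (corner∈ (face (x , s)) s)

  ∈⇒face : ∀ f x s → (x , s) ∈ arcsInside f → f ≡ face (x , s)
  ∈⇒face f x s x∈f = trans (sym (face-corner f s)) (cong (λ y → face (y , s)) (sym (∈⇒corner f x s x∈f)))

  sumⱽ : FiniteSum Vertex
  sumⱽ = finSum n ⊗ finSum m

  sumᴬ : FiniteSum Arc
  sumᴬ = sumⱽ ⊗ finSum 4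

  -- The tail of the arc of direction s at x.
  base : Vertex → Dir → Vertex
  base x _ = x

  -- Half the sum over the four arcs (c x s , s); for c = base this is multiplication by Nᵀ, for
  -- c = corner by Mᵀ.
  block : (Vertex → Dir → Vertex) → (Arc → ℚ) → Vertex → ℚ
  block c ψ x = sum λ s → ½ * ψ (c x s , s)

  -- The reflection 2 N Nᵀ − I for p = tail and c = base, and 2 M Mᵀ − I for p = face and c = corner.
  reflect : (Arc → Vertex) → (Vertex → Dir → Vertex) → (Arc → ℚ) → Arc → ℚ
  reflect p c ψ α = 2ℚ * (½ * block c ψ (p α)) - ψ α

  -- The two reflections and their product, the walk step.
  reflectᶠ reflectⱽ step : (Arc → ℚ) → Arc → ℚ
  reflectᶠ = reflect face corner
  reflectⱽ = reflect tail base
  step ψ   = reflectᶠ (reflectⱽ ψ)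

  module _ (i : ℕ) where
    open Operators i

    N-represents : Represents sumⱽ N (λ φ α → ½ * φ (tail α))
    N-represents φ α = Σ-indicator sumⱽ (tail α ≡_) (tail α ≟ⱽ_) (tail α) refl (λ _ → sym) ½ℝ i φ

    M-represents : Represents sumⱽ M (λ w α → ½ * w (face α))
    M-represents w (x , s) = Σ-indicator sumⱽ (λ f → (x , s) ∈ arcsInside f)
      (λ f → (x , s) ∈? arcsInside f) (face (x , s)) (face∈ x s) (λ f → ∈⇒face f x s) ½ℝ i w

    Nᵀ-represents : Represents sumᴬ (N ᵀ) (block base)
    Nᵀ-represents ψ x = trans (Σ-swap sumⱽ (additive (finSum 4))
      (λ y s → seq (N (y , s) x) i * ψ (y , s)))
      (sum-cong-≗ λ s → Σ-indicator sumⱽ (_≡ x) (_≟ⱽ x) x refl (λ _ → id) ½ℝ i (λ y → ψ (y , s)))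

    Mᵀ-represents : Represents sumᴬ (M ᵀ) (block corner)
    Mᵀ-represents ψ f = trans (Σ-swap sumⱽ (additive (finSum 4))
      (λ y s → seq (M (y , s) f) i * ψ (y , s)))
      (sum-cong-≗ λ s → Σ-indicator sumⱽ (λ x → (x , s) ∈ arcsInside f) (λ x → (x , s) ∈? arcsInside f)
        (corner f s) (corner∈ f s) (λ x → ∈⇒corner f x s) ½ℝ i (λ y → ψ (y , s)))

    U-represents : Represents sumᴬ U step
    U-represents = mul-represents sumᴬ sumᴬ
      (reflection _≟ᴬ_ (mul Σᶠ M (M ᵀ))) (reflection _≟ᴬ_ (mul Σⱽ N (N ᵀ))) reflectᶠ reflectⱽ
      (reflection-represents _≟ᴬ_ sumᴬ (mul Σᶠ M (M ᵀ)) (λ ψ α → ½ * block corner ψ (face α))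
        (mul-represents sumⱽ sumᴬ M (M ᵀ) (λ w α → ½ * w (face α)) (block corner)
          M-represents Mᵀ-represents))
      (reflection-represents _≟ᴬ_ sumᴬ (mul Σⱽ N (N ᵀ)) (λ ψ α → ½ * block base ψ (tail α))
        (mul-represents sumⱽ sumᴬ N (N ᵀ) (λ φ α → ½ * φ (tail α)) (block base)
          N-represents Nᵀ-represents))

    -- The i-th approximations of a state evolve by step.
    power-U : ∀ t v α → seq (apply Σᴬ (power _≟ᴬ_ Σᴬ U t) v α) i ≡
      (step ^ t) (λ β → seq (v β) i) α
    power-U t = apply-represents sumᴬ (power _≟ᴬ_ Σᴬ U t) (step ^ t)
      (power-represents _≟ᴬ_ sumᴬ U step U-represents t)

    N-e : ∀ x α → seq (apply Σⱽ N (e x) α) i ≡ ½ * seq (e x (tail α)) i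
    N-e x α = apply-represents sumⱽ N (λ φ α → ½ * φ (tail α)) N-represents (e x) α

  reflect-cong : ∀ p c {ψ ψ′ : Arc → ℚ} → ψ ≗ ψ′ → reflect p c ψ ≗ reflect p c ψ′
  reflect-cong p c eq α = cong₂ (λ y z → 2ℚ * (½ * y) - z)
    (sum-cong-≗ λ s → cong (½ *_) (eq (c (p α) s , s))) (eq α)

  reflect-lin : ∀ p c k ψ l ψ′ α → reflect p c (λ β → k * ψ β + l * ψ′ β) α ≡
    k * reflect p c ψ α + l * reflect p c ψ′ α
  reflect-lin p c k ψ l ψ′ α = solve 12 (λ k l x₀ x₁ x₂ x₃ x y₀ y₁ y₂ y₃ y →
      con 2ℚ :* (con ½ :* (con ½ :* (k :* x₀ :+ l :* y₀) :+ (con ½ :* (k :* x₁ :+ l :* y₁) :+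
        (con ½ :* (k :* x₂ :+ l :* y₂) :+ (con ½ :* (k :* x₃ :+ l :* y₃) :+ con 0ℚ)))))
        :- (k :* x :+ l :* y)
      := k :* (con 2ℚ :* (con ½ :* (con ½ :* x₀ :+ (con ½ :* x₁ :+
           (con ½ :* x₂ :+ (con ½ :* x₃ :+ con 0ℚ))))) :- x)
         :+ l :* (con 2ℚ :* (con ½ :* (con ½ :* y₀ :+ (con ½ :* y₁ :+
           (con ½ :* y₂ :+ (con ½ :* y₃ :+ con 0ℚ))))) :- y))
    refl k l (ψ (x 0F)) (ψ (x 1F)) (ψ (x 2F)) (ψ (x 3F)) (ψ α)
      (ψ′ (x 0F)) (ψ′ (x 1F)) (ψ′ (x 2F)) (ψ′ (x 3F)) (ψ′ α)
    where
    x : Dir → Arc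
    x s = (c (p α) s , s)

  -- A reflection fixes the range of its projection.
  reflect-fixes : ∀ p c → (∀ x s → p (c x s , s) ≡ x) → ∀ (φ : Vertex → ℚ) →
    reflect p c (φ ∘ p) ≗ φ ∘ p
  reflect-fixes p c pc φ α = begin
    2ℚ * (½ * block c (φ ∘ p) (p α)) - φ (p α)
      ≡⟨ cong (λ y → 2ℚ * (½ * y) - φ (p α))
           (sum-cong-≗ λ s → cong (λ x → ½ * φ x) (pc (p α) s)) ⟩
    2ℚ * (½ * (½ * φ (p α) + (½ * φ (p α) + (½ * φ (p α) + (½ * φ (p α) + 0ℚ))))) - φ (p α)
      ≡⟨ solve 1 (λ x → con 2ℚ :* (con ½ :* (con ½ :* x :+ (con ½ :* x :+ (con ½ :* x :+
           (con ½ :* x :+ con 0ℚ))))) :- x := x) refl (φ (p α)) ⟩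
    φ (p α)
      ∎
    where open ≡-Reasoning

  reflectᶠ-tail : ∀ (φ : Vertex → ℚ) α →
    reflectᶠ (φ ∘ tail) α ≡ ½ * corners right up φ (face α) - φ (tail α)
  reflectᶠ-tail φ α = solve 5 (λ x r u ru t →
    con 2ℚ :* (con ½ :* (con ½ :* x :+ (con ½ :* ru :+ (con ½ :* r :+ (con ½ :* u :+ con 0ℚ))))) :- t
    := con ½ :* ((x :+ r) :+ (u :+ ru)) :- t) refl
    (φ f) (φ (right f)) (φ (up f)) (φ (up (right f))) (φ (tail α))
    where
    f : Face
    f = face α

  reflectⱽ-face : ∀ (w : Face → ℚ) α →
    reflectⱽ (w ∘ face) α ≡ ½ * corners left down w (tail α) + (- 1ℚ) * w (face α)
  reflectⱽ-face w α = solve 5 (λ x r u ru t →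
    con 2ℚ :* (con ½ :* (con ½ :* x :+ (con ½ :* ru :+ (con ½ :* r :+ (con ½ :* u :+ con 0ℚ))))) :- t
    := con ½ :* ((x :+ r) :+ (u :+ ru)) :+ con (- 1ℚ) :* t) refl
    (w x) (w (left x)) (w (down x)) (w (left (down x))) (w (face α))
    where
    x : Vertex
    x = tail α

  walk : Walk Vertex Arc
  walk = record
    { a = right ; a⁻ = left ; b = up ; b⁻ = down
    ; a-a⁻ = right-left ; a⁻-a = left-right ; b-b⁻ = up-down ; b⁻-b = down-up
    ; ab≡ba = λ _ → refl
    ; tail = tail ; face = face
    ; U = step
    ; U-cong = λ eq → reflect-cong face corner (reflect-cong tail base eq)
    ; U-lin = λ c ψ d ψ′ α → trans
        (reflect-cong face corner (reflect-lin tail base c ψ d ψ′) α)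
        (reflect-lin face corner c (reflectⱽ ψ) d (reflectⱽ ψ′) α)
    ; U-tail = λ φ α → trans
        (reflect-cong face corner (reflect-fixes tail base (λ _ _ → refl) φ) α)
        (reflectᶠ-tail φ α)
    ; U-face = step-face
    ; invariant = invariant
    }
    where
    step-face : ∀ (w : Face → ℚ) α → step (w ∘ face) α ≡
      (½ * (½ * corners right up (corners left down w) (face α)) - ½ * corners left down w (tail α))
        - w (face α)
    step-face w α = begin
      reflectᶠ (reflectⱽ (w ∘ face)) α
        ≡⟨ reflect-cong face corner (reflectⱽ-face w) α ⟩
      reflectᶠ (λ β → ½ * Qw (tail β) + (- 1ℚ) * w (face β)) α
        ≡⟨ reflect-lin face corner ½ (Qw ∘ tail) (- 1ℚ) (w ∘ face) α ⟩
      ½ * reflectᶠ (Qw ∘ tail) α + (- 1ℚ) * reflectᶠ (w ∘ face) α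
        ≡⟨ cong₂ (λ y z → ½ * y + (- 1ℚ) * z) (reflectᶠ-tail Qw α)
             (reflect-fixes face corner face-corner w α) ⟩
      ½ * (½ * corners right up Qw (face α) - Qw (tail α)) + (- 1ℚ) * w (face α)
        ≡⟨ solve 3 (λ p q r → con ½ :* (con ½ :* p :- q) :+ con (- 1ℚ) :* r :=
             (con ½ :* (con ½ :* p) :- con ½ :* q) :- r) refl
             (corners right up Qw (face α)) (Qw (tail α)) (w (face α)) ⟩
      (½ * (½ * corners right up Qw (face α)) - ½ * Qw (tail α)) - w (face α)
        ∎
      where
      open ≡-Reasoning
      Qw : Vertex → ℚ
      Qw = corners left down w
    invariant : ∀ (θ : Vertex → ℚ) → θ ∘ right ≗ θ → θ ∘ up ≗ θ → ∀ α → θ (face α) ≡ θ (tail α)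
    invariant θ θr θu (x , 0F) = refl
    invariant θ θr θu (x , 1F) = trans (θl (down x)) (θd x)
      where
      θl : ∀ y → θ (left y) ≡ θ y
      θl y = trans (sym (θr (left y))) (cong θ (right-left y))
      θd : ∀ y → θ (down y) ≡ θ y
      θd y = trans (sym (θu (down y))) (cong θ (up-down y))
    invariant θ θr θu (x , 2F) = trans (sym (θr (left x))) (cong θ (right-left x))
    invariant θ θr θu (x , 3F) = trans (sym (θu (down x))) (cong θ (up-down x))

  right-order : ∀ x → (right ^ n) x ≡ x
  right-order (x , y) = trans (go n) (cong (_, y) (cyclicSuc-order x))
    where
    go : ∀ k → (right ^ k) (x , y) ≡ ((cyclicSuc ^ k) x , y)
    go zero    = refl
    go (suc k) = cong right (go k)

  left-order : ∀ x → (left ^ n) x ≡ x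
  left-order (x , y) = trans (go n) (cong (_, y) (cyclicPred-order x))
    where
    go : ∀ k → (left ^ k) (x , y) ≡ ((cyclicPred ^ k) x , y)
    go zero    = refl
    go (suc k) = cong left (go k)

  up-order : ∀ x → (up ^ m) x ≡ x
  up-order (x , y) = trans (go m) (cong (x ,_) (cyclicSuc-order y))
    where
    go : ∀ k → (up ^ k) (x , y) ≡ (x , (cyclicSuc ^ k) y)
    go zero    = refl
    go (suc k) = cong up (go k)

  down-order : ∀ x → (down ^ m) x ≡ x
  down-order (x , y) = trans (go m) (cong (x ,_) (cyclicPred-order y))
    where
    go : ∀ k → (down ^ k) (x , y) ≡ (x , (cyclicPred ^ k) y)
    go zero    = refl
    go (suc k) = cong down (go k)

------------------------------------------------------------------------
-- Limits of rational sequences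

infix 4 _⟶_

-- The sequence u converges to the rational p.
record _⟶_ (u : ℕ → ℚ) (p : ℚ) : Set where
  constructor limit
  field
    eventually : ∀ ε → 0ℚ ℚ.< ε → ∃ λ K → ∀ i → K ℕ.≤ i → ∣ u i - p ∣ ℚ.< ε

open _⟶_

½-pos : ∀ {ε} → 0ℚ ℚ.< ε → 0ℚ ℚ.< ½ * ε
½-pos {ε} 0<ε = subst (ℚ._< ½ * ε) (ℚ.*-zeroʳ ½) (ℚ.*-monoʳ-<-pos ½ 0<ε)

½+½ : ∀ ε → ½ * ε + ½ * ε ≡ ε
½+½ = solve 1 (λ ε → con ½ :* ε :+ con ½ :* ε := ε) refl

∣-∣-sym : ∀ p q → ∣ p - q ∣ ≡ ∣ q - p ∣
∣-∣-sym p q = trans (sym (ℚ.∣-p∣≡∣p∣ (p - q)))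
  (cong ∣_∣ (solve 2 (λ p q → :- (p :- q) := q :- p) refl p q))

abstract

  -- The quotient δ of ε by 1 + |c|; the 1 keeps the divisor positive when c = 0.
  -- It is abstract so that the reciprocal never unfolds.
  divide : ∀ ε c → 0ℚ ℚ.< ε → ∃ λ δ → 0ℚ ℚ.< δ × (1ℚ + ∣ c ∣) * δ ≡ ε
  divide ε c 0<ε = 1/b * ε
    , subst (ℚ._< 1/b * ε) (ℚ.*-zeroʳ 1/b) (ℚ.*-monoʳ-<-pos 1/b {{ℚ.1/pos⇒pos b}} 0<ε)
    , trans (sym (ℚ.*-assoc b 1/b ε)) (trans (cong (_* ε) (ℚ.*-inverseʳ b)) (ℚ.*-identityˡ ε))
    where
    b : ℚ
    b = 1ℚ + ∣ c ∣
    instance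
      b>0 : Positive b
      b>0 = positive (ℚ.+-mono-<-≤ (ℚ.positive⁻¹ 1ℚ) (ℚ.0≤∣p∣ c))
      b≢0 : ℚ.NonZero b
      b≢0 = ℚ.pos⇒nonZero b
    1/b : ℚ
    1/b = 1/ b

1+∣_∣-pos : ∀ c → 0ℚ ℚ.< 1ℚ + ∣ c ∣
1+∣ c ∣-pos = ℚ.+-mono-<-≤ (ℚ.positive⁻¹ 1ℚ) (ℚ.0≤∣p∣ c)

⟶-const : ∀ p → (λ _ → p) ⟶ p
⟶-const p .eventually ε 0<ε = 0 , λ _ _ → subst (ℚ._< ε) (cong ∣_∣ (sym (ℚ.+-inverseʳ p))) 0<ε

⟶-resp : ∀ {u v p} → u ≗ v → u ⟶ p → v ⟶ p
⟶-resp {p = p} e l .eventually ε 0<ε with l .eventually ε 0<ε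
... | K , h = K , λ i K≤i → subst (λ z → ∣ z - p ∣ ℚ.< ε) (e i) (h i K≤i)

⟶-+ : ∀ {u v p q} → u ⟶ p → v ⟶ q → (λ i → u i + v i) ⟶ (p + q)
⟶-+ {u} {v} {p} {q} l l′ .eventually ε 0<ε
  with l .eventually (½ * ε) (½-pos 0<ε) | l′ .eventually (½ * ε) (½-pos 0<ε)
... | K , h | K′ , h′ = K ℕ.⊔ K′ , λ i ≤i → begin-strict
  ∣ (u i + v i) - (p + q) ∣         ≡⟨ cong ∣_∣ (solve 4 (λ u v p q → (u :+ v) :- (p :+ q) :=
                                         (u :- p) :+ (v :- q)) refl (u i) (v i) p q) ⟩
  ∣ (u i - p) + (v i - q) ∣         ≤⟨ ℚ.∣p+q∣≤∣p∣+∣q∣ (u i - p) (v i - q) ⟩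
  ∣ u i - p ∣ + ∣ v i - q ∣         <⟨ ℚ.+-mono-< (h i (ℕ.m⊔n≤o⇒m≤o K K′ ≤i)) (h′ i (ℕ.m⊔n≤o⇒n≤o K K′ ≤i)) ⟩
  ½ * ε + ½ * ε                     ≡⟨ ½+½ ε ⟩
  ε                                 ∎
  where open ℚ.≤-Reasoning

⟶-* : ∀ {u v p q} → u ⟶ p → v ⟶ q → (λ i → u i * v i) ⟶ (p * q)
⟶-* {u} {v} {p} {q} l l′ .eventually ε 0<ε
  with divide (½ * ε) p (½-pos 0<ε) | divide (½ * ε) q (½-pos 0<ε)
... | δ , 0<δ , pδ | η , 0<η , qη 
  with l .eventually 1ℚ (ℚ.positive⁻¹ 1ℚ) | l′ .eventually δ 0<δ | l .eventually η 0<η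
... | K₁ , h₁ | K₂ , h₂ | K₃ , h₃ = K₁ ℕ.⊔ (K₂ ℕ.⊔ K₃) , close
  where
  close : ∀ i → K₁ ℕ.⊔ (K₂ ℕ.⊔ K₃) ℕ.≤ i → ∣ u i * v i - p * q ∣ ℚ.< ε
  close i ≤i = begin-strict
    ∣ u i * v i - p * q ∣
      ≡⟨ cong ∣_∣ (solve 4 (λ u v p q → u :* v :- p :* q := u :* (v :- q) :+ q :* (u :- p)) refl
           (u i) (v i) p q) ⟩
    ∣ u i * (v i - q) + q * (u i - p) ∣
      ≤⟨ ℚ.∣p+q∣≤∣p∣+∣q∣ (u i * (v i - q)) (q * (u i - p)) ⟩
    ∣ u i * (v i - q) ∣ + ∣ q * (u i - p) ∣
      ≡⟨ cong₂ _+_ (ℚ.∣p*q∣≡∣p∣*∣q∣ (u i) (v i - q)) (ℚ.∣p*q∣≡∣p∣*∣q∣ q (u i - p)) ⟩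
    ∣ u i ∣ * ∣ v i - q ∣ + ∣ q ∣ * ∣ u i - p ∣
      <⟨ ℚ.+-mono-< 
         (below (u i) (1ℚ + ∣ p ∣) (v i - q) δ u≤ 1+∣ p ∣-pos (h₂ i ≤K₂))
         (below q (1ℚ + ∣ q ∣) (u i - p) η q≤ 1+∣ q ∣-pos (h₃ i ≤K₃)) ⟩
    (1ℚ + ∣ p ∣) * δ + (1ℚ + ∣ q ∣) * η
      ≡⟨ cong₂ _+_ pδ qη ⟩
    ½ * ε + ½ * ε
      ≡⟨ ½+½ ε ⟩
    ε
      ∎
    where
    open ℚ.≤-Reasoning
    ≤K₁ : K₁ ℕ.≤ i
    ≤K₁ = ℕ.m⊔n≤o⇒m≤o K₁ (K₂ ℕ.⊔ K₃) ≤i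
    ≤K₂ : K₂ ℕ.≤ i
    ≤K₂ = ℕ.m⊔n≤o⇒m≤o K₂ K₃ (ℕ.m⊔n≤o⇒n≤o K₁ (K₂ ℕ.⊔ K₃) ≤i)
    ≤K₃ : K₃ ℕ.≤ i
    ≤K₃ = ℕ.m⊔n≤o⇒n≤o K₂ K₃ (ℕ.m⊔n≤o⇒n≤o K₁ (K₂ ℕ.⊔ K₃) ≤i)
    below : ∀ c b x y → ∣ c ∣ ℚ.≤ b → 0ℚ ℚ.< b → ∣ x ∣ ℚ.< y → ∣ c ∣ * ∣ x ∣ ℚ.< b * y
    below c b x y c≤b 0<b x<y = begin-strict
      ∣ c ∣ * ∣ x ∣   ≤⟨ ℚ.*-monoʳ-≤-nonNeg ∣ x ∣ {{ℚ.∣-∣-nonNeg x}} c≤b ⟩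
      b * ∣ x ∣       <⟨ ℚ.*-monoʳ-<-pos b {{positive 0<b}} x<y ⟩
      b * y           ∎
    u≤ : ∣ u i ∣ ℚ.≤ 1ℚ + ∣ p ∣
    u≤ = begin
      ∣ u i ∣              ≡⟨ cong ∣_∣ (solve 2 (λ u p → u := (u :- p) :+ p) refl (u i) p) ⟩
      ∣ (u i - p) + p ∣    ≤⟨ ℚ.∣p+q∣≤∣p∣+∣q∣ (u i - p) p ⟩
      ∣ u i - p ∣ + ∣ p ∣  ≤⟨ ℚ.+-monoˡ-≤ ∣ p ∣ (ℚ.<⇒≤ (h₁ i ≤K₁)) ⟩
      1ℚ + ∣ p ∣           ∎
    q≤ : ∣ q ∣ ℚ.≤ 1ℚ + ∣ q ∣
    q≤ = begin
      ∣ q ∣         ≡⟨ ℚ.+-identityˡ ∣ q ∣ ⟨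
      0ℚ + ∣ q ∣    ≤⟨ ℚ.+-monoˡ-≤ ∣ q ∣ (ℚ.<⇒≤ (ℚ.positive⁻¹ 1ℚ)) ⟩
      1ℚ + ∣ q ∣    ∎

limits-close : ∀ {u p q} → u ⟶ p → u ⟶ q → ∀ ε → 0ℚ ℚ.< ε → ∣ p - q ∣ ℚ.< ε
limits-close {u} {p} {q} l l′ ε 0<ε
  with l .eventually (½ * ε) (½-pos 0<ε) | l′ .eventually (½ * ε) (½-pos 0<ε)
... | K , h | K′ , h′ = begin-strict
  ∣ p - q ∣                   ≡⟨ cong ∣_∣ (solve 3 (λ p q u → p :- q := (p :- u) :+ (u :- q)) refl p q (u i)) ⟩
  ∣ (p - u i) + (u i - q) ∣   ≤⟨ ℚ.∣p+q∣≤∣p∣+∣q∣ (p - u i) (u i - q) ⟩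
  ∣ p - u i ∣ + ∣ u i - q ∣   <⟨ ℚ.+-mono-< p-close (h′ i (ℕ.m≤n⊔m K K′)) ⟩
  ½ * ε + ½ * ε               ≡⟨ ½+½ ε ⟩
  ε                           ∎
  where
  open ℚ.≤-Reasoning
  i : ℕ
  i = K ℕ.⊔ K′
  p-close : ∣ p - u i ∣ ℚ.< ½ * ε
  p-close = subst (ℚ._< ½ * ε) (∣-∣-sym (u i) p) (h i (ℕ.m≤m⊔n K K′))

-- If p and q differ, limits-close with ε = |p − q| is absurd.
⟶-unique : ∀ {u p q} → u ⟶ p → u ⟶ q → p ≡ q
⟶-unique {u} {p} {q} l l′ with p ℚ.≟ q
... | yes p≡q = p≡q
... | no  p≢q = contradiction (limits-close l l′ ∣ p - q ∣ 0<d) (ℚ.<-irrefl refl)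
  where
  0<d : 0ℚ ℚ.< ∣ p - q ∣
  0<d = ℚ.≰⇒> λ d≤0 →
    p≢q (x-y≡0⇒x≡y p q (ℚ.∣p∣≡0⇒p≡0 (p - q) (ℚ.≤-antisym d≤0 (ℚ.0≤∣p∣ (p - q)))))

-- If x = y as reals and x is constantly p, the approximations of y converge to p.
≈⇒⟶ : ∀ {x y : ℝ} {p} → x Defs.≈ y → (∀ i → seq x i ≡ p) → seq y ⟶ p
≈⇒⟶ {x} {y} {p} x≈y x≡p .eventually ε 0<ε with x≈y ε 0<ε
... | K , h = K , λ i K≤i → subst (ℚ._< ε)
  (trans (cong (λ z → ∣ z - seq y i ∣) (x≡p i)) (∣-∣-sym p (seq y i))) (h i K≤i)

≈-sym : ∀ {x y : ℝ} → x Defs.≈ y → y Defs.≈ x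
≈-sym {x} {y} x≈y ε 0<ε with x≈y ε 0<ε
... | K , h = K , λ i K≤i → subst (ℚ._< ε) (∣-∣-sym (seq x i) (seq y i)) (h i K≤i)

≗⇒≈ : ∀ {x y : ℝ} → seq x ≗ seq y → x Defs.≈ y
≗⇒≈ {x} {y} e ε 0<ε = 0 , λ i _ → subst (ℚ._< ε) (sym (cong ∣_∣ (x-x≡0 (e i)))) 0<ε

------------------------------------------------------------------------
-- Periodicity as a statement about rational states

-- Finitely many positive periods have a common multiple.
common-period : ∀ n (P : Fin n → ℕ → Set) → (∀ i j t → P i t → P i (j ℕ.* t)) →
  (∀ i → ∃ λ t → 0 ℕ.< t × P i t) → ∃ λ t → 0 ℕ.< t × (∀ i → P i t)
common-period zero    P mult p = 1 , ℕ.z<s , λ ()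
common-period (suc n) P mult p with p zero | common-period n (P ∘ suc) (mult ∘ suc) (p ∘ suc)
... | t , 0<t , P0 | t′ , 0<t′ , P+ = t′ ℕ.* t , ℕ.*-mono-< 0<t′ 0<t , λ
  { zero    → mult zero t′ t P0
  ; (suc i) → subst (P (suc i)) (ℕ.*-comm t t′) (mult (suc i) t t′ (P+ i))
  }

module Period (n m : ℕ) .{{_ : NonZero n}} .{{_ : NonZero m}} where
  open Defs.Grid n m hiding (tail)
  open GridWalk n m hiding (face)
  open WalkProperties walk using (U^-cong; U^-lin; tail) renaming (U to W)
  open Fixed walk

  -- The phase is γ = 1.
  fixed⇒periodic : ∀ τ → 0 ℕ.< τ → (∀ φ → Fix τ φ) → Periodic
  fixed⇒periodic τ 0<τ fix x = τ , 0<τ , (1ℝ +i 0ℝ)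
    , ≗⇒≈ {x = 1ℝ Defs.* 1ℝ Defs.+ 0ℝ Defs.* 0ℝ} {1ℝ} (λ _ → refl) , λ α → real α , imaginary α
    where
    Ne : Arc → ℝ
    Ne = apply Σⱽ N (e x)
    returns : ∀ α i → seq (apply Σᴬ (power _≟ᴬ_ Σᴬ U τ) Ne α) i ≡ seq (Ne α) i
    returns α i = begin
      seq (apply Σᴬ (power _≟ᴬ_ Σᴬ U τ) Ne α) i           ≡⟨ power-U i τ Ne α ⟩
      (W ^ τ) (λ β → seq (Ne β) i) α                      ≡⟨ U^-cong τ (N-e i x) α ⟩
      (W ^ τ) (λ β → ½ * seq (e x (tail β)) i) α          ≡⟨ fix (λ y → ½ * seq (e x y) i) .return α ⟩
      ½ * seq (e x (tail α)) i                            ≡⟨ N-e i x α ⟨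
      seq (Ne α) i                                        ∎
      where open ≡-Reasoning
    real : ∀ α → apply Σᴬ (power _≟ᴬ_ Σᴬ U τ) Ne α Defs.≈ 1ℝ Defs.* Ne α Defs.- 0ℝ Defs.* 0ℝ
    real α = ≗⇒≈ {x = apply Σᴬ (power _≟ᴬ_ Σᴬ U τ) Ne α} {1ℝ Defs.* Ne α Defs.- 0ℝ Defs.* 0ℝ} λ i →
      trans (returns α i) (solve 1 (λ z → z := con 1ℚ :* z :- con 0ℚ :* con 0ℚ) refl (seq (Ne α) i))
    imaginary : ∀ α → 0ℝ Defs.≈ 1ℝ Defs.* 0ℝ Defs.+ 0ℝ Defs.* Ne α
    imaginary α = ≗⇒≈ {x = 0ℝ} {1ℝ Defs.* 0ℝ Defs.+ 0ℝ Defs.* Ne α} λ i →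
      solve 1 (λ z → con 0ℚ := con 1ℚ :* con 0ℚ :+ con 0ℚ :* z) refl (seq (Ne α) i)

  -- The rational version of the basis vector e x.
  dirac : Vertex → Vertex → ℚ
  dirac x y = if does (x ≟ⱽ y) then 1ℚ else 0ℚ

  dirac-self : ∀ x → dirac x x ≡ 1ℚ
  dirac-self x with x ≟ⱽ x
  ... | yes _  = refl
  ... | no x≢x = contradiction refl x≢x

  dirac-off : ∀ {x y} → x ≢ y → dirac x y ≡ 0ℚ
  dirac-off {x} {y} x≢y with x ≟ⱽ y
  ... | yes x≡y = contradiction x≡y x≢y
  ... | no _    = refl

  seq-e : ∀ x y i → seq (e x y) i ≡ dirac x y
  seq-e x y i with does (x ≟ⱽ y)
  ... | true  = refl
  ... | false = refl

  Fix-scale : ∀ k c φ → Fix k φ → Fix k (λ x → c * φ x)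
  Fix-scale k c φ f .return α = begin
    (W ^ k) (λ β → c * φ (tail β)) α
      ≡⟨ U^-cong k (λ β → scale (φ (tail β))) α ⟩
    (W ^ k) (λ β → c * φ (tail β) + 0ℚ * φ (tail β)) α
      ≡⟨ U^-lin k c (φ ∘ tail) 0ℚ (φ ∘ tail) α ⟩
    c * (W ^ k) (φ ∘ tail) α + 0ℚ * (W ^ k) (φ ∘ tail) α
      ≡⟨ scale ((W ^ k) (φ ∘ tail) α) ⟨
    c * (W ^ k) (φ ∘ tail) α
      ≡⟨ cong (c *_) (f .return α) ⟩
    c * φ (tail α)
      ∎
    where
    open ≡-Reasoning
    scale : ∀ z → c * z ≡ c * z + 0ℚ * z
    scale = solve 2 (λ c z → c :* z := c :* z :+ con 0ℚ :* z) refl c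

  -- The returned state Z is a rational multiple g of N e_x, the approximations of re γ converge to g
  -- and those of im γ to 0, so g² = 1 and twice the period restores N e_x.
  periodicAt⇒fixed : ∀ x → PeriodicAt x → ∃ λ t → 0 ℕ.< t × Fix t (dirac x)
  periodicAt⇒fixed x (t , 0<t , γ , unimodular , eq) = t ℕ.+ t , ℕ.<-≤-trans 0<t (ℕ.m≤m+n t t) , fixed
    where
    h : Vertex → ℚ
    h y = ½ * dirac x y
    Z : Arc → ℚ
    Z = (W ^ t) (h ∘ tail)
    Ne : Arc → ℝ
    Ne = apply Σⱽ N (e x)
    seq-Ne : ∀ α i → seq (Ne α) i ≡ h (tail α)
    seq-Ne α i = trans (N-e i x α) (cong (½ *_) (seq-e x (tail α) i))
    seq-Z : ∀ α i → seq (apply Σᴬ (power _≟ᴬ_ Σᴬ U t) Ne α) i ≡ Z α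
    seq-Z α i = trans (power-U i t Ne α) (U^-cong t (λ β → seq-Ne β i) α)
    r s : ℕ → ℚ
    r = seq (re γ)
    s = seq (im γ)
    rh⟶Z : ∀ α → (λ i → h (tail α) * r i) ⟶ Z α
    rh⟶Z α = ⟶-resp
      (λ i → trans (cong (λ z → r i * z - s i * 0ℚ) (seq-Ne α i))
        (solve 3 (λ r s h → r :* h :- s :* con 0ℚ := h :* r) refl (r i) (s i) (h (tail α))))
      (≈⇒⟶ {x = apply Σᴬ (power _≟ᴬ_ Σᴬ U t) Ne α} {re γ Defs.* Ne α Defs.- im γ Defs.* 0ℝ}
        (proj₁ (eq α)) (seq-Z α))
    sh⟶0 : ∀ α → (λ i → h (tail α) * s i) ⟶ 0ℚ
    sh⟶0 α = ⟶-resp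
      (λ i → trans (cong (λ z → r i * 0ℚ + s i * z) (seq-Ne α i))
        (solve 3 (λ r s h → r :* con 0ℚ :+ s :* h := h :* s) refl (r i) (s i) (h (tail α))))
      (≈⇒⟶ {x = 0ℝ} {re γ Defs.* 0ℝ Defs.+ im γ Defs.* Ne α} (proj₂ (eq α)) (λ _ → refl))
    α₀ : Arc
    α₀ = x , 0F
    double : ∀ z → 2ℚ * (h x * z) ≡ z
    double z = trans (cong (λ y → 2ℚ * (½ * y * z)) (dirac-self x))
      (solve 1 (λ z → con 2ℚ :* (con ½ :* con 1ℚ :* z) := z) refl z)
    g : ℚ
    g = 2ℚ * Z α₀
    r⟶g : r ⟶ g
    r⟶g = ⟶-resp (double ∘ r) (⟶-* (⟶-const 2ℚ) (rh⟶Z α₀))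
    s⟶0 : s ⟶ (2ℚ * 0ℚ)
    s⟶0 = ⟶-resp (double ∘ s) (⟶-* (⟶-const 2ℚ) (sh⟶0 α₀))
    Z≡hg : ∀ α → Z α ≡ h (tail α) * g
    Z≡hg α = ⟶-unique (rh⟶Z α) (⟶-* (⟶-const (h (tail α))) r⟶g)
    g²≡1 : g * g ≡ 1ℚ
    g²≡1 = trans (solve 1 (λ g → g :* g := g :* g :+ (con 2ℚ :* con 0ℚ) :* (con 2ℚ :* con 0ℚ)) refl g)
      (⟶-unique (⟶-+ (⟶-* r⟶g r⟶g) (⟶-* s⟶0 s⟶0))
        (≈⇒⟶ {x = 1ℝ} {re γ Defs.* re γ Defs.+ im γ Defs.* im γ}
          (≈-sym {x = re γ Defs.* re γ Defs.+ im γ Defs.* im γ} {1ℝ} unimodular) (λ _ → refl)))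
    fixed-h : Fix (t ℕ.+ t) h
    fixed-h .return α = begin
      (W ^ (t ℕ.+ t)) (h ∘ tail) α
        ≡⟨ cong-app (fold-+ (h ∘ tail) W t) α ⟩
      (W ^ t) Z α
        ≡⟨ U^-cong t (λ β → trans (Z≡hg β) (scale (h (tail β)))) α ⟩
      (W ^ t) (λ β → g * h (tail β) + 0ℚ * h (tail β)) α
        ≡⟨ U^-lin t g (h ∘ tail) 0ℚ (h ∘ tail) α ⟩
      g * Z α + 0ℚ * Z α
        ≡⟨ cong (λ z → g * z + 0ℚ * z) (Z≡hg α) ⟩
      g * (h (tail α) * g) + 0ℚ * (h (tail α) * g)
        ≡⟨ solve 2 (λ g h → g :* (h :* g) :+ con 0ℚ :* (h :* g) := h :* (g :* g)) refl g (h (tail α)) ⟩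
      h (tail α) * (g * g)
        ≡⟨ cong (h (tail α) *_) g²≡1 ⟩
      h (tail α) * 1ℚ
        ≡⟨ ℚ.*-identityʳ (h (tail α)) ⟩
      h (tail α)
        ∎
      where
      open ≡-Reasoning
      scale : ∀ z → z * g ≡ g * z + 0ℚ * z
      scale z = solve 2 (λ g z → z :* g := g :* z :+ con 0ℚ :* z) refl g z
    fixed : Fix (t ℕ.+ t) (dirac x)
    fixed = Fix-resp (t ℕ.+ t) (λ y → solve 1 (λ z → con 2ℚ :* (con ½ :* z) := z) refl (dirac x y))
      (Fix-scale (t ℕ.+ t) 2ℚ h fixed-h)
      where
      Fix-resp : ∀ k {φ χ} → φ ≗ χ → Fix k φ → Fix k χ
      Fix-resp k e f .return α = trans (sym (U^-cong k (e ∘ tail) α)) (trans (f .return α) (e (tail α)))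

  -- The functions dirac x span all functions.
  dirac-basis⇒fixed : ∀ t → (∀ x → Fix t (dirac x)) → ∀ φ → Fix t φ
  dirac-basis⇒fixed t fix φ .return α = begin
    L φ                                       ≡⟨ Additive.L-cong L-additive (expand φ) ⟩
    L (λ y → Σⱼ λ x → φ x * dirac x y)        ≡⟨ Σ-swap sumⱽ L-additive (λ x y → φ x * dirac x y) ⟨
    Σⱼ (λ x → L (λ y → φ x * dirac x y))      ≡⟨ Σ-cong sumⱽ (λ x → Fix-scale t (φ x) (dirac x) (fix x) .return α) ⟩
    Σⱼ (λ x → φ x * dirac x (tail α))         ≡⟨ expand φ (tail α) ⟨
    φ (tail α)                                ∎
    where
    open ≡-Reasoning
    Σⱼ : (Vertex → ℚ) → ℚ
    Σⱼ = FiniteSum.Σ sumⱽ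
    L : (Vertex → ℚ) → ℚ
    L χ = (W ^ t) (χ ∘ tail) α
    expand : ∀ χ y → χ y ≡ Σⱼ λ x → χ x * dirac x y
    expand χ y = sym (trans
      (Σ-support sumⱽ (λ x → χ x * dirac x y) y
        λ x x≢y → trans (cong (χ x *_) (dirac-off x≢y)) (ℚ.*-zeroʳ (χ x)))
      (trans (cong (χ y *_) (dirac-self y)) (ℚ.*-identityʳ (χ y))))
    L-additive : Additive L
    L-additive = record
      { L-cong = λ e → U^-cong t (e ∘ tail) α
      ; L-0 = trans (U^-lin t 0ℚ (λ _ → 0ℚ) 0ℚ (λ _ → 0ℚ) α)
          (solve 1 (λ z → con 0ℚ :* z :+ con 0ℚ :* z := con 0ℚ) refl ((W ^ t) (λ _ → 0ℚ) α))
      ; L-+ = λ f g → begin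
          L (λ y → f y + g y)
            ≡⟨ U^-cong t (λ β → cong₂ _+_ (sym (ℚ.*-identityˡ (f (tail β)))) (sym (ℚ.*-identityˡ (g (tail β))))) α ⟩
          (W ^ t) (λ β → 1ℚ * f (tail β) + 1ℚ * g (tail β)) α
            ≡⟨ U^-lin t 1ℚ (f ∘ tail) 1ℚ (g ∘ tail) α ⟩
          1ℚ * L f + 1ℚ * L g
            ≡⟨ cong₂ _+_ (ℚ.*-identityˡ (L f)) (ℚ.*-identityˡ (L g)) ⟩
          L f + L g
            ∎
      }

  periodic⇒fixed : Periodic → ∃ λ T → 0 ℕ.< T × (∀ φ → Fix T φ)
  periodic⇒fixed periodic = T , 0<T , dirac-basis⇒fixed T (λ (x , y) → fix x y)
    where
    P : Fin n → Fin m → ℕ → Set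
    P x y t = Fix t (dirac (x , y))
    common : ∃ λ t → 0 ℕ.< t × (∀ x y → P x y t)
    common = common-period n (λ x t → ∀ y → P x y t)
      (λ x j t p y → Fix-* j t (dirac (x , y)) (p y))
      (λ x → common-period m (P x) (λ y j t → Fix-* j t (dirac (x , y)))
        (λ y → periodicAt⇒fixed (x , y) (periodic (x , y))))
    T : ℕ
    T = proj₁ common
    0<T : 0 ℕ.< T
    0<T = proj₁ (proj₂ common)
    fix : ∀ x y → P x y T
    fix = proj₂ (proj₂ common)

------------------------------------------------------------------------
-- Integral rationals

abstract

  -- The embedding of the integers, abstract so that it never unfolds to normal forms of fractions.
  ι : ℤ → ℚ
  ι z = fromℚᵘ (mkℚᵘ z 0)

  private
    toℚᵘ-ι : ∀ z → toℚᵘ (ι z) ℚᵘ.≃ mkℚᵘ z 0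
    toℚᵘ-ι z = ℚ.toℚᵘ-fromℚᵘ (mkℚᵘ z 0)

  ι-injective : ∀ {x y} → ι x ≡ ι y → x ≡ y
  ι-injective {x} {y} eq
    with ℚᵘ.≃-trans (ℚᵘ.≃-sym (toℚᵘ-ι x)) (ℚᵘ.≃-trans (ℚᵘ.≃-reflexive (cong toℚᵘ eq)) (toℚᵘ-ι y))
  ... | *≡* e = trans (sym (ℤ.*-identityʳ x)) (trans e (ℤ.*-identityʳ y))

  ι-+ : ∀ x y → ι (x ℤ.+ y) ≡ ι x + ι y
  ι-+ x y = ℚ.toℚᵘ-injective (begin
    toℚᵘ (ι (x ℤ.+ y))              ≈⟨ toℚᵘ-ι (x ℤ.+ y) ⟩
    mkℚᵘ (x ℤ.+ y) 0                ≈⟨ *≡* (eq x y) ⟩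
    mkℚᵘ x 0 ℚᵘ.+ mkℚᵘ y 0          ≈⟨ ℚᵘ.+-cong (toℚᵘ-ι x) (toℚᵘ-ι y) ⟨
    toℚᵘ (ι x) ℚᵘ.+ toℚᵘ (ι y)      ≈⟨ ℚ.toℚᵘ-homo-+ (ι x) (ι y) ⟨
    toℚᵘ (ι x + ι y)                ∎)
    where
    open ℚᵘ.≃-Reasoning
    eq : ∀ x y → (x ℤ.+ y) ℤ.* 1ℤ ≡ (x ℤ.* 1ℤ ℤ.+ y ℤ.* 1ℤ) ℤ.* 1ℤ
    eq = solve-∀

  ι-* : ∀ x y → ι (x ℤ.* y) ≡ ι x * ι y
  ι-* x y = ℚ.toℚᵘ-injective (begin
    toℚᵘ (ι (x ℤ.* y))              ≈⟨ toℚᵘ-ι (x ℤ.* y) ⟩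
    mkℚᵘ x 0 ℚᵘ.* mkℚᵘ y 0          ≈⟨ ℚᵘ.*-cong (toℚᵘ-ι x) (toℚᵘ-ι y) ⟨
    toℚᵘ (ι x) ℚᵘ.* toℚᵘ (ι y)      ≈⟨ ℚ.toℚᵘ-homo-* (ι x) (ι y) ⟨
    toℚᵘ (ι x * ι y)                ∎)
    where open ℚᵘ.≃-Reasoning

  ι-1 : ι 1ℤ ≡ 1ℚ
  ι-1 = refl

  ι-neg1 : ι (ℤ.- 1ℤ) ≡ - 1ℚ
  ι-neg1 = refl

  ι-4 : ι (+ 4) ≡ 4ℚ
  ι-4 = refl

  ι-2 : ι (+ 2) ≡ 2ℚ
  ι-2 = refl

Integral : ℚ → Set
Integral q = ∃ λ z → q ≡ ι z

Integral-+ : ∀ {p q} → Integral p → Integral q → Integral (p + q)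
Integral-+ (x , refl) (y , refl) = x ℤ.+ y , sym (ι-+ x y)

Integral-* : ∀ {p q} → Integral p → Integral q → Integral (p * q)
Integral-* (x , refl) (y , refl) = x ℤ.* y , sym (ι-* x y)

Integral-2 : Integral 2ℚ
Integral-2 = + 2 , sym ι-2

Integral-4 : Integral 4ℚ
Integral-4 = + 4 , sym ι-4

Integral-−1 : Integral (- 1ℚ)
Integral-−1 = ℤ.- 1ℤ , sym ι-neg1

4^ : ℕ → ℚ
4^ k = ι (+ (4 ℕ.^ k))

4^-+ : ∀ j k → 4^ (j ℕ.+ k) ≡ 4^ j * 4^ k
4^-+ j k = begin
  ι (+ (4 ℕ.^ (j ℕ.+ k)))               ≡⟨ cong (ι ∘ +_) (ℕ.^-distribˡ-+-* 4 j k) ⟩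
  ι (+ (4 ℕ.^ j ℕ.* 4 ℕ.^ k))           ≡⟨ cong ι (ℤ.pos-* (4 ℕ.^ j) (4 ℕ.^ k)) ⟩
  ι (+ (4 ℕ.^ j) ℤ.* + (4 ℕ.^ k))       ≡⟨ ι-* _ _ ⟩
  4^ j * 4^ k                           ∎
  where open ≡-Reasoning

4^-suc : ∀ k → 4^ (suc k) ≡ 4ℚ * 4^ k
4^-suc k = trans (4^-+ 1 k) (cong (_* 4^ k) ι-4)

------------------------------------------------------------------------
-- Denominators along the walk

module Integrality {V A : Set} (W : Walk V A) where
  open WalkProperties W
  open Fixed W

  -- The state after k steps from φ ∘ tail.
  E : ℕ → (V → ℚ) → A → ℚ
  E k φ = (U ^ k) (φ ∘ tail)

  chebyshev-^ : ∀ k φ α → E (suc k) (𝒜 φ) α ≡ 4ℚ * ((E (2 ℕ.+ k) φ α + 2ℚ * E (suc k) φ α) + E k φ α)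
  chebyshev-^ k φ α = begin
    (U ^ suc k) (𝒜 φ ∘ tail) α
      ≡⟨ U^-step k (𝒜 φ ∘ tail) α ⟨
    (U ^ k) (U (𝒜 φ ∘ tail)) α
      ≡⟨ U^-cong k (λ β → trans (chebyshev φ β) (expand (U² β) (U (φ ∘ tail) β) (φ (tail β)))) α ⟩
    (U ^ k) (λ β → 4ℚ * (1ℚ * U² β + 2ℚ * U (φ ∘ tail) β) + 4ℚ * φ (tail β)) α
      ≡⟨ U^-lin k 4ℚ (λ β → 1ℚ * U² β + 2ℚ * U (φ ∘ tail) β) 4ℚ (φ ∘ tail) α ⟩
    4ℚ * (U ^ k) (λ β → 1ℚ * U² β + 2ℚ * U (φ ∘ tail) β) α + 4ℚ * E k φ α
      ≡⟨ cong (λ z → 4ℚ * z + 4ℚ * E k φ α) (U^-lin k 1ℚ U² 2ℚ (U (φ ∘ tail)) α) ⟩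
    4ℚ * (1ℚ * (U ^ k) U² α + 2ℚ * (U ^ k) (U (φ ∘ tail)) α) + 4ℚ * E k φ α
      ≡⟨ expand ((U ^ k) U² α) ((U ^ k) (U (φ ∘ tail)) α) (E k φ α) ⟨
    4ℚ * (((U ^ k) U² α + 2ℚ * (U ^ k) (U (φ ∘ tail)) α) + E k φ α)
      ≡⟨ cong₂ (λ y z → 4ℚ * ((y + 2ℚ * z) + E k φ α))
           (trans (U^-step k (U (φ ∘ tail)) α) (U-cong (U^-step k (φ ∘ tail)) α)) (U^-step k (φ ∘ tail) α) ⟩
    4ℚ * ((E (2 ℕ.+ k) φ α + 2ℚ * E (suc k) φ α) + E k φ α)
      ∎
    where
    open ≡-Reasoning
    U² : A → ℚ
    U² = U (U (φ ∘ tail))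
    expand : ∀ x y z → 4ℚ * ((x + 2ℚ * y) + z) ≡ 4ℚ * (1ℚ * x + 2ℚ * y) + 4ℚ * z
    expand = solve 3 (λ x y z → con 4ℚ :* ((x :+ con 2ℚ :* y) :+ z) :=
      con 4ℚ :* (con 1ℚ :* x :+ con 2ℚ :* y) :+ con 4ℚ :* z) refl

  IntegerValued : (V → ℚ) → Set
  IntegerValued φ = ∀ x → Integral (φ x)

  𝒜-integer : ∀ φ → IntegerValued φ → IntegerValued (𝒜 φ)
  𝒜-integer φ int = X-integer a a⁻ (X-integer b b⁻ int)
    where
    X-integer : ∀ (s s⁻ : V → V) {χ} → IntegerValued χ → IntegerValued (X s s⁻ χ)
    X-integer s s⁻ int x = Integral-+ (Integral-+ (int x) (int x)) (Integral-+ (int (s x)) (int (s⁻ x)))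

  -- Induction on k by the recurrence: E (k+2) φ = ¼ E (k+1) (𝒜 φ) − 2 E (k+1) φ − E k φ.
  denominators : ∀ k φ → IntegerValued φ → ∀ α → Integral (4^ k * E k φ α)
  denominators zero φ int α = Integral-* (1ℤ , refl) (int (tail α))
  denominators (suc zero) φ int α = subst Integral (sym eq)
    (Integral-+ (Integral-* Integral-2 P-integer) (Integral-* Integral-4 (Integral-* Integral-−1 (int (tail α)))))
    where
    f : V
    f = face α
    P-integer : Integral (P φ f)
    P-integer = Integral-+ (Integral-+ (int f) (int (a f))) (Integral-+ (int (b f)) (int (a (b f))))
    eq : 4^ 1 * E 1 φ α ≡ 2ℚ * P φ f + 4ℚ * ((- 1ℚ) * φ (tail α))
    eq = trans (cong₂ _*_ ι-4 (U-tail φ α))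
      (solve 2 (λ p q → con 4ℚ :* (con ½ :* p :- q) := con 2ℚ :* p :+ con 4ℚ :* (con (- 1ℚ) :* q))
        refl (P φ f) (φ (tail α)))
  denominators (suc (suc k)) φ int α = subst Integral (sym eq)
    (Integral-+
      (Integral-+ (denominators (suc k) (𝒜 φ) (𝒜-integer φ int) α)
        (Integral-* (Integral-* Integral-−1 (Integral-* Integral-2 Integral-4)) (denominators (suc k) φ int α)))
      (Integral-* (Integral-* Integral-−1 (Integral-* Integral-4 Integral-4)) (denominators k φ int α)))
    where
    eq : 4^ (suc (suc k)) * E (suc (suc k)) φ α ≡
      (4^ (suc k) * E (suc k) (𝒜 φ) α + ((- 1ℚ) * (2ℚ * 4ℚ)) * (4^ (suc k) * E (suc k) φ α))
        + ((- 1ℚ) * (4ℚ * 4ℚ)) * (4^ k * E k φ α)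
    eq = begin
      4^ (suc (suc k)) * x
        ≡⟨ cong (_* x) (trans (4^-suc (suc k)) (cong (4ℚ *_) (4^-suc k))) ⟩
      (4ℚ * (4ℚ * 4^ k)) * x
        ≡⟨ solve 4 (λ p x y z → (con 4ℚ :* (con 4ℚ :* p)) :* x :=
             ((con 4ℚ :* p) :* (con 4ℚ :* ((x :+ con 2ℚ :* y) :+ z))
               :+ (con (- 1ℚ) :* (con 2ℚ :* con 4ℚ)) :* ((con 4ℚ :* p) :* y))
               :+ (con (- 1ℚ) :* (con 4ℚ :* con 4ℚ)) :* (p :* z)) refl (4^ k) x y z ⟩
      ((4ℚ * 4^ k) * (4ℚ * ((x + 2ℚ * y) + z)) + ((- 1ℚ) * (2ℚ * 4ℚ)) * ((4ℚ * 4^ k) * y))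
        + ((- 1ℚ) * (4ℚ * 4ℚ)) * (4^ k * z)
        ≡⟨ cong₂ (λ p w → (p * w + ((- 1ℚ) * (2ℚ * 4ℚ)) * (p * y)) + ((- 1ℚ) * (4ℚ * 4ℚ)) * (4^ k * z))
             (4^-suc k) (chebyshev-^ k φ α) ⟨
      (4^ (suc k) * E (suc k) (𝒜 φ) α + ((- 1ℚ) * (2ℚ * 4ℚ)) * (4^ (suc k) * y))
        + ((- 1ℚ) * (4ℚ * 4ℚ)) * (4^ k * z)
        ∎
      where
      open ≡-Reasoning
      x y z : ℚ
      x = E (suc (suc k)) φ α
      y = E (suc k) φ α
      z = E k φ α

  module _ (T : ℕ) (0<T : 0 ℕ.< T) (fix : ∀ φ → Fix T φ) where

    -- The exponent k can be reduced modulo the period T.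
    bounded-denominators : ∀ k φ → IntegerValued φ → ∀ α → Integral (4^ T * E k φ α)
    bounded-denominators k φ int α = subst Integral (sym eq)
      (Integral-* (_ , refl) (denominators r φ int α))
      where
      instance
        T≢0 : NonZero T
        T≢0 = ℕ.>-nonZero 0<T
      r q d : ℕ
      r = k ℕ.% T
      q = k ℕ./ T
      d = T ℕ.∸ r
      d+r≡T : d ℕ.+ r ≡ T
      d+r≡T = ℕ.m∸n+n≡m (ℕ.<⇒≤ (ℕ.m%n<n k T))
      E-mod : E k φ α ≡ E r φ α
      E-mod = begin
        (U ^ k) (φ ∘ tail) α                      ≡⟨ cong (λ j → (U ^ j) (φ ∘ tail) α) (ℕ.m≡m%n+[m/n]*n k T) ⟩
        (U ^ (r ℕ.+ q ℕ.* T)) (φ ∘ tail) α        ≡⟨ cong-app (fold-+ (φ ∘ tail) U r) α ⟩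
        (U ^ r) ((U ^ (q ℕ.* T)) (φ ∘ tail)) α    ≡⟨ U^-cong r (Fix-* q T φ (fix φ) .return) α ⟩
        (U ^ r) (φ ∘ tail) α                      ∎
        where open ≡-Reasoning
      eq : 4^ T * E k φ α ≡ 4^ d * (4^ r * E r φ α)
      eq = begin
        4^ T * E k φ α              ≡⟨ cong₂ (λ j z → 4^ j * z) (sym d+r≡T) E-mod ⟩
        4^ (d ℕ.+ r) * E r φ α      ≡⟨ cong (_* E r φ α) (4^-+ d r) ⟩
        (4^ d * 4^ r) * E r φ α     ≡⟨ ℚ.*-assoc (4^ d) (4^ r) (E r φ α) ⟩
        4^ d * (4^ r * E r φ α)     ∎
        where open ≡-Reasoning

    -- By the recurrence each application of 𝒜 gains a factor 4, at the cost of looking one step back;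
    -- this is the reason for j ≤ k.
    𝒜^-divisible-E : ∀ j k → j ℕ.≤ k → ∀ φ → IntegerValued φ → ∀ α →
      ∃ λ z → 4^ T * E k ((𝒜 ^ j) φ) α ≡ 4^ j * ι z
    𝒜^-divisible-E zero k _ φ int α with bounded-denominators k φ int α
    ... | z , eq = z , trans eq (trans (sym (ℚ.*-identityˡ (ι z))) (cong (_* ι z) (sym ι-1)))
    𝒜^-divisible-E (suc j) (suc k) (ℕ.s≤s j≤k) φ int α
      with 𝒜^-divisible-E j (2 ℕ.+ k) (ℕ.m≤n⇒m≤o+n 2 j≤k) φ int α
         | 𝒜^-divisible-E j (suc k) (ℕ.m≤n⇒m≤1+n j≤k) φ int α
         | 𝒜^-divisible-E j k j≤k φ int α
    ... | x , eq-x | y , eq-y | z , eq-z = (x ℤ.+ + 2 ℤ.* y) ℤ.+ z , (begin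
      4^ T * E (suc k) (𝒜 χ) α
        ≡⟨ cong (4^ T *_) (chebyshev-^ k χ α) ⟩
      4^ T * (4ℚ * ((E (2 ℕ.+ k) χ α + 2ℚ * E (suc k) χ α) + E k χ α))
        ≡⟨ solve 4 (λ t x y z → t :* (con 4ℚ :* ((x :+ con 2ℚ :* y) :+ z)) :=
             con 4ℚ :* ((t :* x :+ con 2ℚ :* (t :* y)) :+ t :* z)) refl
             (4^ T) (E (2 ℕ.+ k) χ α) (E (suc k) χ α) (E k χ α) ⟩
      4ℚ * ((4^ T * E (2 ℕ.+ k) χ α + 2ℚ * (4^ T * E (suc k) χ α)) + 4^ T * E k χ α)
        ≡⟨ cong (4ℚ *_) (cong₂ _+_ (cong₂ (λ x y → x + 2ℚ * y) eq-x eq-y) eq-z) ⟩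
      4ℚ * ((4^ j * ι x + 2ℚ * (4^ j * ι y)) + 4^ j * ι z)
        ≡⟨ solve 4 (λ t x y z → con 4ℚ :* ((t :* x :+ con 2ℚ :* (t :* y)) :+ t :* z) :=
             (con 4ℚ :* t) :* ((x :+ con 2ℚ :* y) :+ z)) refl (4^ j) (ι x) (ι y) (ι z) ⟩
      (4ℚ * 4^ j) * ((ι x + 2ℚ * ι y) + ι z)
        ≡⟨ cong₂ _*_ (4^-suc j) ι-sum ⟨
      4^ (suc j) * ι ((x ℤ.+ + 2 ℤ.* y) ℤ.+ z)
        ∎)
      where
      open ≡-Reasoning
      χ : V → ℚ
      χ = (𝒜 ^ j) φ
      ι-sum : ι ((x ℤ.+ + 2 ℤ.* y) ℤ.+ z) ≡ (ι x + 2ℚ * ι y) + ι z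
      ι-sum = begin
        ι ((x ℤ.+ + 2 ℤ.* y) ℤ.+ z)      ≡⟨ ι-+ _ z ⟩
        ι (x ℤ.+ + 2 ℤ.* y) + ι z        ≡⟨ cong (_+ ι z) (ι-+ x _) ⟩
        (ι x + ι (+ 2 ℤ.* y)) + ι z      ≡⟨ cong (λ w → (ι x + w) + ι z) (trans (ι-* (+ 2) y) (cong (_* ι y) ι-2)) ⟩
        (ι x + 2ℚ * ι y) + ι z           ∎

    -- The multiple k = jT of the period turns E k back into the initial state.
    𝒜^-divisible : ∀ j φ → IntegerValued φ → ∀ α →
      ∃ λ z → 4^ T * (𝒜 ^ j) φ (tail α) ≡ 4^ j * ι z
    𝒜^-divisible j φ int α with 𝒜^-divisible-E j (j ℕ.* T) (ℕ.m≤m*n j T {{ℕ.>-nonZero 0<T}}) φ int α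
    ... | z , eq = z , trans (cong (4^ T *_) (sym (Fix-* j T ((𝒜 ^ j) φ) (fix ((𝒜 ^ j) φ)) .return α))) eq
2^ : ℕ → ℤ
2^ u = + (2 ℕ.^ u)

2^-suc : ∀ u → 2^ (suc u) ≡ + 2 ℤ.* 2^ u
2^-suc u = ℤ.pos-* 2 (2 ℕ.^ u)

2^-+ : ∀ u v → 2^ (u ℕ.+ v) ≡ 2^ u ℤ.* 2^ v
2^-+ u v = trans (cong +_ (ℕ.^-distribˡ-+-* 2 u v)) (ℤ.pos-* (2 ℕ.^ u) (2 ℕ.^ v))

------------------------------------------------------------------------
-- The operator 2 + s + s⁻¹ on a cycle

-- 2 + s + s⁻¹ on integer functions on the cycle of length n.
Xℤ : ∀ {n} .{{_ : NonZero n}} → (Fin n → ℤ) → Fin n → ℤ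
Xℤ g x = (g x ℤ.+ g x) ℤ.+ (g (cyclicSuc x) ℤ.+ g (cyclicPred x))

-- Some value of Xʲ g has 2-adic valuation exactly u, for some integer function g: it is 2ᵘ times
-- an odd number.
Value : (n : ℕ) .{{_ : NonZero n}} → ℕ → ℕ → Set
Value n j u = ∃ λ (g : Fin n → ℤ) → ∃ λ x → ∃ λ w → (Xℤ ^ j) g x ≡ 2^ u ℤ.* (1ℤ ℤ.+ + 2 ℤ.* w)

------------------------------------------------------------------------
-- Odd values, modulo 2

-- Congruence modulo 2.
infix 4 _≡₂_

record _≡₂_ (x y : ℤ) : Set where
  constructor _because_
  field
    quotient : ℤ
    equation : x ≡ y ℤ.+ + 2 ℤ.* quotient

open _≡₂_

≡₂-trans : ∀ {x y z} → x ≡₂ y → y ≡₂ z → x ≡₂ z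
≡₂-trans {z = z} (p because refl) (q because refl) = (q ℤ.+ p) because lemma z p q
  where
  lemma : ∀ z p q → z ℤ.+ + 2 ℤ.* q ℤ.+ + 2 ℤ.* p ≡ z ℤ.+ + 2 ℤ.* (q ℤ.+ p)
  lemma = solve-∀

≡₂-+ : ∀ {x y x′ y′} → x ≡₂ y → x′ ≡₂ y′ → x ℤ.+ x′ ≡₂ y ℤ.+ y′
≡₂-+ {y = y} {y′ = y′} (p because refl) (q because refl) = (p ℤ.+ q) because lemma y p y′ q
  where
  lemma : ∀ y p y′ q → y ℤ.+ + 2 ℤ.* p ℤ.+ (y′ ℤ.+ + 2 ℤ.* q) ≡ y ℤ.+ y′ ℤ.+ + 2 ℤ.* (p ℤ.+ q)
  lemma = solve-∀

module _ {n : ℕ} .{{_ : NonZero n}} where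

  -- Modulo 2, squaring is additive, so X ≡ s + s⁻¹ gives Xʲ ≡ sʲ + s⁻ʲ for j = 2ᵏ.  The inverse shift
  -- is translation by n − 1.
  frobenius : ∀ k (g : Fin n → ℤ) x →
    (Xℤ ^ (2 ℕ.^ k)) g x ≡₂ g (shift (2 ℕ.^ k) x) ℤ.+ g (shift (2 ℕ.^ k ℕ.* ℕ.pred n) x)
  frobenius zero    g x = g x because (begin
    (g x ℤ.+ g x) ℤ.+ (g (cyclicSuc x) ℤ.+ g (cyclicPred x))
      ≡⟨ cong₂ (λ y z → (g x ℤ.+ g x) ℤ.+ (g y ℤ.+ g z)) (cyclicSuc≗shift x)
           (cong (λ d → shift d x) (sym (ℕ.*-identityˡ (ℕ.pred n)))) ⟩
    (g x ℤ.+ g x) ℤ.+ (g (shift 1 x) ℤ.+ g (shift (1 ℕ.* ℕ.pred n) x))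
      ≡⟨ lemma (g x) (g (shift 1 x)) (g (shift (1 ℕ.* ℕ.pred n) x)) ⟩
    (g (shift 1 x) ℤ.+ g (shift (1 ℕ.* ℕ.pred n) x)) ℤ.+ + 2 ℤ.* g x
      ∎)
    where
    open ≡-Reasoning
    lemma : ∀ x y z → (x ℤ.+ x) ℤ.+ (y ℤ.+ z) ≡ (y ℤ.+ z) ℤ.+ + 2 ℤ.* x
    lemma = solve-∀
  frobenius (suc k) g x = subst (_≡₂ g (shift p′ x) ℤ.+ g (shift (p′ ℕ.* ℕ.pred n) x)) (sym split)
    (≡₂-trans (frobenius k g′ x)
      (≡₂-trans (≡₂-+ (frobenius k g (shift p x)) (frobenius k g (shift r x)))
        (g x because (begin
          (g (shift p (shift p x)) ℤ.+ g (shift r (shift p x)))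
            ℤ.+ (g (shift p (shift r x)) ℤ.+ g (shift r (shift r x)))
            ≡⟨ cong₂ ℤ._+_
                 (cong₂ (λ y z → g y ℤ.+ g z)
                   (trans (shift-+ p p x) (cong (λ d → shift d x) pp))
                   (trans (shift-+ r p x) (back x)))
                 (cong₂ (λ y z → g y ℤ.+ g z)
                   (trans (shift-+ p r x) (trans (cong (λ d → shift d x) (ℕ.+-comm r p)) (back x)))
                   (trans (shift-+ r r x) (cong (λ d → shift d x) rr))) ⟩
          (g (shift p′ x) ℤ.+ g x) ℤ.+ (g x ℤ.+ g (shift (p′ ℕ.* ℕ.pred n) x))
            ≡⟨ lemma (g (shift p′ x)) (g x) (g (shift (p′ ℕ.* ℕ.pred n) x)) ⟩
          (g (shift p′ x) ℤ.+ g (shift (p′ ℕ.* ℕ.pred n) x)) ℤ.+ + 2 ℤ.* g x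
            ∎))))
    where
    open ≡-Reasoning
    p p′ r : ℕ
    p  = 2 ℕ.^ k
    p′ = 2 ℕ.^ suc k
    r  = p ℕ.* ℕ.pred n
    g′ : Fin n → ℤ
    g′ = (Xℤ ^ p) g
    pp : p ℕ.+ p ≡ p′
    pp = cong (p ℕ.+_) (sym (ℕ.+-identityʳ p))
    rr : r ℕ.+ r ≡ p′ ℕ.* ℕ.pred n
    rr = trans (sym (ℕ.*-distribʳ-+ (ℕ.pred n) p p)) (cong (ℕ._* ℕ.pred n) pp)
    back : ∀ x → shift (p ℕ.+ r) x ≡ x
    back x = trans
      (cong (λ d → shift d x) (trans (sym (ℕ.*-suc p (ℕ.pred n))) (cong (p ℕ.*_) (ℕ.suc-pred n))))
      (shift-multiple p x)
    split : (Xℤ ^ p′) g x ≡ (Xℤ ^ p) g′ x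
    split = trans (cong (λ d → (Xℤ ^ d) g x) (sym pp)) (cong-app (fold-+ g Xℤ p) x)
    lemma : ∀ x y z → (x ℤ.+ y) ℤ.+ (y ℤ.+ z) ≡ (x ℤ.+ z) ℤ.+ + 2 ℤ.* y
    lemma = solve-∀

  -- For g the indicator function of the point c = sʲ x₀, where j = 2ᵏ: the points sʲ x₀ and s⁻ʲ x₀
  -- differ, because n does not divide 2j.
  odd-value : ∀ k → n ℕ.∤ 2 ℕ.^ suc k → Value n (2 ℕ.^ k) 0
  odd-value k n∤ = g , x₀ , z , trans (trans eq (cong (ℤ._+ + 2 ℤ.* z) g-values)) (sym (ℤ.*-identityˡ _))
    where
    open ≡-Reasoning
    p r : ℕ
    p = 2 ℕ.^ k
    r = p ℕ.* ℕ.pred n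
    x₀ c : Fin n
    x₀ = 0 mod n
    c  = shift p x₀
    g : Fin n → ℤ
    g y = if does (y Fin.≟ c) then 1ℤ else 0ℤ
    z : ℤ
    z = frobenius k g x₀ .quotient
    eq : (Xℤ ^ p) g x₀ ≡ (g c ℤ.+ g (shift r x₀)) ℤ.+ + 2 ℤ.* z
    eq = frobenius k g x₀ .equation
    distinct : shift r x₀ ≢ c
    distinct r≡p = n∤ (ℕ.m%n≡0⇒n∣m (2 ℕ.^ suc k) n (begin
      (2 ℕ.^ suc k) % n                             ≡⟨ cong (_% n) (cong (p ℕ.+_) (ℕ.+-identityʳ p)) ⟩
      (p ℕ.+ p) % n                                 ≡⟨ cong (λ y → (y ℕ.+ (p ℕ.+ p)) % n) (trans (toℕ-mod 0) (ℕ.m*n%n≡0 0 n)) ⟨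
      (toℕ x₀ ℕ.+ (p ℕ.+ p)) % n                    ≡⟨ toℕ-mod (toℕ x₀ ℕ.+ (p ℕ.+ p)) ⟨
      toℕ (shift (p ℕ.+ p) x₀)                      ≡⟨ cong toℕ (shift-+ p p x₀) ⟨
      toℕ (shift p c)                               ≡⟨ cong (toℕ ∘ shift p) r≡p ⟨
      toℕ (shift p (shift r x₀))                    ≡⟨ cong toℕ (shift-+ p r x₀) ⟩
      toℕ (shift (r ℕ.+ p) x₀)                      ≡⟨ cong (λ d → toℕ (shift d x₀)) r+p ⟩
      toℕ (shift (p ℕ.* n) x₀)                      ≡⟨ cong toℕ (shift-multiple p x₀) ⟩
      toℕ x₀                                        ≡⟨ trans (toℕ-mod 0) (ℕ.m*n%n≡0 0 n) ⟩
      0                                             ∎))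
      where
      r+p : r ℕ.+ p ≡ p ℕ.* n
      r+p = trans (ℕ.+-comm r p) (trans (sym (ℕ.*-suc p (ℕ.pred n))) (cong (p ℕ.*_) (ℕ.suc-pred n)))
    g-values : g c ℤ.+ g (shift r x₀) ≡ 1ℤ
    g-values with c Fin.≟ c | shift r x₀ Fin.≟ c
    ... | yes _   | no _  = refl
    ... | yes _   | yes e = contradiction e distinct
    ... | no  c≢c | _     = contradiction refl c≢c

------------------------------------------------------------------------
-- Values on functions of period 4 and 8

-- The operator X on functions on ℕ of period d + 1, for which i + d serves as the predecessor of i.
Xᵖ : ℕ → (ℕ → ℤ) → ℕ → ℤ
Xᵖ d G i = (G i ℤ.+ G i) ℤ.+ (G (suc i) ℤ.+ G (d ℕ.+ i))

-- Period d + 1.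
HasPeriod : ℕ → (ℕ → ℤ) → Set
HasPeriod d G = ∀ i → G (suc d ℕ.+ i) ≡ G i

HasPeriod-* : ∀ d {G} → HasPeriod d G → ∀ q i → G (q ℕ.* suc d ℕ.+ i) ≡ G i
HasPeriod-* d per zero    i = refl
HasPeriod-* d {G} per (suc q) i = begin
  G (suc d ℕ.+ q ℕ.* suc d ℕ.+ i)       ≡⟨ cong G (ℕ.+-assoc (suc d) (q ℕ.* suc d) i) ⟩
  G (suc d ℕ.+ (q ℕ.* suc d ℕ.+ i))     ≡⟨ per (q ℕ.* suc d ℕ.+ i) ⟩
  G (q ℕ.* suc d ℕ.+ i)                 ≡⟨ HasPeriod-* d per q i ⟩
  G i                                   ∎
  where open ≡-Reasoning

Xℤ-cong : ∀ {n} .{{_ : NonZero n}} {g h : Fin n → ℤ} → g ≗ h → Xℤ g ≗ Xℤ h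
Xℤ-cong e x = cong₂ ℤ._+_ (cong₂ ℤ._+_ (e x) (e x)) (cong₂ ℤ._+_ (e (cyclicSuc x)) (e (cyclicPred x)))

Xℤ-periodic : ∀ {n} .{{_ : NonZero n}} d → suc d ℕ.∣ n → ∀ G → HasPeriod d G →
  Xℤ {n} (G ∘ toℕ) ≗ Xᵖ d G ∘ toℕ
Xℤ-periodic {n} d (divides q n≡) G per x = cong₂ (λ y z → (G i ℤ.+ G i) ℤ.+ (y ℤ.+ z))
  (trans (cong G (toℕ-mod (suc i))) (G-% (suc i)))
  (trans (cong G (toℕ-mod (i ℕ.+ ℕ.pred n))) (trans (G-% (i ℕ.+ ℕ.pred n)) (pred-value q n≡)))
  where
  open ≡-Reasoning
  i : ℕ
  i = toℕ x
  G-% : ∀ j → G (j % n) ≡ G j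
  G-% j = begin
    G (j % n)                                 ≡⟨ HasPeriod-* d per (j / n ℕ.* q) (j % n) ⟨
    G (j / n ℕ.* q ℕ.* suc d ℕ.+ j % n)       ≡⟨ cong (λ e → G (e ℕ.+ j % n)) (trans (ℕ.*-assoc (j / n) q (suc d)) (cong (j / n ℕ.*_) (sym n≡))) ⟩
    G (j / n ℕ.* n ℕ.+ j % n)                 ≡⟨ cong G (ℕ.+-comm (j / n ℕ.* n) (j % n)) ⟩
    G (j % n ℕ.+ j / n ℕ.* n)                 ≡⟨ cong G (ℕ.m≡m%n+[m/n]*n j n) ⟨
    G j                                       ∎
  pred-value : ∀ q → n ≡ q ℕ.* suc d → G (i ℕ.+ ℕ.pred n) ≡ G (d ℕ.+ i)
  pred-value zero    n≡0 = contradiction n≡0 (ℕ.≢-nonZero⁻¹ n)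
  pred-value (suc q) n≡  = begin
    G (i ℕ.+ ℕ.pred n)                        ≡⟨ cong (λ e → G (i ℕ.+ ℕ.pred e)) n≡ ⟩
    G (i ℕ.+ (d ℕ.+ q ℕ.* suc d))             ≡⟨ cong G (ℕ.+-assoc i d (q ℕ.* suc d)) ⟨
    G (i ℕ.+ d ℕ.+ q ℕ.* suc d)               ≡⟨ cong G (ℕ.+-comm (i ℕ.+ d) (q ℕ.* suc d)) ⟩
    G (q ℕ.* suc d ℕ.+ (i ℕ.+ d))             ≡⟨ HasPeriod-* d per q (i ℕ.+ d) ⟩
    G (i ℕ.+ d)                               ≡⟨ cong G (ℕ.+-comm i d) ⟩
    G (d ℕ.+ i)                               ∎

-- A family G of functions of period d + 1 that is stable under X: X maps G p to G (f p).
module Family {P : Set} (d : ℕ) (G : P → ℕ → ℤ) (f : P → P)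
  (periodic : ∀ p → HasPeriod d (G p)) (step : ∀ p → Xᵖ d (G p) ≗ G (f p))
  {n : ℕ} .{{_ : NonZero n}} (d∣n : suc d ℕ.∣ n) where

  Xℤ^-family : ∀ j p → (Xℤ {n} ^ j) (G p ∘ toℕ) ≗ G ((f ^ j) p) ∘ toℕ
  Xℤ^-family zero    p x = refl
  Xℤ^-family (suc j) p x = begin
    Xℤ ((Xℤ ^ j) (G p ∘ toℕ)) x         ≡⟨ Xℤ-cong (Xℤ^-family j p) x ⟩
    Xℤ (G ((f ^ j) p) ∘ toℕ) x          ≡⟨ Xℤ-periodic d d∣n (G ((f ^ j) p)) (periodic _) x ⟩
    Xᵖ d (G ((f ^ j) p)) (toℕ x)        ≡⟨ step ((f ^ j) p) (toℕ x) ⟩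
    G (f ((f ^ j) p)) (toℕ x)           ∎
    where open ≡-Reasoning

  Xℤ^-zero : ∀ j p → (Xℤ {n} ^ j) (G p ∘ toℕ) (0 mod n) ≡ G ((f ^ j) p) 0
  Xℤ^-zero j p = trans (Xℤ^-family j p (0 mod n))
    (cong (G ((f ^ j) p)) (trans (toℕ-mod 0) (ℕ.m*n%n≡0 0 n)))

-- The function c, 0, −c, 0 of period 4, which X doubles.
quarter : ℤ → ℕ → ℤ
quarter c 0 = c
quarter c 1 = 0ℤ
quarter c 2 = ℤ.- c
quarter c 3 = 0ℤ
quarter c (suc (suc (suc (suc i)))) = quarter c i

quarter-step : ∀ c → Xᵖ 3 (quarter c) ≗ quarter (+ 2 ℤ.* c)
quarter-step c 0 = lemma c
  where
  lemma : ∀ c → (c ℤ.+ c) ℤ.+ (0ℤ ℤ.+ 0ℤ) ≡ + 2 ℤ.* c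
  lemma = solve-∀
quarter-step c 1 = lemma c
  where
  lemma : ∀ c → (0ℤ ℤ.+ 0ℤ) ℤ.+ (ℤ.- c ℤ.+ c) ≡ 0ℤ
  lemma = solve-∀
quarter-step c 2 = lemma c
  where
  lemma : ∀ c → (ℤ.- c ℤ.+ ℤ.- c) ℤ.+ (0ℤ ℤ.+ 0ℤ) ≡ ℤ.- (+ 2 ℤ.* c)
  lemma = solve-∀
quarter-step c 3 = lemma c
  where
  lemma : ∀ c → (0ℤ ℤ.+ 0ℤ) ℤ.+ (c ℤ.+ ℤ.- c) ≡ 0ℤ
  lemma = solve-∀
quarter-step c (suc (suc (suc (suc i)))) = quarter-step c i

value-4 : ∀ j → Value 4 j j
value-4 j = quarter 1ℤ ∘ toℕ , 0 mod 4 , 0ℤ , trans (F.Xℤ^-zero j 1ℤ) (go j)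
  where
  module F = Family 3 quarter (+ 2 ℤ.*_) (λ _ _ → refl) quarter-step {4} (ℕ.∣-refl {4})
  go : ∀ j → ((+ 2 ℤ.*_) ^ j) 1ℤ ≡ 2^ j ℤ.* (1ℤ ℤ.+ + 2 ℤ.* 0ℤ)
  go zero    = refl
  go (suc j) = trans (cong (+ 2 ℤ.*_) (go j))
    (trans (sym (ℤ.*-assoc (+ 2) (2^ j) _)) (cong (ℤ._* (1ℤ ℤ.+ + 2 ℤ.* 0ℤ)) (sym (2^-suc j))))

-- The functions of period 8 that change sign after 4 steps and are symmetric about 0.  On them
-- s + s⁻¹ is multiplication by √2, if the pair (a , b) is read as a + b √2.
eighth : ℤ × ℤ → ℕ → ℤ
eighth (a , b) 0 = a
eighth (a , b) 1 = b
eighth (a , b) 2 = 0ℤ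
eighth (a , b) 3 = ℤ.- b
eighth (a , b) 4 = ℤ.- a
eighth (a , b) 5 = ℤ.- b
eighth (a , b) 6 = 0ℤ
eighth (a , b) 7 = b
eighth p (suc (suc (suc (suc (suc (suc (suc (suc i)))))))) = eighth p i

times-2+√2 : ℤ × ℤ → ℤ × ℤ
times-2+√2 (a , b) = + 2 ℤ.* a ℤ.+ + 2 ℤ.* b , a ℤ.+ + 2 ℤ.* b

eighth-step : ∀ p → Xᵖ 7 (eighth p) ≗ eighth (times-2+√2 p)
eighth-step (a , b) 0 = lemma a b
  where
  lemma : ∀ a b → (a ℤ.+ a) ℤ.+ (b ℤ.+ b) ≡ + 2 ℤ.* a ℤ.+ + 2 ℤ.* b
  lemma = solve-∀
eighth-step (a , b) 1 = lemma a b
  where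
  lemma : ∀ a b → (b ℤ.+ b) ℤ.+ (0ℤ ℤ.+ a) ≡ a ℤ.+ + 2 ℤ.* b
  lemma = solve-∀
eighth-step (a , b) 2 = lemma a b
  where
  lemma : ∀ a b → (0ℤ ℤ.+ 0ℤ) ℤ.+ (ℤ.- b ℤ.+ b) ≡ 0ℤ
  lemma = solve-∀
eighth-step (a , b) 3 = lemma a b
  where
  lemma : ∀ a b → (ℤ.- b ℤ.+ ℤ.- b) ℤ.+ (ℤ.- a ℤ.+ 0ℤ) ≡ ℤ.- (a ℤ.+ + 2 ℤ.* b)
  lemma = solve-∀
eighth-step (a , b) 4 = lemma a b
  where
  lemma : ∀ a b → (ℤ.- a ℤ.+ ℤ.- a) ℤ.+ (ℤ.- b ℤ.+ ℤ.- b) ≡ ℤ.- (+ 2 ℤ.* a ℤ.+ + 2 ℤ.* b)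
  lemma = solve-∀
eighth-step (a , b) 5 = lemma a b
  where
  lemma : ∀ a b → (ℤ.- b ℤ.+ ℤ.- b) ℤ.+ (0ℤ ℤ.+ ℤ.- a) ≡ ℤ.- (a ℤ.+ + 2 ℤ.* b)
  lemma = solve-∀
eighth-step (a , b) 6 = lemma a b
  where
  lemma : ∀ a b → (0ℤ ℤ.+ 0ℤ) ℤ.+ (b ℤ.+ ℤ.- b) ≡ 0ℤ
  lemma = solve-∀
eighth-step (a , b) 7 = lemma a b
  where
  lemma : ∀ a b → (b ℤ.+ b) ℤ.+ (a ℤ.+ 0ℤ) ≡ a ℤ.+ + 2 ℤ.* b
  lemma = solve-∀
eighth-step p (suc (suc (suc (suc (suc (suc (suc (suc i)))))))) = eighth-step p i

-- (2 + √2)² = 2 (3 + 2 √2), and multiplication by 3 + 2 √2 keeps the first coordinate odd.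
value-8 : ∀ {n} .{{_ : NonZero n}} → 8 ℕ.∣ n → ∀ q → Value n (q ℕ.* 2) q
value-8 {n} 8∣n q = eighth (1ℤ , 0ℤ) ∘ toℕ , 0 mod n , proj₁ (go q) ,
  trans (F.Xℤ^-zero (q ℕ.* 2) (1ℤ , 0ℤ)) (cong proj₁ (proj₂ (proj₂ (go q))))
  where
  module F = Family 7 eighth times-2+√2 (λ _ _ → refl) eighth-step {n} 8∣n
  go : ∀ q → ∃ λ w → ∃ λ b → (times-2+√2 ^ (q ℕ.* 2)) (1ℤ , 0ℤ) ≡ (2^ q ℤ.* (1ℤ ℤ.+ + 2 ℤ.* w) , 2^ q ℤ.* b)
  go zero    = 0ℤ , 0ℤ , refl
  go (suc q) with go q
  ... | w , b , eq = 1ℤ ℤ.+ + 3 ℤ.* w ℤ.+ + 2 ℤ.* b , + 2 ℤ.* (1ℤ ℤ.+ + 2 ℤ.* w) ℤ.+ + 3 ℤ.* b ,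
    trans (cong (times-2+√2 ∘ times-2+√2) eq)
      (cong₂ _,_ (trans (lemma₁ (2^ q) w b) (cong (ℤ._* _) (sym (2^-suc q))))
                 (trans (lemma₂ (2^ q) w b) (cong (ℤ._* _) (sym (2^-suc q)))))
    where
    lemma₁ : ∀ t w b →
      + 2 ℤ.* (+ 2 ℤ.* (t ℤ.* (1ℤ ℤ.+ + 2 ℤ.* w)) ℤ.+ + 2 ℤ.* (t ℤ.* b))
        ℤ.+ + 2 ℤ.* (t ℤ.* (1ℤ ℤ.+ + 2 ℤ.* w) ℤ.+ + 2 ℤ.* (t ℤ.* b))
      ≡ (+ 2 ℤ.* t) ℤ.* (1ℤ ℤ.+ + 2 ℤ.* (1ℤ ℤ.+ + 3 ℤ.* w ℤ.+ + 2 ℤ.* b))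
    lemma₁ = solve-∀
    lemma₂ : ∀ t w b →
      (+ 2 ℤ.* (t ℤ.* (1ℤ ℤ.+ + 2 ℤ.* w)) ℤ.+ + 2 ℤ.* (t ℤ.* b))
        ℤ.+ + 2 ℤ.* (t ℤ.* (1ℤ ℤ.+ + 2 ℤ.* w) ℤ.+ + 2 ℤ.* (t ℤ.* b))
      ≡ (+ 2 ℤ.* t) ℤ.* (+ 2 ℤ.* (1ℤ ℤ.+ + 2 ℤ.* w) ℤ.+ + 3 ℤ.* b)
    lemma₂ = solve-∀

------------------------------------------------------------------------
-- Divisors of powers of two

-- An odd n = 1 + 2w that divides 2p divides p = n p − w (2 p).
∣2^⇒≡2^ : ∀ k n → n ℕ.∣ 2 ℕ.^ k → ∃ λ e → n ≡ 2 ℕ.^ e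
∣2^⇒≡2^ zero    n n∣ = 0 , ℕ.∣1⇒≡1 n∣
∣2^⇒≡2^ (suc k) n n∣ with n % 2 in r≡ | ℕ.m≡m%n+[m/n]*n n 2 | ℕ.m%n<n n 2
... | zero  | n≡ | _ = suc (proj₁ half) , trans n≡2h (cong (2 ℕ.*_) (proj₂ half))
  where
  n≡2h : n ≡ 2 ℕ.* (n / 2)
  n≡2h = trans n≡ (ℕ.*-comm (n / 2) 2)
  half : ∃ λ e → n / 2 ≡ 2 ℕ.^ e
  half = ∣2^⇒≡2^ k (n / 2) (ℕ.*-cancelˡ-∣ 2 (subst (ℕ._∣ 2 ℕ.^ suc k) n≡2h n∣))
... | suc zero | n≡ | _ = ∣2^⇒≡2^ k n (ℕ.∣m+n∣m⇒∣n sum∣ n∣w*2p)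
  where
  p w : ℕ
  p = 2 ℕ.^ k
  w = n / 2
  n∣w*2p : n ℕ.∣ w ℕ.* (2 ℕ.* p)
  n∣w*2p = ℕ.∣n⇒∣m*n w n∣
  sum∣ : n ℕ.∣ w ℕ.* (2 ℕ.* p) ℕ.+ p
  sum∣ = divides p (begin
    w ℕ.* (2 ℕ.* p) ℕ.+ p     ≡⟨ ℕ.+-comm _ p ⟩
    p ℕ.+ w ℕ.* (2 ℕ.* p)     ≡⟨ cong (p ℕ.+_) (ℕ.*-assoc w 2 p) ⟨
    p ℕ.+ w ℕ.* 2 ℕ.* p       ≡⟨ cong (ℕ._* p) n≡ ⟨
    n ℕ.* p                   ≡⟨ ℕ.*-comm n p ⟩
    p ℕ.* n                   ∎)
    where open ≡-Reasoning
... | suc (suc _) | _ | ℕ.s≤s (ℕ.s≤s ())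

2^-cases : ∀ k n → 3 ℕ.≤ n → n ℕ.∣ 2 ℕ.^ k → n ≡ 4 ⊎ 8 ℕ.∣ n
2^-cases k n 3≤n n∣ with ∣2^⇒≡2^ k n n∣
... | 0 , refl = contradiction 3≤n λ { (ℕ.s≤s ()) }
... | 1 , refl = contradiction 3≤n λ { (ℕ.s≤s (ℕ.s≤s ())) }
... | 2 , refl = inj₁ refl
... | suc (suc (suc e)) , refl = inj₂ (divides (2 ℕ.^ e) (trans (ℕ.^-distribˡ-+-* 2 3 e) (ℕ.*-comm 8 (2 ℕ.^ e))))

-- The exponent is j = 2ᵏ⁺¹, so that j/2 = 2ᵏ is an integer.
small-value : ∀ n .{{_ : NonZero n}} → 3 ℕ.≤ n → n ≢ 4 → ∀ k →
  ∃ λ u → 2 ℕ.* u ℕ.≤ 2 ℕ.^ suc k × Value n (2 ℕ.^ suc k) u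
small-value n 3≤n n≢4 k with n ℕ.∣? 2 ℕ.^ suc (suc k)
... | no n∤ = 0 , ℕ.z≤n , odd-value (suc k) n∤
... | yes n∣ with 2^-cases (suc (suc k)) n 3≤n n∣
...   | inj₁ n≡4 = contradiction n≡4 n≢4
...   | inj₂ 8∣n = 2 ℕ.^ k , ℕ.≤-refl ,
  subst (λ j → Value n j (2 ℕ.^ k)) (ℕ.*-comm (2 ℕ.^ k) 2) (value-8 8∣n (2 ℕ.^ k))

value : ∀ n .{{_ : NonZero n}} → 3 ℕ.≤ n → ∀ k → ∃ λ u → u ℕ.≤ 2 ℕ.^ suc k × Value n (2 ℕ.^ suc k) u
value n 3≤n k with n ℕ.≟ 4
... | yes refl = 2 ℕ.^ suc k , ℕ.≤-refl , value-4 (2 ℕ.^ suc k)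
... | no n≢4 with small-value n 3≤n n≢4 k
...   | u , 2u≤j , v = u , ℕ.≤-trans (ℕ.m≤n*m u 2) 2u≤j , v

-- A number 2ᵃ times an odd number is divisible by 2ᵇ only if b ≤ a.
valuation : ∀ a b o z → 2^ a ℤ.* (1ℤ ℤ.+ + 2 ℤ.* o) ≡ 2^ b ℤ.* z → b ℕ.≤ a
valuation a       zero    o z eq = ℕ.z≤n
valuation zero    (suc b) o z eq = contradiction
  (trans eq (trans (cong (ℤ._* z) (2^-suc b)) (ℤ.*-assoc (+ 2) (2^ b) z))) (odd≢even _)
  where
  odd≢even : ∀ y → 1ℤ ℤ.* (1ℤ ℤ.+ + 2 ℤ.* o) ≢ + 2 ℤ.* y
  odd≢even y e = ℕ.even≢odd ℤ.∣ y ℤ.- o ∣ 0 (trans (sym (ℤ.abs-* (+ 2) (y ℤ.- o))) (cong ℤ.∣_∣ (begin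
    + 2 ℤ.* (y ℤ.- o)                                ≡⟨ lemma₁ y o ⟩
    + 2 ℤ.* y ℤ.- + 2 ℤ.* o                          ≡⟨ cong (ℤ._- + 2 ℤ.* o) e ⟨
    1ℤ ℤ.* (1ℤ ℤ.+ + 2 ℤ.* o) ℤ.- + 2 ℤ.* o          ≡⟨ lemma₂ o ⟩
    1ℤ                                               ∎)))
    where
    open ≡-Reasoning
    lemma₁ : ∀ y o → + 2 ℤ.* (y ℤ.- o) ≡ + 2 ℤ.* y ℤ.- + 2 ℤ.* o
    lemma₁ = solve-∀
    lemma₂ : ∀ o → 1ℤ ℤ.* (1ℤ ℤ.+ + 2 ℤ.* o) ℤ.- + 2 ℤ.* o ≡ 1ℤ
    lemma₂ = solve-∀
valuation (suc a) (suc b) o z eq = ℕ.s≤s (valuation a b o z (ℤ.*-cancelˡ-≡ (+ 2) _ _ (begin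
  + 2 ℤ.* (2^ a ℤ.* (1ℤ ℤ.+ + 2 ℤ.* o))     ≡⟨ ℤ.*-assoc (+ 2) (2^ a) _ ⟨
  + 2 ℤ.* 2^ a ℤ.* (1ℤ ℤ.+ + 2 ℤ.* o)       ≡⟨ cong (ℤ._* _) (2^-suc a) ⟨
  2^ (suc a) ℤ.* (1ℤ ℤ.+ + 2 ℤ.* o)         ≡⟨ eq ⟩
  2^ (suc b) ℤ.* z                          ≡⟨ cong (ℤ._* z) (2^-suc b) ⟩
  + 2 ℤ.* 2^ b ℤ.* z                        ≡⟨ ℤ.*-assoc (+ 2) (2^ b) z ⟩
  + 2 ℤ.* (2^ b ℤ.* z)                      ∎)))
  where open ≡-Reasoning

------------------------------------------------------------------------
-- Long cycles exclude periodicity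

module Torus (n m : ℕ) .{{_ : NonZero n}} .{{_ : NonZero m}} where
  open Grid n m using (Vertex)
  open GridWalk n m
  open WalkProperties walk using (X; 𝒜; swap)
  open Fixed walk
  open Integrality walk

  -- The function g ⊗ h on the vertices.
  tensor : (Fin n → ℤ) → (Fin m → ℤ) → Vertex → ℚ
  tensor g h (x , y) = ι (g x ℤ.* h y)

  𝒜-tensor : ∀ g h v → 𝒜 (tensor g h) v ≡ tensor (Xℤ g) (Xℤ h) v
  𝒜-tensor g h (x , y) = begin
    𝒜 (tensor g h) (x , y)
      ≡⟨ cong₂ _+_ (cong₂ _+_ (row x) (row x)) (cong₂ _+_ (row x⁺) (row x⁻)) ⟩
    (ι (g x ℤ.* Xh) + ι (g x ℤ.* Xh)) + (ι (g x⁺ ℤ.* Xh) + ι (g x⁻ ℤ.* Xh))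
      ≡⟨ ι-four (g x ℤ.* Xh) (g x⁺ ℤ.* Xh) (g x⁻ ℤ.* Xh) ⟨
    ι ((g x ℤ.* Xh ℤ.+ g x ℤ.* Xh) ℤ.+ (g x⁺ ℤ.* Xh ℤ.+ g x⁻ ℤ.* Xh))
      ≡⟨ cong ι (lemma (g x) (g x⁺) (g x⁻) Xh) ⟩
    tensor (Xℤ g) (Xℤ h) (x , y)
      ∎
    where
    open ≡-Reasoning
    x⁺ x⁻ : Fin n
    x⁺ = cyclicSuc x
    x⁻ = cyclicPred x
    Xh : ℤ
    Xh = Xℤ h y
    ι-four : ∀ a b c → ι ((a ℤ.+ a) ℤ.+ (b ℤ.+ c)) ≡ (ι a + ι a) + (ι b + ι c)
    ι-four a b c = trans (ι-+ (a ℤ.+ a) (b ℤ.+ c)) (cong₂ _+_ (ι-+ a a) (ι-+ b c))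
    lemma : ∀ a b c t → (a ℤ.* t ℤ.+ a ℤ.* t) ℤ.+ (b ℤ.* t ℤ.+ c ℤ.* t) ≡ ((a ℤ.+ a) ℤ.+ (b ℤ.+ c)) ℤ.* t
    lemma = solve-∀
    lemma′ : ∀ a b c t → (t ℤ.* a ℤ.+ t ℤ.* a) ℤ.+ (t ℤ.* b ℤ.+ t ℤ.* c) ≡ t ℤ.* ((a ℤ.+ a) ℤ.+ (b ℤ.+ c))
    lemma′ = solve-∀
    row : ∀ x′ → X up down (tensor g h) (x′ , y) ≡ ι (g x′ ℤ.* Xh)
    row x′ = trans (sym (ι-four (g x′ ℤ.* h y) (g x′ ℤ.* h (cyclicSuc y)) (g x′ ℤ.* h (cyclicPred y))))
      (cong ι (lemma′ (h y) (h (cyclicSuc y)) (h (cyclicPred y)) (g x′)))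

  𝒜-cong : ∀ {φ χ : Vertex → ℚ} → φ ≗ χ → 𝒜 φ ≗ 𝒜 χ
  𝒜-cong e = X-cong right left (X-cong up down e)
    where
    X-cong : ∀ (s s⁻ : Vertex → Vertex) {φ χ : Vertex → ℚ} → φ ≗ χ → X s s⁻ φ ≗ X s s⁻ χ
    X-cong s s⁻ e v = cong₂ _+_ (cong₂ _+_ (e v) (e v)) (cong₂ _+_ (e (s v)) (e (s⁻ v)))

  𝒜^-tensor : ∀ j g h → (𝒜 ^ j) (tensor g h) ≗ tensor ((Xℤ ^ j) g) ((Xℤ ^ j) h)
  𝒜^-tensor zero    g h v = refl
  𝒜^-tensor (suc j) g h v = trans (𝒜-cong (𝒜^-tensor j g h) v) (𝒜-tensor ((Xℤ ^ j) g) ((Xℤ ^ j) h) v)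

  -- A comparison of the 2-adic valuations in 4ᵀ (Xʲ g)(x) (Xʲ h)(y) = 4ʲ z.
  valuation-bound : ∀ T → 0 < T → (∀ φ → Fix T φ) → ∀ j u v → Value n j u → Value m j v →
    2 ℕ.* j ≤ 2 ℕ.* T ℕ.+ (u ℕ.+ v)
  valuation-bound T 0<T fix j u v (g , x , w , gx) (h , y , w′ , hy) = bound
    where
    open ≡-Reasoning
    G H : ℤ
    G = (Xℤ ^ j) g x
    H = (Xℤ ^ j) h y
    divisible : ∃ λ z → 4^ T * (𝒜 ^ j) (tensor g h) (x , y) ≡ 4^ j * ι z
    divisible = 𝒜^-divisible T 0<T fix j (tensor g h) (λ (x , y) → g x ℤ.* h y , refl) ((x , y) , 0F)
    z : ℤ
    z = proj₁ divisible
    4^≡2^ : ∀ k → + (4 ℕ.^ k) ≡ 2^ (2 ℕ.* k)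
    4^≡2^ k = cong +_ (ℕ.^-*-assoc 2 2 k)
    integers : + (4 ℕ.^ T) ℤ.* (G ℤ.* H) ≡ + (4 ℕ.^ j) ℤ.* z
    integers = ι-injective (begin
      ι (+ (4 ℕ.^ T) ℤ.* (G ℤ.* H))               ≡⟨ ι-* (+ (4 ℕ.^ T)) (G ℤ.* H) ⟩
      4^ T * ι (G ℤ.* H)                          ≡⟨ cong (4^ T *_) (𝒜^-tensor j g h (x , y)) ⟨
      4^ T * (𝒜 ^ j) (tensor g h) (x , y)         ≡⟨ proj₂ divisible ⟩
      4^ j * ι z                                  ≡⟨ ι-* (+ (4 ℕ.^ j)) z ⟨
      ι (+ (4 ℕ.^ j) ℤ.* z)                       ∎)
    lemma : ∀ t p q w w′ →
      t ℤ.* (p ℤ.* (1ℤ ℤ.+ + 2 ℤ.* w) ℤ.* (q ℤ.* (1ℤ ℤ.+ + 2 ℤ.* w′)))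
      ≡ t ℤ.* (p ℤ.* q) ℤ.* (1ℤ ℤ.+ + 2 ℤ.* (w ℤ.+ w′ ℤ.+ + 2 ℤ.* (w ℤ.* w′)))
    lemma = solve-∀
    o : ℤ
    o = w ℤ.+ w′ ℤ.+ + 2 ℤ.* (w ℤ.* w′)
    bound : 2 ℕ.* j ≤ 2 ℕ.* T ℕ.+ (u ℕ.+ v)
    bound = valuation (2 ℕ.* T ℕ.+ (u ℕ.+ v)) (2 ℕ.* j) o z (begin
      2^ (2 ℕ.* T ℕ.+ (u ℕ.+ v)) ℤ.* (1ℤ ℤ.+ + 2 ℤ.* o)
        ≡⟨ cong (ℤ._* (1ℤ ℤ.+ + 2 ℤ.* o))
             (trans (2^-+ (2 ℕ.* T) (u ℕ.+ v)) (cong (2^ (2 ℕ.* T) ℤ.*_) (2^-+ u v))) ⟩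
      2^ (2 ℕ.* T) ℤ.* (2^ u ℤ.* 2^ v) ℤ.* (1ℤ ℤ.+ + 2 ℤ.* o)
        ≡⟨ lemma (2^ (2 ℕ.* T)) (2^ u) (2^ v) w w′ ⟨
      2^ (2 ℕ.* T) ℤ.* (2^ u ℤ.* (1ℤ ℤ.+ + 2 ℤ.* w) ℤ.* (2^ v ℤ.* (1ℤ ℤ.+ + 2 ℤ.* w′)))
        ≡⟨ cong₂ (λ t p → t ℤ.* p) (4^≡2^ T) (cong₂ ℤ._*_ gx hy) ⟨
      + (4 ℕ.^ T) ℤ.* (G ℤ.* H)
        ≡⟨ integers ⟩
      + (4 ℕ.^ j) ℤ.* z
        ≡⟨ cong (ℤ._* z) (4^≡2^ j) ⟩
      2^ (2 ℕ.* j) ℤ.* z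
        ∎)

  -- With u + v ≤ 3j/2 the bound gives j ≤ 4T, which the choice j = 2^(4T+1) violates.
  not-fixed : 3 ≤ n → 3 ≤ m → ¬ (n ≡ 4 × m ≡ 4) → ∀ T → 0 < T → ¬ (∀ φ → Fix T φ)
  not-fixed 3≤n 3≤m ≢4 T 0<T fix = contradiction (ℕ.+-cancelʳ-≤ (3 ℕ.* j) j (4 ℕ.* T) j+3j≤) (ℕ.<⇒≱ 4T<j)
    where
    k j : ℕ
    k = 4 ℕ.* T
    j = 2 ℕ.^ suc k
    k<2^k : ∀ k → k < 2 ℕ.^ k
    k<2^k zero    = ℕ.s≤s ℕ.z≤n
    k<2^k (suc k) = ℕ.+-mono-≤-< (ℕ.m^n>0 2 k) (ℕ.<-≤-trans (k<2^k k) (ℕ.m≤m+n (2 ℕ.^ k) 0))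
    4T<j : 4 ℕ.* T < j
    4T<j = ℕ.<-trans (k<2^k k) (ℕ.^-monoʳ-< 2 (ℕ.s≤s (ℕ.s≤s ℕ.z≤n)) (ℕ.n<1+n k))
    values : ∃ λ u → ∃ λ v → 2 ℕ.* (u ℕ.+ v) ≤ 3 ℕ.* j × Value n j u × Value m j v
    values with n ℕ.≟ 4
    ... | no n≢4 with small-value n 3≤n n≢4 k | value m 3≤m k
    ...   | u , 2u≤j , U | v , v≤j , V = u , v , (begin
        2 ℕ.* (u ℕ.+ v)          ≡⟨ ℕ.*-distribˡ-+ 2 u v ⟩
        2 ℕ.* u ℕ.+ 2 ℕ.* v      ≤⟨ ℕ.+-mono-≤ 2u≤j (ℕ.*-monoʳ-≤ 2 v≤j) ⟩
        3 ℕ.* j                  ∎) , U , V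
      where open ℕ.≤-Reasoning
    values | yes n≡4 with value n 3≤n k | small-value m 3≤m (λ m≡4 → ≢4 (n≡4 , m≡4)) k
    ...   | u , u≤j , U | v , 2v≤j , V = u , v , (begin
        2 ℕ.* (u ℕ.+ v)          ≡⟨ cong (2 ℕ.*_) (ℕ.+-comm u v) ⟩
        2 ℕ.* (v ℕ.+ u)          ≡⟨ ℕ.*-distribˡ-+ 2 v u ⟩
        2 ℕ.* v ℕ.+ 2 ℕ.* u      ≤⟨ ℕ.+-mono-≤ 2v≤j (ℕ.*-monoʳ-≤ 2 u≤j) ⟩
        3 ℕ.* j                  ∎) , U , V
      where open ℕ.≤-Reasoning
    u v : ℕ
    u = proj₁ values
    v = proj₁ (proj₂ values)
    u+v≤ : 2 ℕ.* (u ℕ.+ v) ≤ 3 ℕ.* j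
    u+v≤ = proj₁ (proj₂ (proj₂ values))
    value-n : Value n j u
    value-n = proj₁ (proj₂ (proj₂ (proj₂ values)))
    value-m : Value m j v
    value-m = proj₂ (proj₂ (proj₂ (proj₂ values)))
    j+3j≤ : j ℕ.+ 3 ℕ.* j ≤ 4 ℕ.* T ℕ.+ 3 ℕ.* j
    j+3j≤ = begin
      j ℕ.+ 3 ℕ.* j                          ≡⟨ ℕ.*-assoc 2 2 j ⟩
      2 ℕ.* (2 ℕ.* j)                        ≤⟨ ℕ.*-monoʳ-≤ 2 (valuation-bound T 0<T fix j u v value-n value-m) ⟩
      2 ℕ.* (2 ℕ.* T ℕ.+ (u ℕ.+ v))          ≡⟨ ℕ.*-distribˡ-+ 2 (2 ℕ.* T) (u ℕ.+ v) ⟩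
      2 ℕ.* (2 ℕ.* T) ℕ.+ 2 ℕ.* (u ℕ.+ v)    ≤⟨ ℕ.+-mono-≤ (ℕ.≤-reflexive (sym (ℕ.*-assoc 2 2 T))) u+v≤ ⟩
      4 ℕ.* T ℕ.+ 3 ℕ.* j                    ∎
      where open ℕ.≤-Reasoning

------------------------------------------------------------------------
-- The characterisation

cyclicSuc-involutive : ∀ k .{{_ : NonZero k}} → k ≤ 2 → ∀ (x : Fin k) → cyclicSuc (cyclicSuc x) ≡ x
cyclicSuc-involutive 1 _ x = trans (cyclicSuc-order {1} (cyclicSuc x)) (cyclicSuc-order {1} x)
cyclicSuc-involutive 2 _ x = cyclicSuc-order {2} x
cyclicSuc-involutive (suc (suc (suc _))) (ℕ.s≤s (ℕ.s≤s ()))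

theorem6p1 : ∀ (n m : ℕ) .{{_ : NonZero n}} .{{_ : NonZero m}} →
    Grid.Periodic n m ⇔ (n ⊓ m ≤ 2 ⊎ (n ≡ 4 × m ≡ 4))
theorem6p1 n m = mk⇔ necessary sufficient
  where
  open Grid n m using (Periodic)
  open GridWalk n m
  open Period n m
  open WalkProperties walk using (swap)
  open Fixed walk using (Fix; returning)

  fixed⇒bound : ∀ T → 0 < T → (∀ φ → Fix T φ) → n ⊓ m ≤ 2 ⊎ (n ≡ 4 × m ≡ 4)
  fixed⇒bound T 0<T fix with n ⊓ m ℕ.≤? 2 | (n ℕ.≟ 4) ×-dec (m ℕ.≟ 4)
  ... | yes ≤2 | _      = inj₁ ≤2
  ... | no _   | yes ≡4 = inj₂ ≡4
  ... | no ≰2  | no ≢4  =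
    contradiction fix (Torus.not-fixed n m (3≤ (ℕ.m⊓n≤m n m)) (3≤ (ℕ.m⊓n≤n n m)) ≢4 T 0<T)
    where
    3≤ : ∀ {k} → n ⊓ m ≤ k → 3 ≤ k
    3≤ = ℕ.≤-trans (ℕ.≰⇒> ≰2)

  necessary : Periodic → n ⊓ m ≤ 2 ⊎ (n ≡ 4 × m ≡ 4)
  necessary periodic = let T , 0<T , fix = periodic⇒fixed periodic in fixed⇒bound T 0<T fix

  n≤2⇒periodic : n ≤ 2 → Periodic
  n≤2⇒periodic n≤2 = fixed⇒periodic (2 ℕ.* m) (ℕ.<-≤-trans (ℕ.>-nonZero⁻¹ m) (ℕ.m≤n*m m 2))
    (Periodicity.involution⇒fixed walk
      (λ (x , y) → cong (_, y) (cyclicSuc-involutive n n≤2 x)) m up-order down-order)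

  m≤2⇒periodic : m ≤ 2 → Periodic
  m≤2⇒periodic m≤2 = fixed⇒periodic (2 ℕ.* n) (ℕ.<-≤-trans (ℕ.>-nonZero⁻¹ n) (ℕ.m≤n*m n 2))
    (λ φ → returning (Fixed.return (Periodicity.involution⇒fixed swap
      (λ (x , y) → cong (x ,_) (cyclicSuc-involutive m m≤2 y)) n right-order left-order φ)))

  4×4⇒periodic : n ≡ 4 → m ≡ 4 → Periodic
  4×4⇒periodic n≡4 m≡4 = fixed⇒periodic 12 ℕ.z<s
    (Periodicity.order-4⇒fixed walk
      (subst (λ k → ∀ x → (right ^ k) x ≡ x) n≡4 right-order)
      (subst (λ k → ∀ x → (left ^ k) x ≡ x) n≡4 left-order)
      (subst (λ k → ∀ x → (up ^ k) x ≡ x) m≡4 up-order)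
      (subst (λ k → ∀ x → (down ^ k) x ≡ x) m≡4 down-order))

  sufficient : n ⊓ m ≤ 2 ⊎ (n ≡ 4 × m ≡ 4) → Periodic
  sufficient (inj₁ ≤2) = [ (λ ⊓≡n → n≤2⇒periodic (subst (_≤ 2) ⊓≡n ≤2))
                         , (λ ⊓≡m → m≤2⇒periodic (subst (_≤ 2) ⊓≡m ≤2)) ]′ (ℕ.⊓-sel n m)
  sufficient (inj₂ (n≡4 , m≡4)) = 4×4⇒periodic n≡4 m≡4
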